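{- Fix integers $\lambda \geq 2$ and $\mu \geq 0$, and a polynomial $\alpha \in \mathbb{Z}[n,k]$ such that $\alpha(mn, mk) = m^2 \alpha(n,k)$ (identically) and $\alpha(0,k) = k^2$. For integers $n\ge 0$ define \[ A^{(\lambda,\mu)}_q(n) = \sum_{k=0}^n q^{\alpha(n,k)} \binom{n}{k}_q^{\lambda}\binom{n+k}{k}_q^{\mu}. \] Then for every positive integer $m$ and every integer $n\ge 0$, \[ A^{(\lambda,\mu)}_q(mn) \equiv A^{(\lambda,\mu)}_{q^{m^2}}(n) - \frac{m^2-1}{12}(q^m-1)^2 R^{(\lambda,\mu)}(n) \pmod{\Phi_m(q)^3}, \] where $A^{(\lambda,\mu)}_{q^{m^2}}(n)$ is $A^{(\lambda,\mu)}_q(n)$ with $q$ replaced by $q^{m^2}$, and \[ R^{(\lambda,\mu)}(n) = \sum_{k = 0}^{n} c^{(\lambda,\mu)}_{n,k}\binom{n}{k}^{\lambda}\binom{n+k}{k}^{\mu}, \qquad c^{(\lambda,\mu)}_{n,k} = \begin{cases} n^2 + (\mu-2)\frac{nk}{2}, & \lambda = 2,\\ ((\lambda+\mu)n - \lambda k)\frac{k}{2}, & \lambda > 2.\end{cases} \]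
   Context: $[n]_q = 1+q+\cdots+q^{n-1}$, $[n]_q! = [n]_q\cdots[1]_q$, and for $0\le k\le n$, $\binom{n}{k}_q = \frac{[n]_q!}{[k]_q![n-k]_q!}$. $\Phi_m(q)$ is the $m$th cyclotomic polynomial. A congruence $f\equiv g \pmod{\varphi(q)}$ means $f-g = h\varphi$ for some $h \in \mathbb{Q}[q^{\pm1}]$. -}

module Defs where

open import Data.Nat as ℕ using (ℕ; zero; suc; _≤ᵇ_)
open import Data.Nat.Divisibility using (_∣?_)
open import Data.Nat.Combinatorics using (_C_)
open import Data.Integer as ℤ using (ℤ; +_)
open import Data.Rational as ℚ using (ℚ; 0ℚ; 1ℚ)
open import Data.List using (List; []; _∷_; _++_; map; foldr; length; reverse; replicate; concatMap; upTo)
open import Data.Product using (_×_; _,_; ∃)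
open import Data.Bool using (if_then_else_)
open import Relation.Nullary.Decidable using (⌊_⌋)
open import Relation.Binary.PropositionalEquality using (_≡_)

-- Dense polynomials over ℤ in q: coefficient lists, lowest degree first.

ZPoly : Set
ZPoly = List ℤ

zadd : ZPoly → ZPoly → ZPoly
zadd [] bs = bs
zadd as [] = as
zadd (a ∷ as) (b ∷ bs) = (a ℤ.+ b) ∷ zadd as bs

zscale : ℤ → ZPoly → ZPoly
zscale c = map (c ℤ.*_)

zmul : ZPoly → ZPoly → ZPoly
zmul [] bs = []
zmul (a ∷ as) bs = zadd (zscale a bs) (+ 0 ∷ zmul as bs)

zone : ZPoly
zone = + 1 ∷ []

zprod : List ZPoly → ZPoly
zprod = foldr zmul zone

qpowMinusOne : ℕ → ZPoly
qpowMinusOne zero = []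
qpowMinusOne (suc m) = ℤ.-[1+ 0 ] ∷ (replicate m (+ 0) ++ (+ 1 ∷ []))

-- Long division by a monic polynomial, in high-degree-first form.
-- subHF c as bt : subtract c * bt from the leading part of as.
subHF : ℤ → List ℤ → List ℤ → List ℤ
subHF c as [] = as
subHF c [] bs = []
subHF c (a ∷ as) (b ∷ bs) = (a ℤ.- c ℤ.* b) ∷ subHF c as bs

-- divHF fuel a bt : quotient (high first) of a by the monic
-- polynomial whose high-first coefficient list is 1 ∷ bt.
divHF : ℕ → List ℤ → List ℤ → List ℤ
divHF zero _ _ = []
divHF (suc f) [] bt = []
divHF (suc f) (c ∷ as) bt =
  if length bt ≤ᵇ length as then c ∷ divHF f (subHF c as bt) bt else []

-- Quotient of a by a monic polynomial b (b given lowest degree first,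
-- with leading coefficient 1 and no trailing zeros).
zdivMonic : ZPoly → ZPoly → ZPoly
zdivMonic a b with reverse b
... | [] = []
... | (_ ∷ bt) = reverse (divHF (length a) (reverse a) bt)

mutual
  cycloTable : ℕ → List (ℕ × ZPoly)
  cycloTable zero = []
  cycloTable (suc n) = cycloTable n ++ ((suc n , cyclo (suc n)) ∷ [])

  cyclo : ℕ → ZPoly
  cyclo zero = zone        -- unused convention (Φ_0 is never used)
  cyclo (suc n) =
    zdivMonic (qpowMinusOne (suc n))
              (zprod (concatMap (λ { (d , p) → if ⌊ d ∣? suc n ⌋ then p ∷ [] else [] })
                                (cycloTable n)))

qint : ℕ → ZPoly
qint n = replicate n (+ 1)

qfact : ℕ → ZPoly
qfact zero = zone
qfact (suc n) = zmul (qint (suc n)) (qfact n)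

-- binom n k _q = [n]_q! / ([k]_q! [n-k]_q!)   (exact division; used for k ≤ n)
qbinom : ℕ → ℕ → ZPoly
qbinom n k = zdivMonic (qfact n) (zmul (qfact k) (qfact (n ℕ.∸ k)))

-- Laurent polynomials over ℚ in q: finite formal sums of monomials c·q^e.

LPoly : Set
LPoly = List (ℤ × ℚ)

coeff : LPoly → ℤ → ℚ
coeff [] e = 0ℚ
coeff ((e' , c) ∷ f) e = if ⌊ e' ℤ.≟ e ⌋ then c ℚ.+ coeff f e else coeff f e

_≈L_ : LPoly → LPoly → Set
f ≈L g = ∀ e → coeff f e ≡ coeff g e

_+L_ : LPoly → LPoly → LPoly
f +L g = f ++ g

-L_ : LPoly → LPoly
-L f = map (λ { (e , c) → (e , ℚ.- c) }) f

_-L_ : LPoly → LPoly → LPoly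
f -L g = f +L (-L g)

_*L_ : LPoly → LPoly → LPoly
f *L g = concatMap (λ { (e , c) → map (λ { (e' , c') → (e ℤ.+ e' , c ℚ.* c') }) g }) f

oneL : LPoly
oneL = (+ 0 , 1ℚ) ∷ []

constL : ℚ → LPoly
constL c = (+ 0 , c) ∷ []

monoL : ℤ → LPoly
monoL e = (e , 1ℚ) ∷ []

powL : LPoly → ℕ → LPoly
powL f zero = oneL
powL f (suc n) = f *L powL f n

sumL : List LPoly → LPoly
sumL = foldr _+L_ []

substPow : ℤ → LPoly → LPoly
substPow d = map (λ { (e , c) → (d ℤ.* e , c) })

fromZPoly : ZPoly → LPoly
fromZPoly = go (+ 0)
  where
  go : ℤ → ZPoly → LPoly
  go e [] = []
  go e (a ∷ as) = (e , a ℚ./ 1) ∷ go (ℤ.suc e) as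

CongMod : LPoly → LPoly → LPoly → Set
CongMod φ f g = ∃ λ h → (f -L g) ≈L (h *L φ)

-- Polynomials in ℤ[n,k]: finite sums of monomials c · n^i · k^j

BiPoly : Set
BiPoly = List (ℕ × ℕ × ℤ)

evalBi : BiPoly → ℤ → ℤ → ℤ
evalBi α n k = foldr (λ { (i , j , c) r → c ℤ.* (n ℤ.^ i) ℤ.* (k ℤ.^ j) ℤ.+ r }) (+ 0) α

A : ℕ → ℕ → BiPoly → ℕ → LPoly
A lam mu α n = sumL (map (λ k →
      monoL (evalBi α (+ n) (+ k))
        *L (powL (fromZPoly (qbinom n k)) lam
        *L powL (fromZPoly (qbinom (n ℕ.+ k) k)) mu))
   (upTo (suc n)))

cc : ℕ → ℕ → ℕ → ℕ → ℚ
cc lam mu n k =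
  if ⌊ lam ℕ.≟ 2 ⌋
  then (ℤ.+ (n ℕ.* n)) ℚ./ 1 ℚ.+ ((((+ mu) ℤ.- (+ 2)) ℤ.* (+ (n ℕ.* k))) ℚ./ 2)
  else ((((+ ((lam ℕ.+ mu) ℕ.* n)) ℤ.- (+ (lam ℕ.* k))) ℤ.* (+ k)) ℚ./ 2)

R : ℕ → ℕ → ℕ → ℚ
R lam mu n = foldr ℚ._+_ 0ℚ (map (λ k →
      cc lam mu n k ℚ.* ((+ ((n C k) ℕ.^ lam ℕ.* ((n ℕ.+ k) C k) ℕ.^ mu)) ℚ./ 1))
   (upTo (suc n)))

{-# OPTIONS --safe #-}
module Submission where

-- Work in ℚ[q^±]/Φ_m³ and put t = q^m - 1, Q = q^m. Then t³ = 0, so every expression in powers of Q is a quadratic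
-- polynomial in t, and 1 - q^r is a unit for 0 < r < m. Let F(s) = ∏_{0<r<m} (1 - Q^s q^r). The q-binomial theorem gives
-- F(s) = Σ_j T_j Q^{sj} with t² T_j = t², and r ↦ m - r gives F(-1) = ε F(0) with ε² = Q^{1-m}. Together these determine
-- F(s)/F(0), and the outcome is
--   F(s) [s+1]_Q = F(0) [s+1]_{q^{m²}} (1 - (m²-1)/24 s t²).
-- Taking products over s, binom(mn,mk)_q = binom(n,k)_{q^{m²}} (1 - (m²-1)/24 k(n-k) t²), which settles the summands of
-- A_q(mn) at multiples of m. At k = mj + r with 0 < r < m the binomial is a multiple of t, so the summand vanishes when
-- λ > 2; when λ = 2 it is ((n-j) C(n,j))² C(n+j,j)^μ q^{r²} binom(m,r)_q². Finally Σ_{0<r<m} q^{r²} binom(m,r)_q² equals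
-- -(m²-1)/12 t²: compare q-Vandermonde for binom(2m,m)_q with the formula for binom(mn,mk)_q at n = 2, k = 1.

open import Defs
open import Data.Nat using (ℕ; zero; suc; _≤_)
open import Data.Integer as ℤ using (ℤ; +_; -[1+_]; 0ℤ; 1ℤ)
open import Data.Rational as ℚ using (ℚ; mkℚ; 0ℚ; 1ℚ; ½)
open import Relation.Binary.PropositionalEquality as ≡ using (_≡_; _≢_; cong; cong₂)
open import Algebra.Bundles using (CommutativeMonoid; CommutativeRing; RawRing)
import Algebra.Properties.CommutativeSemigroup as CommutativeSemigroupProperties
import Algebra.Properties.Ring as RingProperties
import Algebra.Solver.Ring as RingSolver
open import Algebra.Solver.Ring.AlmostCommutativeRing using (fromCommutativeRing; _-Raw-AlmostCommutative⟶_)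
open import Data.Bool using (true; false; if_then_else_; T)
open import Data.Empty using (⊥; ⊥-elim)
import Data.Integer.Divisibility.Signed as ℤ∣
import Data.Integer.Properties as ℤₚ
open import Data.Integer.Solver using () renaming (module +-*-Solver to ℤSolver)
open import Data.List using (List; []; _∷_; _++_; map; foldr; concatMap; length; reverse; replicate; applyUpTo; upTo)
import Data.List.Properties as Listₚ
open import Data.List.Relation.Unary.All as All using (All)
open import Data.List.Relation.Unary.All.Properties using (++⁺)
open import Data.Maybe using (Maybe; just; nothing)
import Data.Nat as ℕ
open import Data.Nat.Combinatorics using (_C_; nCk+nC[k+1]≡[n+1]C[k+1]; nCk≡nC[n∸k]; nCn≡1; k>n⇒nCk≡0)
open import Data.Nat.Divisibility using (_∣_; _∤_; _∣?_; divides; ∣⇒≤; 0∣⇒≡0; ∣-trans; ∣-refl)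
open import Data.Nat.GCD using (gcd; gcd[m,n]∣m; gcd[m,n]∣n; gcd-GCD; module Bézout)
import Data.Nat.Properties as ℕₚ
open import Data.Product using (∃; _×_; _,_; proj₁; proj₂)
import Data.Rational.Properties as ℚₚ
open import Data.Rational.Solver using () renaming (module +-*-Solver to ℚS)
import Data.Rational.Unnormalised as ℚᵘ
import Data.Rational.Unnormalised.Properties as ℚᵘₚ
open import Data.Sum using (_⊎_; inj₁; inj₂)
open import Level using (0ℓ)
import Relation.Binary.Reasoning.Setoid as SetoidReasoning
open import Relation.Nullary using (yes; no)
open import Relation.Nullary.Decidable using (⌊_⌋)

-- They are therefore cancelled over ℚ[q^±], where 1 - q^k is no zero divisor, and only the
-- resulting identity between products of F(s) [s+1]_Q, which are units modulo Φ_m³, is carried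
-- over. `LaurentAlgebra` lets the same lemmas serve ℚ[q^±], its quotient, and both with q replaced
-- by q^(m²).
--
-- The facts t³ = 0 and invertibility of 1 - q^r must be extracted from a definition of Φ_m by
-- repeated long division: Φ_m has to divide q^m - 1 and to be comaximal with q^r - 1 for m not
-- dividing r. The exact quotient is at first known only as a Laurent polynomial; a leading
-- coefficient 1 and an invertible constant coefficient of the divisor together identify it with the
-- output of the division algorithm.

private module ℤS where
  open ℤSolver public using (solve; con) renaming (_:+_ to _:+ᶻ_; _:-_ to _:-ᶻ_; _:*_ to _:*ᶻ_; :-_ to :-ᶻ_; _:=_ to _:=ᶻ_)

  :1ᶻ : ∀ {n} → ℤSolver.Polynomial n
  :1ᶻ = con 1ℤ

open ℤS using (:1ᶻ; _:+ᶻ_; _:-ᶻ_; _:*ᶻ_; :-ᶻ_; _:=ᶻ_)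

-- Finite sums and products over initial segments of ℕ.

module BigOperator (M : CommutativeMonoid 0ℓ 0ℓ) where
  open CommutativeMonoid M
  open CommutativeSemigroupProperties commutativeSemigroup using (interchange)

  fold : (ℕ → Carrier) → ℕ → Carrier
  fold f zero = ε
  fold f (suc n) = f 0 ∙ fold (λ i → f (suc i)) n

  fold-cong< : ∀ {f g} n → (∀ i → i ℕ.< n → f i ≈ g i) → fold f n ≈ fold g n
  fold-cong< zero h = refl
  fold-cong< (suc n) h = ∙-cong (h 0 ℕ.z<s) (fold-cong< n (λ i i<n → h (suc i) (ℕ.s<s i<n)))

  fold-cong : ∀ {f g} n → (∀ i → f i ≈ g i) → fold f n ≈ fold g n
  fold-cong n h = fold-cong< n (λ i _ → h i)

  fold-ε : ∀ n {f} → (∀ i → i ℕ.< n → f i ≈ ε) → fold f n ≈ ε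
  fold-ε zero h = refl
  fold-ε (suc n) h = trans (∙-cong (h 0 ℕ.z<s) (fold-ε n (λ i i<n → h (suc i) (ℕ.s<s i<n)))) (identityˡ ε)

  fold-∙ : ∀ f g n → fold (λ i → f i ∙ g i) n ≈ fold f n ∙ fold g n
  fold-∙ f g zero = sym (identityˡ ε)
  fold-∙ f g (suc n) = trans (∙-congˡ (fold-∙ _ _ n)) (interchange _ _ _ _)

  fold-snoc : ∀ f n → fold f (suc n) ≈ fold f n ∙ f n
  fold-snoc f zero = comm _ _
  fold-snoc f (suc n) = trans (∙-congˡ (fold-snoc _ n)) (sym (assoc _ _ _))

  fold-+ : ∀ f a b → fold f (a ℕ.+ b) ≈ fold f a ∙ fold (λ i → f (a ℕ.+ i)) b
  fold-+ f zero b = sym (identityˡ _)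
  fold-+ f (suc a) b = trans (∙-congˡ (fold-+ _ a b)) (sym (assoc _ _ _))

  fold-blocks : ∀ f n m → fold f (n ℕ.* m) ≈ fold (λ j → fold (λ r → f (j ℕ.* m ℕ.+ r)) m) n
  fold-blocks f zero m = refl
  fold-blocks f (suc n) m = trans (fold-+ f m (n ℕ.* m)) (∙-congˡ (trans (fold-blocks _ n m)
    (fold-cong n (λ j → fold-cong m (λ r → reflexive (≡.cong f (≡.sym (ℕₚ.+-assoc m (j ℕ.* m) r))))))))

  fold-reverse : ∀ f n → fold f n ≈ fold (λ i → f (n ℕ.∸ suc i)) n
  fold-reverse f zero = refl
  fold-reverse f (suc n) = trans (fold-snoc f n) (trans (comm _ _) (∙-congˡ (fold-reverse f n)))

-- Integers and unit fractions inside ℚ.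

fromℤ : ℤ → ℚ
fromℤ i = i ℚ./ 1

-- `i / 1` is normalised through a gcd and does not reduce for a variable i. The equation is
-- therefore checked in the unnormalised rationals, where it is a cross-multiplication.
fromℤ-homo : ∀ i j (_∙_ : ℚ → ℚ → ℚ) (_∙ᵘ_ : ℚᵘ.ℚᵘ → ℚᵘ.ℚᵘ → ℚᵘ.ℚᵘ) (_∙ᶻ_ : ℤ → ℤ → ℤ) →
  (∀ p q → ℚ.toℚᵘ (p ∙ q) ℚᵘ.≃ ℚ.toℚᵘ p ∙ᵘ ℚ.toℚᵘ q) →
  (∀ {p q r s} → p ℚᵘ.≃ q → r ℚᵘ.≃ s → p ∙ᵘ r ℚᵘ.≃ q ∙ᵘ s) →
  (ℚᵘ.mkℚᵘ i 0 ∙ᵘ ℚᵘ.mkℚᵘ j 0 ℚᵘ.≃ ℚᵘ.mkℚᵘ (i ∙ᶻ j) 0) →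
  fromℤ (i ∙ᶻ j) ≡ fromℤ i ∙ fromℤ j
fromℤ-homo i j _∙_ _∙ᵘ_ _∙ᶻ_ homo cong h = ℚₚ.toℚᵘ-injective (begin
    ℚ.toℚᵘ (fromℤ (i ∙ᶻ j)) ≈⟨ ℚₚ.toℚᵘ-fromℚᵘ (ℚᵘ.mkℚᵘ (i ∙ᶻ j) 0) ⟩
    ℚᵘ.mkℚᵘ (i ∙ᶻ j) 0 ≈⟨ h ⟨
    ℚᵘ.mkℚᵘ i 0 ∙ᵘ ℚᵘ.mkℚᵘ j 0 ≈⟨ cong (ℚₚ.toℚᵘ-fromℚᵘ (ℚᵘ.mkℚᵘ i 0)) (ℚₚ.toℚᵘ-fromℚᵘ (ℚᵘ.mkℚᵘ j 0)) ⟨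
    ℚ.toℚᵘ (fromℤ i) ∙ᵘ ℚ.toℚᵘ (fromℤ j) ≈⟨ homo (fromℤ i) (fromℤ j) ⟨
    ℚ.toℚᵘ (fromℤ i ∙ fromℤ j) ∎)
  where open SetoidReasoning ℚᵘₚ.≃-setoid

fromℤ-+ : ∀ i j → fromℤ (i ℤ.+ j) ≡ fromℤ i ℚ.+ fromℤ j
fromℤ-+ i j = fromℤ-homo i j ℚ._+_ ℚᵘ._+_ ℤ._+_ ℚₚ.toℚᵘ-homo-+ ℚᵘₚ.+-cong
  (ℚᵘ.*≡* (≡.cong (ℤ._* 1ℤ) (≡.cong₂ ℤ._+_ (ℤₚ.*-identityʳ i) (ℤₚ.*-identityʳ j))))

fromℤ-* : ∀ i j → fromℤ (i ℤ.* j) ≡ fromℤ i ℚ.* fromℤ j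
fromℤ-* i j = fromℤ-homo i j ℚ._*_ ℚᵘ._*_ ℤ._*_ ℚₚ.toℚᵘ-homo-* ℚᵘₚ.*-cong (ℚᵘ.*≡* ≡.refl)

/-as-* : ∀ i n .{{_ : ℕ.NonZero n}} → i ℚ./ n ≡ fromℤ i ℚ.* (1ℤ ℚ./ n)
/-as-* i n@(suc k) = ℚₚ.toℚᵘ-injective (begin
    ℚ.toℚᵘ (i ℚ./ n) ≈⟨ ℚₚ.toℚᵘ-fromℚᵘ (ℚᵘ.mkℚᵘ i k) ⟩
    ℚᵘ.mkℚᵘ i k ≈⟨ ℚᵘ.*≡* (≡.cong₂ ℤ._*_ (ℤₚ.*-identityʳ i) (≡.cong (λ d → + suc d) (≡.sym (ℕₚ.+-identityʳ k)))) ⟨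
    ℚᵘ.mkℚᵘ i 0 ℚᵘ.* ℚᵘ.mkℚᵘ 1ℤ k ≈⟨ ℚᵘₚ.*-cong (ℚₚ.toℚᵘ-fromℚᵘ (ℚᵘ.mkℚᵘ i 0)) (ℚₚ.toℚᵘ-fromℚᵘ (ℚᵘ.mkℚᵘ 1ℤ k)) ⟨
    ℚ.toℚᵘ (fromℤ i) ℚᵘ.* ℚ.toℚᵘ (1ℤ ℚ./ n) ≈⟨ ℚₚ.toℚᵘ-homo-* (fromℤ i) (1ℤ ℚ./ n) ⟨
    ℚ.toℚᵘ (fromℤ i ℚ.* (1ℤ ℚ./ n)) ∎)
  where open SetoidReasoning ℚᵘₚ.≃-setoid

fromℤ-inverse : ∀ k → fromℤ (+ suc k) ℚ.* (1ℤ ℚ./ suc k) ≡ 1ℚ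
fromℤ-inverse k = ≡.trans (≡.sym (/-as-* (+ suc k) (suc k)))
  (ℚₚ.toℚᵘ-injective (ℚᵘₚ.≃-trans (ℚₚ.toℚᵘ-fromℚᵘ (ℚᵘ.mkℚᵘ (+ suc k) k)) (ℚᵘ.*≡* (ℤₚ.*-comm (+ suc k) 1ℤ))))

-- X e plays the role of q^e.
record LaurentAlgebra : Set₁ where
  field
    commutativeRing : CommutativeRing 0ℓ 0ℓ
  open CommutativeRing commutativeRing public
  field
    ι : ℚ → Carrier
    ι-+ : ∀ a b → ι (a ℚ.+ b) ≈ ι a + ι b
    ι-* : ∀ a b → ι (a ℚ.* b) ≈ ι a * ι b
    ι-neg : ∀ a → ι (ℚ.- a) ≈ - ι a
    ι-0 : ι 0ℚ ≈ 0#
    ι-1 : ι 1ℚ ≈ 1#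
    X : ℤ → Carrier
    X-+ : ∀ a b → X (a ℤ.+ b) ≈ X a * X b
    X-0 : X 0ℤ ≈ 1#

-- Ring solver, sums, powers and units over a Laurent algebra.

module Kit (A : LaurentAlgebra) where
  open LaurentAlgebra A public
  open RingProperties ring public
    using (-0#≈0#; -‿distribˡ-*; -‿distribʳ-*; -‿involutive; x∙y⁻¹≈ε⇒x≈y)
  open SetoidReasoning setoid public

  private
    -- The literals 0 and 1 bypass `ι`, so that solver equations contain `0#` and `1#` exactly as
    -- the goals do.
    ⟦_⟧ᶜ : ℚ → Carrier
    ⟦ mkℚ (+ 0) 0 _ ⟧ᶜ = 0#
    ⟦ mkℚ (+ 1) 0 _ ⟧ᶜ = 1#
    ⟦ c ⟧ᶜ = ι c

    ⟦⟧≈ι : ∀ c → ⟦ c ⟧ᶜ ≈ ι c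
    ⟦⟧≈ι (mkℚ (+ 0) 0 _) = sym ι-0
    ⟦⟧≈ι (mkℚ (+ 1) 0 _) = sym ι-1
    ⟦⟧≈ι (mkℚ (+ 0) (suc _) _) = refl
    ⟦⟧≈ι (mkℚ (+ 1) (suc _) _) = refl
    ⟦⟧≈ι (mkℚ (+ suc (suc _)) _ _) = refl
    ⟦⟧≈ι (mkℚ -[1+ _ ] _ _) = refl

    rawℚ : RawRing 0ℓ 0ℓ
    rawℚ = record { Carrier = ℚ ; _≈_ = _≡_ ; _+_ = ℚ._+_ ; _*_ = ℚ._*_ ; -_ = ℚ.-_ ; 0# = 0ℚ ; 1# = 1ℚ }

    morphism : rawℚ -Raw-AlmostCommutative⟶ fromCommutativeRing commutativeRing
    morphism = record
      { ⟦_⟧ = ⟦_⟧ᶜ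
      ; +-homo = λ a b → trans (⟦⟧≈ι (a ℚ.+ b)) (trans (ι-+ a b) (sym (+-cong (⟦⟧≈ι a) (⟦⟧≈ι b))))
      ; *-homo = λ a b → trans (⟦⟧≈ι (a ℚ.* b)) (trans (ι-* a b) (sym (*-cong (⟦⟧≈ι a) (⟦⟧≈ι b))))
      ; -‿homo = λ a → trans (⟦⟧≈ι (ℚ.- a)) (trans (ι-neg a) (sym (-‿cong (⟦⟧≈ι a))))
      ; 0-homo = refl
      ; 1-homo = refl
      }

    coeff≟ : ∀ a b → Maybe (⟦ a ⟧ᶜ ≈ ⟦ b ⟧ᶜ)
    coeff≟ a b with a ℚ.≟ b
    ... | yes ≡.refl = just refl
    ... | no _ = nothing

  module Solver = RingSolver rawℚ (fromCommutativeRing commutativeRing) morphism coeff≟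

  open Solver public using (solve; _:=_; con; _:+_; _:*_; :-_; _:-_)

  :0 :1 : ∀ {n} → Solver.Polynomial n
  :0 = con 0ℚ
  :1 = con 1ℚ

  module Sum = BigOperator +-commutativeMonoid
  module Product = BigOperator *-commutativeMonoid

  ∑ ∏ : (ℕ → Carrier) → ℕ → Carrier
  ∑ = Sum.fold
  ∏ = Product.fold

  ∑-*ˡ : ∀ c f n → c * ∑ f n ≈ ∑ (λ i → c * f i) n
  ∑-*ˡ c f zero = zeroʳ c
  ∑-*ˡ c f (suc n) = trans (distribˡ c _ _) (+-congˡ (∑-*ˡ c _ n))

  pow : Carrier → ℕ → Carrier
  pow x zero = 1#
  pow x (suc n) = x * pow x n

  pow-cong : ∀ {x y} n → x ≈ y → pow x n ≈ pow y n
  pow-cong zero e = refl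
  pow-cong (suc n) e = *-cong e (pow-cong n e)

  pow-* : ∀ x y n → pow (x * y) n ≈ pow x n * pow y n
  pow-* x y zero = sym (*-identityˡ 1#)
  pow-* x y (suc n) = trans (*-congˡ (pow-* x y n))
    (solve 4 (λ a b c d → a :* b :* (c :* d) := a :* c :* (b :* d)) refl x y (pow x n) (pow y n))

  pow-+ : ∀ x a b → pow x (a ℕ.+ b) ≈ pow x a * pow x b
  pow-+ x zero b = sym (*-identityˡ _)
  pow-+ x (suc a) b = trans (*-congˡ (pow-+ x a b)) (sym (*-assoc _ _ _))

  ∏-const : ∀ x n → ∏ (λ _ → x) n ≈ pow x n
  ∏-const x zero = refl
  ∏-const x (suc n) = *-congˡ (∏-const x n)

  zz : ℤ → Carrier
  zz i = ι (fromℤ i)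

  zz-+ : ∀ i j → zz (i ℤ.+ j) ≈ zz i + zz j
  zz-+ i j = trans (reflexive (≡.cong ι (fromℤ-+ i j))) (ι-+ _ _)

  zz-* : ∀ i j → zz (i ℤ.* j) ≈ zz i * zz j
  zz-* i j = trans (reflexive (≡.cong ι (fromℤ-* i j))) (ι-* _ _)

  nn : ℕ → Carrier
  nn n = zz (+ n)

  nn-suc : ∀ n → nn (suc n) ≈ 1# + nn n
  nn-suc n = trans (zz-+ (+ 1) (+ n)) (+-congʳ ι-1)

  nn-0 : nn 0 ≈ 0#
  nn-0 = ι-0

  nn-+ : ∀ a b → nn (a ℕ.+ b) ≈ nn a + nn b
  nn-+ a b = zz-+ (+ a) (+ b)

  nn-* : ∀ a b → nn (a ℕ.* b) ≈ nn a * nn b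
  nn-* a b = trans (reflexive (≡.cong zz (ℤₚ.pos-* a b))) (zz-* (+ a) (+ b))

  zz-neg : ∀ i → zz (ℤ.- i) ≈ - zz i
  zz-neg i = begin
      zz (ℤ.- i) ≈⟨ solve 2 (λ a b → a := (b :+ a) :- b) refl (zz (ℤ.- i)) (zz i) ⟩
      (zz i + zz (ℤ.- i)) - zz i ≈⟨ +-congʳ (trans (sym (zz-+ i (ℤ.- i))) (trans (reflexive (≡.cong zz (ℤₚ.+-inverseʳ i))) ι-0)) ⟩
      0# - zz i ≈⟨ +-identityˡ _ ⟩
      - zz i ∎

  X-congʳ : ∀ {a b} → a ≡ b → X a ≈ X b
  X-congʳ e = reflexive (≡.cong X e)

  IsUnit : Carrier → Set
  IsUnit a = ∃ λ b → a * b ≈ 1#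

  unit-cong : ∀ {a b} → a ≈ b → IsUnit a → IsUnit b
  unit-cong e (u , p) = u , trans (*-congʳ (sym e)) p

  unit-1 : IsUnit 1#
  unit-1 = 1# , *-identityˡ 1#

  unit-* : ∀ {a b} → IsUnit a → IsUnit b → IsUnit (a * b)
  unit-* {a} {b} (u , p) (v , q) = u * v , (begin
      a * b * (u * v) ≈⟨ solve 4 (λ a b u v → a :* b :* (u :* v) := a :* u :* (b :* v)) refl a b u v ⟩
      a * u * (b * v) ≈⟨ *-cong p q ⟩
      1# * 1# ≈⟨ *-identityˡ 1# ⟩
      1# ∎)

  unit-∏ : ∀ f n → (∀ i → i ℕ.< n → IsUnit (f i)) → IsUnit (∏ f n)
  unit-∏ f zero h = unit-1
  unit-∏ f (suc n) h = unit-* (h 0 ℕ.z<s) (unit-∏ _ n (λ i l → h (suc i) (ℕ.s<s l)))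

  unit-pow : ∀ {a} n → IsUnit a → IsUnit (pow a n)
  unit-pow zero u = unit-1
  unit-pow (suc n) u = unit-* u (unit-pow n u)

  unit-cancelˡ : ∀ {a x y} → IsUnit a → a * x ≈ a * y → x ≈ y
  unit-cancelˡ {a} {x} {y} (u , p) e = begin
      x ≈⟨ *-identityˡ x ⟨
      1# * x ≈⟨ *-congʳ p ⟨
      a * u * x ≈⟨ solve 3 (λ a u x → a :* u :* x := u :* (a :* x)) refl a u x ⟩
      u * (a * x) ≈⟨ *-congˡ e ⟩
      u * (a * y) ≈⟨ solve 3 (λ a u x → a :* u :* x := u :* (a :* x)) refl a u y ⟨
      a * u * y ≈⟨ *-congʳ p ⟩
      1# * y ≈⟨ *-identityˡ y ⟩
      y ∎

  unit-nn : ∀ n → IsUnit (nn (suc n))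
  unit-nn n = ι (1ℤ ℚ./ suc n) , trans (sym (ι-* _ _)) (trans (reflexive (≡.cong ι (fromℤ-inverse n))) ι-1)

-- Gaussian binomial coefficients

module QBinomial (A : LaurentAlgebra) where
  open Kit A

  X-merge : ∀ {a b c} → a ℤ.+ b ≡ c → X a * X b ≈ X c
  X-merge ≡.refl = sym (X-+ _ _)

  -- Pascal's recursion in place of a quotient of factorials: modulo Φ_m³ with m ≥ 2 the element
  -- [m]_q is nilpotent, so such a quotient would not determine the value.
  gauss : ℕ → ℕ → Carrier
  gauss n zero = 1#
  gauss zero (suc k) = 0#
  gauss (suc n) (suc k) = X (+ suc k) * gauss n (suc k) + gauss n k

  gauss-zero : ∀ n k → n ℕ.< k → gauss n k ≈ 0#
  gauss-zero zero (suc k) l = refl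
  gauss-zero (suc n) (suc k) (ℕ.s≤s l) =
    trans (+-cong (trans (*-congˡ (gauss-zero n (suc k) (ℕₚ.m≤n⇒m≤1+n l))) (zeroʳ _)) (gauss-zero n k l)) (+-identityˡ 0#)

  gauss-diag : ∀ n → gauss n n ≈ 1#
  gauss-diag zero = refl
  gauss-diag (suc n) = trans (+-cong (trans (*-congˡ (gauss-zero n (suc n) (ℕₚ.n<1+n n))) (zeroʳ _)) (gauss-diag n)) (+-identityˡ 1#)

  gauss-pascal′ : ∀ n k → gauss (suc n) (suc k) ≈ gauss n (suc k) + X (+ n ℤ.- + k) * gauss n k
  gauss-pascal′ zero zero = trans (solve 1 (λ x → x :* con ℚ.0ℚ :+ :1 := con ℚ.0ℚ :+ :1 :* :1) refl (X 1ℤ)) (+-congˡ (*-congʳ (sym X-0)))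
  gauss-pascal′ zero (suc k) = solve 2 (λ x y → x :* con ℚ.0ℚ :+ con ℚ.0ℚ := con ℚ.0ℚ :+ y :* con ℚ.0ℚ) refl _ _
  gauss-pascal′ (suc n) zero = begin
      X 1ℤ * gauss (suc n) 1 + 1#
        ≈⟨ +-congʳ (*-congˡ (gauss-pascal′ n 0)) ⟩
      X 1ℤ * (gauss n 1 + X (+ n ℤ.- 0ℤ) * 1#) + 1#
        ≈⟨ solve 3 (λ x a y → x :* (a :+ y :* :1) :+ :1 := x :* a :+ :1 :+ x :* y :* :1) refl (X 1ℤ) (gauss n 1) (X (+ n ℤ.- 0ℤ)) ⟩
      X 1ℤ * gauss n 1 + 1# + X 1ℤ * X (+ n ℤ.- 0ℤ) * 1#
        ≈⟨ +-congˡ (*-congʳ (X-merge (ℤS.solve 1 (λ n → :1ᶻ :+ᶻ (n :-ᶻ ℤS.con 0ℤ) :=ᶻ :1ᶻ :+ᶻ n :-ᶻ ℤS.con 0ℤ) ≡.refl (+ n)))) ⟩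
      X 1ℤ * gauss n 1 + 1# + X (+ suc n ℤ.- 0ℤ) * 1# ∎
  gauss-pascal′ (suc n) (suc k) = begin
      X k2 * gauss (suc n) (2 ℕ.+ k) + gauss (suc n) (suc k)
        ≈⟨ +-cong (*-congˡ (gauss-pascal′ n (suc k))) (gauss-pascal′ n k) ⟩
      X k2 * (gauss n (2 ℕ.+ k) + X (+ n ℤ.- + suc k) * gauss n (suc k)) + (gauss n (suc k) + X (+ n ℤ.- + k) * gauss n k)
        ≈⟨ solve 6 (λ x a y b z c → x :* (a :+ y :* b) :+ (b :+ z :* c) := x :* a :+ b :+ (x :* y :* b :+ z :* c)) refl
             (X k2) (gauss n (2 ℕ.+ k)) (X (+ n ℤ.- + suc k)) (gauss n (suc k)) (X (+ n ℤ.- + k)) (gauss n k) ⟩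
      X k2 * gauss n (2 ℕ.+ k) + gauss n (suc k) + (X k2 * X (+ n ℤ.- + suc k) * gauss n (suc k) + X (+ n ℤ.- + k) * gauss n k)
        ≈⟨ +-congˡ (+-cong (*-congʳ (trans (X-merge e₁) (X-+ _ _))) (*-congʳ (X-congʳ e₂))) ⟩
      X k2 * gauss n (2 ℕ.+ k) + gauss n (suc k) + (X (+ suc n ℤ.- + suc k) * X (+ suc k) * gauss n (suc k) + X (+ suc n ℤ.- + suc k) * gauss n k)
        ≈⟨ +-congˡ (solve 4 (λ x y b c → x :* y :* b :+ x :* c := x :* (y :* b :+ c)) refl (X (+ suc n ℤ.- + suc k)) (X (+ suc k)) (gauss n (suc k)) (gauss n k)) ⟩
      X k2 * gauss n (2 ℕ.+ k) + gauss n (suc k) + X (+ suc n ℤ.- + suc k) * gauss (suc n) (suc k) ∎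
    where
    k2 : ℤ
    k2 = + suc (suc k)
    e₁ : k2 ℤ.+ (+ n ℤ.- + suc k) ≡ (+ suc n ℤ.- + suc k) ℤ.+ + suc k
    e₁ = ℤS.solve 2 (λ n k → (:1ᶻ :+ᶻ (:1ᶻ :+ᶻ k)) :+ᶻ (n :-ᶻ (:1ᶻ :+ᶻ k)) :=ᶻ ((:1ᶻ :+ᶻ n) :-ᶻ (:1ᶻ :+ᶻ k)) :+ᶻ (:1ᶻ :+ᶻ k)) ≡.refl (+ n) (+ k)
    e₂ : + n ℤ.- + k ≡ + suc n ℤ.- + suc k
    e₂ = ℤS.solve 2 (λ n k → n :-ᶻ k :=ᶻ (:1ᶻ :+ᶻ n) :-ᶻ (:1ᶻ :+ᶻ k)) ≡.refl (+ n) (+ k)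

  gauss-sym : ∀ n a b → a ℕ.+ b ≡ n → gauss n a ≈ gauss n b
  gauss-sym n zero b ≡.refl = sym (gauss-diag b)
  gauss-sym n (suc a) zero e rewrite ≡.trans (≡.sym (ℕₚ.+-identityʳ (suc a))) e = gauss-diag n
  gauss-sym (suc n) (suc a) (suc b) e = begin
      X (+ suc a) * gauss n (suc a) + gauss n a
        ≈⟨ +-cong (*-congˡ (gauss-sym n (suc a) b (≡.trans (≡.sym (ℕₚ.+-suc a b)) (ℕₚ.suc-injective e)))) (gauss-sym n a (suc b) (ℕₚ.suc-injective e)) ⟩
      X (+ suc a) * gauss n b + gauss n (suc b)
        ≈⟨ +-comm _ _ ⟩
      gauss n (suc b) + X (+ suc a) * gauss n b
        ≈⟨ +-congˡ (*-congʳ (X-congʳ exponent)) ⟩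
      gauss n (suc b) + X (+ n ℤ.- + b) * gauss n b
        ≈⟨ gauss-pascal′ n b ⟨
      gauss (suc n) (suc b) ∎
    where
    exponent : + suc a ≡ + n ℤ.- + b
    exponent rewrite ≡.sym (ℕₚ.suc-injective e) =
      ℤS.solve 2 (λ a b → :1ᶻ :+ᶻ a :=ᶻ (a :+ᶻ (:1ᶻ :+ᶻ b)) :-ᶻ b) ≡.refl (+ a) (+ b)

  -- Both Pascal rules expand `gauss (suc n) (suc k)`; equating the expansions leaves a first-order
  -- recursion in k. It holds even where 1 - q^(k+1) is a zero divisor.
  absorb : ∀ n k → (1# - X (+ suc k)) * gauss n (suc k) ≈ (1# - X (+ n ℤ.- + k)) * gauss n k
  absorb n k = begin
      (1# - x) * G′ ≈⟨ solve 4 (λ x y G′ G → (:1 :- x) :* G′ := (G′ :+ y :* G) :- x :* G′ :- y :* G) refl x y G′ G ⟩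
      (G′ + y * G) - x * G′ - y * G ≈⟨ +-congʳ (+-congʳ (gauss-pascal′ n k)) ⟨
      (x * G′ + G) - x * G′ - y * G ≈⟨ solve 4 (λ x y G′ G → (x :* G′ :+ G) :- x :* G′ :- y :* G := (:1 :- y) :* G) refl x y G′ G ⟩
      (1# - y) * G ∎
    where
    x = X (+ suc k)
    y = X (+ n ℤ.- + k)
    G′ = gauss n (suc k)
    G = gauss n k

  absorb-both : ∀ n k → (1# - X (+ suc k)) * gauss (suc n) (suc k) ≈ (1# - X (+ suc n)) * gauss n k
  absorb-both n k = begin
      (1# - x) * (x * G′ + G) ≈⟨ solve 3 (λ x G′ G → (:1 :- x) :* (x :* G′ :+ G) := x :* ((:1 :- x) :* G′) :+ (:1 :- x) :* G) refl x G′ G ⟩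
      x * ((1# - x) * G′) + (1# - x) * G ≈⟨ +-congʳ (*-congˡ (absorb n k)) ⟩
      x * ((1# - y) * G) + (1# - x) * G ≈⟨ solve 3 (λ x y G → x :* ((:1 :- y) :* G) :+ (:1 :- x) :* G := (:1 :- x :* y) :* G) refl x y G ⟩
      (1# - x * y) * G ≈⟨ *-congʳ (+-congˡ (-‿cong (X-merge (ℤS.solve 2 (λ n k → (:1ᶻ :+ᶻ k) :+ᶻ (n :-ᶻ k) :=ᶻ :1ᶻ :+ᶻ n) ≡.refl (+ n) (+ k))))) ⟩
      (1# - X (+ suc n)) * G ∎
    where
    x = X (+ suc k)
    y = X (+ n ℤ.- + k)
    G′ = gauss n (suc k)
    G = gauss n k

  qnum : ℕ → Carrier
  qnum = ∑ (λ i → X (+ i))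

  qnum-+ : ∀ a b → qnum (a ℕ.+ b) ≈ qnum a + X (+ a) * qnum b
  qnum-+ a b = trans (Sum.fold-+ _ a b) (+-congˡ (trans (Sum.fold-cong b (λ i → X-+ (+ a) (+ i))) (sym (∑-*ˡ _ _ b))))

  geometric : ∀ c n → (1# - X c) * ∑ (λ i → X (c ℤ.* + i)) n ≈ 1# - X (c ℤ.* + n)
  geometric c zero = trans (zeroʳ _) (trans (sym (-‿inverseʳ 1#)) (+-congˡ (-‿cong (trans (sym X-0) (X-congʳ (≡.sym (ℤₚ.*-zeroʳ c)))))))
  geometric c (suc n) = begin
      (1# - X c) * ∑ (λ i → X (c ℤ.* + i)) (suc n) ≈⟨ *-congˡ (Sum.fold-snoc _ n) ⟩
      (1# - X c) * (∑ (λ i → X (c ℤ.* + i)) n + X (c ℤ.* + n)) ≈⟨ distribˡ _ _ _ ⟩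
      (1# - X c) * ∑ (λ i → X (c ℤ.* + i)) n + (1# - X c) * X (c ℤ.* + n) ≈⟨ +-congʳ (geometric c n) ⟩
      1# - X (c ℤ.* + n) + (1# - X c) * X (c ℤ.* + n)
        ≈⟨ solve 2 (λ x y → :1 :- x :+ (:1 :- y) :* x := :1 :- y :* x) refl (X (c ℤ.* + n)) (X c) ⟩
      1# - X c * X (c ℤ.* + n)
        ≈⟨ +-congˡ (-‿cong (X-merge (≡.sym (ℤₚ.*-suc c (+ n))))) ⟩
      1# - X (c ℤ.* + suc n) ∎

  -- Both [n]_q and 1 - q^n satisfy u(a) + q^a u(b) = u(a+b), the property behind the factorial
  -- formula. The first choice leads to `qbinom`, the second to products of 1 - q^i that can be cut
  -- into blocks.
  module Factorial (u : ℕ → Carrier)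
    (u-+ : ∀ a b → u (suc a) + X (+ suc a) * u (suc b) ≈ u (suc a ℕ.+ suc b)) where

    fac : ℕ → Carrier
    fac = ∏ (λ i → u (suc i))

    gauss-fac : ∀ n a b → a ℕ.+ b ≡ n → gauss n a * (fac a * fac b) ≈ fac n
    gauss-fac n zero b ≡.refl = trans (*-identityˡ _) (*-identityˡ _)
    gauss-fac n (suc a) zero e with ≡.refl ← ≡.trans (≡.sym (ℕₚ.+-identityʳ (suc a))) e =
      trans (*-cong (gauss-diag n) (*-identityʳ _)) (*-identityˡ _)
    gauss-fac (suc n) (suc a) (suc b) e = begin
        (X (+ suc a) * gauss n (suc a) + gauss n a) * (fac (suc a) * fac (suc b))
          ≈⟨ solve 5 (λ x g h A B → (x :* g :+ h) :* (A :* B) := x :* g :* (A :* B) :+ h :* (A :* B)) refl (X (+ suc a)) (gauss n (suc a)) (gauss n a) (fac (suc a)) (fac (suc b)) ⟩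
        X (+ suc a) * gauss n (suc a) * (fac (suc a) * fac (suc b)) + gauss n a * (fac (suc a) * fac (suc b))
          ≈⟨ +-cong (*-congˡ (*-congˡ (Product.fold-snoc _ b))) (*-congˡ (*-congʳ (Product.fold-snoc _ a))) ⟩
        X (+ suc a) * gauss n (suc a) * (fac (suc a) * (fac b * u (suc b))) + gauss n a * (fac a * u (suc a) * fac (suc b))
          ≈⟨ solve 9 (λ x g A B v h A′ B′ v′ → x :* g :* (A :* (B :* v)) :+ h :* (A′ :* v′ :* B′) := x :* v :* (g :* (A :* B)) :+ v′ :* (h :* (A′ :* B′))) refl
               (X (+ suc a)) (gauss n (suc a)) (fac (suc a)) (fac b) (u (suc b)) (gauss n a) (fac a) (fac (suc b)) (u (suc a)) ⟩
        X (+ suc a) * u (suc b) * (gauss n (suc a) * (fac (suc a) * fac b)) + u (suc a) * (gauss n a * (fac a * fac (suc b)))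
          ≈⟨ +-cong (*-congˡ (gauss-fac n (suc a) b (≡.trans (≡.sym (ℕₚ.+-suc a b)) e′))) (*-congˡ (gauss-fac n a (suc b) e′)) ⟩
        X (+ suc a) * u (suc b) * fac n + u (suc a) * fac n
          ≈⟨ solve 4 (λ x v w f → x :* v :* f :+ w :* f := f :* (w :+ x :* v)) refl (X (+ suc a)) (u (suc b)) (u (suc a)) (fac n) ⟩
        fac n * (u (suc a) + X (+ suc a) * u (suc b))
          ≈⟨ *-congˡ (trans (u-+ a b) (reflexive (≡.cong u e))) ⟩
        fac n * u (suc n)
          ≈⟨ Product.fold-snoc _ n ⟨
        fac (suc n) ∎
      where
      e′ = ℕₚ.suc-injective e

  module QFactorial = Factorial qnum (λ a b → sym (qnum-+ (suc a) (suc b)))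

  module Pochhammer = Factorial (λ n → 1# - X (+ n)) (λ a b →
    trans (solve 2 (λ x y → :1 :- x :+ x :* (:1 :- y) := :1 :- x :* y) refl (X (+ suc a)) (X (+ suc b)))
          (+-congˡ (-‿cong (X-merge ≡.refl))))

  vandermondeTerm : ℕ → ℕ → ℕ → ℕ → Carrier
  vandermondeTerm a b c k = X ((+ a ℤ.- + k) ℤ.* + (c ℕ.∸ k)) * (gauss a k * gauss b (c ℕ.∸ k))

  -- Induction on a by Pascal's rule: the exponent (a-k)(c-k) is the one for which the two
  -- contributions to each term recombine by the same rule.
  vandermonde : ∀ a b c → gauss (a ℕ.+ b) c ≈ ∑ (vandermondeTerm a b c) (suc c)
  vandermonde zero b c = sym (trans
    (+-cong (trans (*-cong X-0 (*-identityˡ _)) (*-identityˡ _))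
            (Sum.fold-ε c (λ k _ → trans (*-congˡ (zeroˡ _)) (zeroʳ _))))
    (+-identityʳ _))
  vandermonde (suc a) b zero = sym (trans (+-identityʳ _) (trans (*-cong (trans (X-congʳ (ℤₚ.*-zeroʳ (+ suc a ℤ.- 0ℤ))) X-0) (*-identityˡ _)) (*-identityˡ _)))
  vandermonde (suc a) b (suc c) = begin
      X (+ suc c) * gauss (a ℕ.+ b) (suc c) + gauss (a ℕ.+ b) c
        ≈⟨ +-cong (*-congˡ (vandermonde a b (suc c))) (vandermonde a b c) ⟩
      X (+ suc c) * ∑ (vandermondeTerm a b (suc c)) (2 ℕ.+ c) + ∑ (vandermondeTerm a b c) (suc c)
        ≈⟨ +-congʳ (∑-*ˡ _ (vandermondeTerm a b (suc c)) (2 ℕ.+ c)) ⟩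
      X (+ suc c) * vandermondeTerm a b (suc c) 0 + ∑ (λ k → X (+ suc c) * vandermondeTerm a b (suc c) (suc k)) (suc c) + ∑ (vandermondeTerm a b c) (suc c)
        ≈⟨ trans (+-assoc _ _ _) (+-congˡ (sym (Sum.fold-∙ (λ k → X (+ suc c) * vandermondeTerm a b (suc c) (suc k)) (vandermondeTerm a b c) (suc c)))) ⟩
      X (+ suc c) * vandermondeTerm a b (suc c) 0 + ∑ (λ k → X (+ suc c) * vandermondeTerm a b (suc c) (suc k) + vandermondeTerm a b c k) (suc c)
        ≈⟨ +-cong head (Sum.fold-cong< (suc c) (λ k k<c → step k (ℕₚ.≤-pred k<c))) ⟩
      ∑ (vandermondeTerm (suc a) b (suc c)) (2 ℕ.+ c) ∎
    where
    head : X (+ suc c) * vandermondeTerm a b (suc c) 0 ≈ vandermondeTerm (suc a) b (suc c) 0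
    head = trans (sym (*-assoc _ _ _)) (*-congʳ (X-merge
      (ℤS.solve 2 (λ a c → c :+ᶻ (a :-ᶻ ℤS.con 0ℤ) :*ᶻ c :=ᶻ ((:1ᶻ :+ᶻ a) :-ᶻ ℤS.con 0ℤ) :*ᶻ c) ≡.refl (+ a) (+ suc c))))
    step : ∀ k → k ℕ.≤ c → X (+ suc c) * vandermondeTerm a b (suc c) (suc k) + vandermondeTerm a b c k ≈ vandermondeTerm (suc a) b (suc c) (suc k)
    step k k≤c = begin
        X (+ suc c) * (X e₁ * (gauss a (suc k) * G)) + X e₂ * (gauss a k * G)
          ≈⟨ solve 6 (λ x y g z h G → x :* (y :* (g :* G)) :+ z :* (h :* G) := x :* y :* (g :* G) :+ z :* (h :* G)) refl (X (+ suc c)) (X e₁) (gauss a (suc k)) (X e₂) (gauss a k) G ⟩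
        X (+ suc c) * X e₁ * (gauss a (suc k) * G) + X e₂ * (gauss a k * G)
          ≈⟨ +-cong (*-congʳ (trans (X-merge exponent₁) (X-+ _ _))) (*-congʳ (X-congʳ exponent₂)) ⟩
        X e₃ * X (+ suc k) * (gauss a (suc k) * G) + X e₃ * (gauss a k * G)
          ≈⟨ solve 5 (λ z x g h G → z :* x :* (g :* G) :+ z :* (h :* G) := z :* ((x :* g :+ h) :* G)) refl (X e₃) (X (+ suc k)) (gauss a (suc k)) (gauss a k) G ⟩
        X e₃ * (gauss (suc a) (suc k) * G) ∎
      where
      d = c ℕ.∸ k
      G = gauss b d
      e₁ = (+ a ℤ.- + suc k) ℤ.* + d
      e₂ = (+ a ℤ.- + k) ℤ.* + d
      e₃ = (+ suc a ℤ.- + suc k) ℤ.* + d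
      exponent₁ : + suc c ℤ.+ e₁ ≡ e₃ ℤ.+ + suc k
      exponent₁ = ≡.trans (≡.cong (λ c → + suc c ℤ.+ e₁) (≡.sym (ℕₚ.m∸n+n≡m k≤c)))
        (ℤS.solve 3 (λ a k d → (:1ᶻ :+ᶻ (d :+ᶻ k)) :+ᶻ (a :-ᶻ (:1ᶻ :+ᶻ k)) :*ᶻ d :=ᶻ
            ((:1ᶻ :+ᶻ a) :-ᶻ (:1ᶻ :+ᶻ k)) :*ᶻ d :+ᶻ (:1ᶻ :+ᶻ k)) ≡.refl (+ a) (+ k) (+ d))
      exponent₂ : e₂ ≡ e₃
      exponent₂ = ℤS.solve 3 (λ a k d → (a :-ᶻ k) :*ᶻ d :=ᶻ ((:1ᶻ :+ᶻ a) :-ᶻ (:1ᶻ :+ᶻ k)) :*ᶻ d) ≡.refl (+ a) (+ k) (+ d)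

  -- sign j = (-1)^j q^{j(j+1)/2}
  sign : ℕ → Carrier
  sign zero = 1#
  sign (suc j) = - (X (+ suc j) * sign j)

  qBinomialTerm : ℤ → ℕ → ℕ → Carrier
  qBinomialTerm a n j = sign j * gauss n j * X (a ℤ.* + j)

  -- Appending the factor 1 - q^(a+n+1) is the second Pascal rule in each term. As a is any integer,
  -- q^a acts as a variable: q^a = Q^s yields F(s), including s = -1.
  qBinomial : ∀ a n → ∏ (λ r → 1# - X (a ℤ.+ + suc r)) n ≈ ∑ (qBinomialTerm a n) (suc n)
  qBinomial a zero = sym (trans (+-identityʳ _) (trans (*-cong (*-identityˡ _) (trans (X-congʳ (ℤₚ.*-zeroʳ a)) X-0)) (*-identityˡ _)))
  qBinomial a (suc n) = begin
      ∏ (λ r → 1# - X (a ℤ.+ + suc r)) (suc n)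
        ≈⟨ Product.fold-snoc _ n ⟩
      ∏ (λ r → 1# - X (a ℤ.+ + suc r)) n * (1# - y)
        ≈⟨ *-congʳ (qBinomial a n) ⟩
      S * (1# - y)
        ≈⟨ solve 2 (λ s y → s :* (:1 :- y) := s :+ (:- y) :* s) refl S y ⟩
      S + (- y) * S
        ≈⟨ +-cong (sym extend) (∑-*ˡ _ (qBinomialTerm a n) (suc n)) ⟩
      ∑ (qBinomialTerm a n) (2 ℕ.+ n) + ∑ (λ j → (- y) * qBinomialTerm a n j) (suc n)
        ≈⟨ trans (+-assoc _ _ _) (+-congˡ (sym (Sum.fold-∙ (λ j → qBinomialTerm a n (suc j)) (λ j → (- y) * qBinomialTerm a n j) (suc n)))) ⟩
      qBinomialTerm a n 0 + ∑ (λ j → qBinomialTerm a n (suc j) + (- y) * qBinomialTerm a n j) (suc n)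
        ≈⟨ +-congˡ (Sum.fold-cong (suc n) step) ⟩
      ∑ (qBinomialTerm a (suc n)) (2 ℕ.+ n) ∎
    where
    y = X (a ℤ.+ + suc n)
    S = ∑ (qBinomialTerm a n) (suc n)
    extend : ∑ (qBinomialTerm a n) (2 ℕ.+ n) ≈ S
    extend = trans (Sum.fold-snoc (qBinomialTerm a n) (suc n)) (trans (+-congˡ (trans (*-congʳ (trans (*-congˡ (gauss-zero n (suc n) (ℕₚ.n<1+n n))) (zeroʳ _))) (zeroˡ _))) (+-identityʳ _))
    exponent : ∀ j → (a ℤ.+ + suc n) ℤ.+ a ℤ.* + j ≡ + suc j ℤ.+ (+ n ℤ.- + j) ℤ.+ a ℤ.* + suc j
    exponent j = ℤS.solve 3 (λ a n j → (a :+ᶻ (:1ᶻ :+ᶻ n)) :+ᶻ a :*ᶻ j :=ᶻ (:1ᶻ :+ᶻ j) :+ᶻ (n :-ᶻ j) :+ᶻ a :*ᶻ (:1ᶻ :+ᶻ j)) ≡.refl a (+ n) (+ j)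
    step : ∀ j → qBinomialTerm a n (suc j) + (- y) * qBinomialTerm a n j ≈ qBinomialTerm a (suc n) (suc j)
    step j = begin
        - (x * s) * G′ * z′ + (- y) * (s * G * z)
          ≈⟨ solve 7 (λ x s G′ z′ y G z → (:- (x :* s)) :* G′ :* z′ :+ (:- y) :* (s :* G :* z) := (:- (x :* s)) :* G′ :* z′ :- s :* G :* (y :* z)) refl x s G′ z′ y G z ⟩
        - (x * s) * G′ * z′ - s * G * (y * z)
          ≈⟨ +-congˡ (-‿cong (*-congˡ (trans (X-merge (exponent j)) (trans (X-+ _ _) (*-congʳ (X-+ _ _)))))) ⟩
        - (x * s) * G′ * z′ - s * G * (x * p * z′)
          ≈⟨ solve 6 (λ x s G′ z′ p G → (:- (x :* s)) :* G′ :* z′ :- s :* G :* (x :* p :* z′) := (:- (x :* s)) :* (G′ :+ p :* G) :* z′) refl x s G′ z′ p G ⟩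
        - (x * s) * (G′ + p * G) * z′
          ≈⟨ *-congʳ (*-congˡ (gauss-pascal′ n j)) ⟨
        - (x * s) * gauss (suc n) (suc j) * z′ ∎
      where
      x = X (+ suc j)
      s = sign j
      G′ = gauss n (suc j)
      G = gauss n j
      z′ = X (a ℤ.* + suc j)
      z = X (a ℤ.* + j)
      p = X (+ n ℤ.- + j)

-- Factorisation of binom(mn, mk)_q into blocks of m consecutive factors.

module BlockProducts (A : LaurentAlgebra) (M : ℕ) where
  open QBinomial A
  open Kit A
  private
    m : ℕ
    m = suc M

  -- block s = F(s)
  block : ℤ → Carrier
  block s = ∏ (λ r → 1# - X (+ m ℤ.* s ℤ.+ + suc r)) M

  onBlock : ℕ → ℕ → Carrier
  onBlock k l = gauss ((k ℕ.+ l) ℕ.* m) (k ℕ.* m)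

  -- This is [n]_Q with Q = q^m, so `blockFactor s` is F(s) [s+1]_Q.
  qint₁ : ℕ → Carrier
  qint₁ = ∑ (λ i → X (+ m ℤ.* + i))

  blockFactor : ℕ → Carrier
  blockFactor s = block (+ s) * qint₁ (suc s)

  blockProduct : ℕ → Carrier
  blockProduct = ∏ blockFactor

  -- Block j consists of F(j) and a last factor 1 - Q^(j+1) = (1 - Q) [j+1]_Q. One factor 1 - Q per
  -- block is set apart: it becomes nilpotent modulo Φ_m³, the rest becomes invertible.
  pochhammer-blocks : ∀ n → Pochhammer.fac (n ℕ.* m) ≈ pow (1# - X (+ m)) n * blockProduct n
  pochhammer-blocks n = begin
      Pochhammer.fac (n ℕ.* m) ≈⟨ Product.fold-blocks f n m ⟩
      ∏ (λ j → ∏ (λ r → f (j ℕ.* m ℕ.+ r)) m) n ≈⟨ Product.fold-cong n oneBlock ⟩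
      ∏ (λ j → (1# - X (+ m)) * blockFactor j) n ≈⟨ Product.fold-∙ (λ _ → 1# - X (+ m)) blockFactor n ⟩
      ∏ (λ _ → 1# - X (+ m)) n * blockProduct n ≈⟨ *-congʳ (∏-const _ n) ⟩
      pow (1# - X (+ m)) n * blockProduct n ∎
    where
    f : ℕ → Carrier
    f i = 1# - X (+ suc i)
    index : ∀ j r → + suc (j ℕ.* m ℕ.+ r) ≡ + m ℤ.* + j ℤ.+ + suc r
    index j r = ≡.trans (≡.cong (λ x → + 1 ℤ.+ (x ℤ.+ + r)) (ℤₚ.pos-* j m))
      (ℤS.solve 3 (λ r j m → :1ᶻ :+ᶻ (j :*ᶻ m :+ᶻ r) :=ᶻ m :*ᶻ j :+ᶻ (:1ᶻ :+ᶻ r)) ≡.refl (+ r) (+ j) (+ m))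
    oneBlock : ∀ j → ∏ (λ r → f (j ℕ.* m ℕ.+ r)) m ≈ (1# - X (+ m)) * blockFactor j
    oneBlock j = begin
      ∏ (λ r → f (j ℕ.* m ℕ.+ r)) m ≈⟨ Product.fold-snoc (λ r → f (j ℕ.* m ℕ.+ r)) M ⟩
      ∏ (λ r → f (j ℕ.* m ℕ.+ r)) M * f (j ℕ.* m ℕ.+ M)
        ≈⟨ *-cong (Product.fold-cong M (λ r → +-congˡ (-‿cong (X-congʳ (index j r)))))
             (+-congˡ (-‿cong (X-congʳ (≡.trans (index j M) (≡.trans (ℤₚ.+-comm (+ m ℤ.* + j) (+ m)) (≡.sym (ℤₚ.*-suc (+ m) (+ j)))))))) ⟩
      block (+ j) * (1# - X (+ m ℤ.* + suc j)) ≈⟨ *-congˡ (geometric (+ m) (suc j)) ⟨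
      block (+ j) * ((1# - X (+ m)) * qint₁ (suc j)) ≈⟨ solve 3 (λ b c q → b :* (c :* q) := c :* (b :* q)) refl (block (+ j)) (1# - X (+ m)) (qint₁ (suc j)) ⟩
      (1# - X (+ m)) * blockFactor j ∎

  -- The power (1 - Q)^(k+l) occurs on both sides and is cancelled. Cancellability is an explicit
  -- hypothesis because it holds for Laurent polynomials and fails modulo Φ_m³.
  factorization : (∀ f g → (1# - X (+ m)) * f ≈ (1# - X (+ m)) * g → f ≈ g) →
    ∀ k l → onBlock k l * (blockProduct k * blockProduct l) ≈ blockProduct (k ℕ.+ l)
  factorization cancel k l = cancel-pow (k ℕ.+ l) _ _ (begin
      pow c (k ℕ.+ l) * (G * (blockProduct k * blockProduct l)) ≈⟨ *-congʳ (pow-+ c k l) ⟩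
      pow c k * pow c l * (G * (blockProduct k * blockProduct l))
        ≈⟨ solve 5 (λ a b g p q → a :* b :* (g :* (p :* q)) := g :* (a :* p :* (b :* q))) refl (pow c k) (pow c l) G (blockProduct k) (blockProduct l) ⟩
      G * (pow c k * blockProduct k * (pow c l * blockProduct l)) ≈⟨ *-congˡ (*-cong (pochhammer-blocks k) (pochhammer-blocks l)) ⟨
      G * (Pochhammer.fac (k ℕ.* m) * Pochhammer.fac (l ℕ.* m))
        ≈⟨ Pochhammer.gauss-fac ((k ℕ.+ l) ℕ.* m) (k ℕ.* m) (l ℕ.* m) (≡.sym (ℕₚ.*-distribʳ-+ m k l)) ⟩
      Pochhammer.fac ((k ℕ.+ l) ℕ.* m) ≈⟨ pochhammer-blocks (k ℕ.+ l) ⟩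
      pow c (k ℕ.+ l) * blockProduct (k ℕ.+ l) ∎)
    where
    c = 1# - X (+ m)
    G = onBlock k l
    cancel-pow : ∀ n f g → pow c n * f ≈ pow c n * g → f ≈ g
    cancel-pow zero f g e = trans (sym (*-identityˡ f)) (trans e (*-identityˡ g))
    cancel-pow (suc n) f g e = cancel-pow n f g (cancel _ _ (trans (sym (*-assoc c _ f)) (trans e (*-assoc c _ g))))

-- Replacing q by q^d changes only what counts as a power of q. `gauss` over `rebase d A` is thus
-- the q-binomial at q^d, as an element of the same ring.
rebase : ℤ → LaurentAlgebra → LaurentAlgebra
rebase d A = record
  { commutativeRing = commutativeRing
  ; ι = ι ; ι-+ = ι-+ ; ι-* = ι-* ; ι-neg = ι-neg ; ι-0 = ι-0 ; ι-1 = ι-1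
  ; X = λ e → X (d ℤ.* e)
  ; X-+ = λ a b → trans (reflexive (≡.cong X (ℤₚ.*-distribˡ-+ d a b))) (X-+ _ _)
  ; X-0 = trans (reflexive (≡.cong X (ℤₚ.*-zeroʳ d))) X-0
  }
  where open LaurentAlgebra A

-- Apart from the block factorisation, Φ_m enters the congruence only through this property and
-- `UnitsBelow`.
CubeZero : LaurentAlgebra → ℕ → Set
CubeZero A m = t * (t * t) ≈ 0#
  where
  open LaurentAlgebra A
  t = X (+ m) - 1#

UnitsBelow : LaurentAlgebra → ℕ → Set
UnitsBelow A M = ∀ r → r ℕ.< M → IsUnit (1# - X (+ suc r))
  where open Kit A

-- Expansions modulo t³

module PowerSums (A : LaurentAlgebra) where
  open Kit A

  infixr 9 _·_
  _·_ : ∀ {n} → ℚ → Solver.Polynomial n → Solver.Polynomial n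
  c · p = con c :* p

  ⅙ : ℚ
  ⅙ = + 1 ℚ./ 6

  ∑nn : ∀ n → ∑ nn n ≈ ι ½ * (nn n * (nn n - 1#))
  ∑nn zero = sym (trans (*-congˡ (*-congʳ nn-0)) (trans (*-congˡ (zeroˡ _)) (zeroʳ _)))
  ∑nn (suc n) = trans (Sum.fold-snoc nn n) (trans (+-congʳ (∑nn n))
    (trans (solve 1 (λ n → ½ · (n :* (n :- :1)) :+ n := ½ · ((:1 :+ n) :* ((:1 :+ n) :- :1))) refl (nn n))
           (*-congˡ (sym (*-cong (nn-suc n) (+-congʳ (nn-suc n)))))))

  sumOfSquares : ∀ n → ∑ (λ i → nn i * nn i) n ≈ ι ⅙ * (nn n * (nn n - 1#) * (nn n + nn n - 1#))
  sumOfSquares zero = sym (trans (*-congˡ (trans (*-congʳ (*-congʳ nn-0)) (trans (*-congʳ (zeroˡ _)) (zeroˡ _)))) (zeroʳ _))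
  sumOfSquares (suc n) = trans (Sum.fold-snoc _ n) (trans (+-congʳ (sumOfSquares n))
    (trans (solve 1 (λ n → ⅙ · (n :* (n :- :1) :* (n :+ n :- :1)) :+ n :* n
                        := ⅙ · ((:1 :+ n) :* ((:1 :+ n) :- :1) :* ((:1 :+ n) :+ (:1 :+ n) :- :1))) refl (nn n))
           (*-congˡ (sym (*-cong (*-cong (nn-suc n) (+-congʳ (nn-suc n))) (+-congʳ (+-cong (nn-suc n) (nn-suc n))))))))

module Congruence (A : LaurentAlgebra) (M : ℕ) (t³≈0 : CubeZero A (suc M)) (units : UnitsBelow A M) where

  open QBinomial A
  open Kit A
  open PowerSums A
  open BlockProducts A M

  m : ℕ
  m = suc M

  t : Carrier
  t = X (+ m) - 1#

  Xm : X (+ m) ≈ 1# + t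
  Xm = solve 1 (λ x → x := :1 :+ (x :- :1)) refl (X (+ m))

  -- The solver knows nothing of t³ = 0. Each computation modulo t³ displays its excess as an
  -- explicit multiple of t³, which is removed here.
  drop : ∀ x c → x + c * (t * (t * t)) ≈ x
  drop x c = trans (+-congˡ (trans (*-congˡ t³≈0) (zeroʳ c))) (+-identityʳ x)

  infix 9 quad
  quad : Carrier → Carrier → Carrier → Carrier
  quad a b c = a + b * t + c * (t * t)

  quad-cong : ∀ {a b c a′ b′ c′} → a ≈ a′ → b ≈ b′ → c ≈ c′ → quad a b c ≈ quad a′ b′ c′
  quad-cong p q r = +-cong (+-cong p (*-congʳ q)) (*-congʳ r)

  quad-* : ∀ a b c a′ b′ c′ → quad a b c * quad a′ b′ c′ ≈ quad (a * a′) (a * b′ + b * a′) (a * c′ + b * b′ + c * a′)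
  quad-* a b c a′ b′ c′ = trans
    (solve 7 (λ t a b c a′ b′ c′ → (a :+ b :* t :+ c :* (t :* t)) :* (a′ :+ b′ :* t :+ c′ :* (t :* t))
       := (a :* a′ :+ (a :* b′ :+ b :* a′) :* t :+ (a :* c′ :+ b :* b′ :+ c :* a′) :* (t :* t))
          :+ (b :* c′ :+ c :* b′ :+ c :* c′ :* t) :* (t :* (t :* t))) refl t a b c a′ b′ c′)
    (drop _ _)

  -- Geometric series: (1 + x)(1 - x + x²) = 1 + x³, and for x = t b/a the cube is a multiple of t³.
  unit-perturb : ∀ {a} b → IsUnit a → IsUnit (a + t * b)
  unit-perturb {a} b (u , p) = u * (1# - x + x * x) , (begin
      (a + t * b) * (u * (1# - x + x * x))
        ≈⟨ solve 4 (λ a t b u → (a :+ t :* b) :* (u :* (:1 :- u :* b :* t :+ u :* b :* t :* (u :* b :* t)))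
             := (a :* u :+ u :* b :* t) :* (:1 :- u :* b :* t :+ u :* b :* t :* (u :* b :* t))) refl a t b u ⟩
      (a * u + x) * (1# - x + x * x)
        ≈⟨ *-congʳ (+-congʳ p) ⟩
      (1# + x) * (1# - x + x * x)
        ≈⟨ solve 2 (λ y t → (:1 :+ y :* t) :* (:1 :- y :* t :+ y :* t :* (y :* t)) := :1 :+ y :* y :* y :* (t :* (t :* t))) refl (u * b) t ⟩
      1# + u * b * (u * b) * (u * b) * (t * (t * t))
        ≈⟨ drop _ _ ⟩
      1# ∎)
    where
    x = u * b * t

  unit-quad : ∀ {a} b c → IsUnit a → IsUnit (quad a b c)
  unit-quad {a} b c h = unit-cong (solve 4 (λ a b c t → a :+ t :* (b :+ c :* t) := a :+ b :* t :+ c :* (t :* t)) refl a b c t) (unit-perturb (b + c * t) h)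

  -- (1 + t)^k truncated after t². The exponent is a ring element, so that one formula covers
  -- negative integers and products such as s j.
  qPower : Carrier → Carrier
  qPower k = quad 1# k (ι ½ * (k * (k - 1#)))

  qPower-cong : ∀ {k l} → k ≈ l → qPower k ≈ qPower l
  qPower-cong e = quad-cong refl e (*-congˡ (*-cong e (+-congʳ e)))

  X-nat : ∀ k → X (+ m ℤ.* + k) ≈ qPower (nn k)
  X-nat zero = begin
      X (+ m ℤ.* 0ℤ) ≈⟨ X-congʳ (ℤₚ.*-zeroʳ (+ m)) ⟩
      X 0ℤ ≈⟨ X-0 ⟩
      1# ≈⟨ solve 1 (λ t → :1 := :1 :+ :0 :* t :+ ½ · (:0 :* (:0 :- :1)) :* (t :* t)) refl t ⟩
      qPower 0# ≈⟨ qPower-cong nn-0 ⟨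
      qPower (nn 0) ∎
  X-nat (suc k) = begin
      X (+ m ℤ.* + suc k) ≈⟨ trans (X-congʳ (ℤₚ.*-suc (+ m) (+ k))) (X-+ _ _) ⟩
      X (+ m) * X (+ m ℤ.* + k) ≈⟨ *-cong Xm (X-nat k) ⟩
      (1# + t) * qPower (nn k)
        ≈⟨ solve 2 (λ t k → (:1 :+ t) :* (:1 :+ k :* t :+ ½ · (k :* (k :- :1)) :* (t :* t))
             := :1 :+ (:1 :+ k) :* t :+ ½ · ((:1 :+ k) :* ((:1 :+ k) :- :1)) :* (t :* t) :+ ½ · (k :* (k :- :1)) :* (t :* (t :* t))) refl t (nn k) ⟩
      qPower (1# + nn k) + ι ½ * (nn k * (nn k - 1#)) * (t * (t * t))
        ≈⟨ drop _ _ ⟩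
      qPower (1# + nn k) ≈⟨ qPower-cong (nn-suc k) ⟨
      qPower (nn (suc k)) ∎

  qPower-inverse : ∀ k → qPower k * qPower (- k) ≈ 1#
  qPower-inverse k = trans (quad-* _ _ _ _ _ _)
    (solve 2 (λ t k → :1 :* :1 :+ (:1 :* (:- k) :+ k :* :1) :* t
        :+ (:1 :* (½ · ((:- k) :* ((:- k) :- :1))) :+ k :* (:- k) :+ ½ · (k :* (k :- :1)) :* :1) :* (t :* t) := :1) refl t k)

  X-multiple : ∀ k → X (+ m ℤ.* k) ≈ qPower (zz k)
  X-multiple (+ k) = X-nat k
  X-multiple k@(-[1+ j ]) = begin
      X e ≈⟨ *-identityʳ _ ⟨
      X e * 1# ≈⟨ *-congˡ (qPower-inverse (nn (suc j))) ⟨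
      X e * (qPower (nn (suc j)) * qPower (- nn (suc j))) ≈⟨ *-assoc _ _ _ ⟨
      X e * qPower (nn (suc j)) * qPower (- nn (suc j)) ≈⟨ *-cong (*-congˡ (X-nat (suc j))) (qPower-cong (zz-neg (+ suc j))) ⟨
      X e * X (+ m ℤ.* + suc j) * qPower (zz k)
        ≈⟨ *-congʳ (trans (X-merge (ℤS.solve 2 (λ m k → m :*ᶻ (:-ᶻ k) :+ᶻ m :*ᶻ k :=ᶻ ℤS.con 0ℤ) ≡.refl (+ m) (+ suc j))) X-0) ⟩
      1# * qPower (zz k) ≈⟨ *-identityˡ _ ⟩
      qPower (zz k) ∎
    where
    e = + m ℤ.* k

  -- The expansion of Q^(ci) summed over i < n; its coefficients are the sums of 1, i and i². Here c
  -- = 1 gives [n]_Q and c = m gives [n] at q^(m²), the two quantities to be compared.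
  ∑-multiples : ∀ c n → ∑ (λ i → X (+ m ℤ.* (c ℤ.* + i))) n
    ≈ quad (nn n) (zz c * (ι ½ * (nn n * (nn n - 1#)))) (ι ½ * (zz c * zz c * (ι ⅙ * (nn n * (nn n - 1#) * (nn n + nn n - 1#))) - zz c * (ι ½ * (nn n * (nn n - 1#)))))
  ∑-multiples c zero = sym (trans (quad-cong nn-0 (*-congˡ (*-congˡ (*-cong nn-0 refl)))
        (*-congˡ (+-cong (*-congˡ (*-congˡ (*-congʳ (*-congʳ nn-0)))) (-‿cong (*-congˡ (*-congˡ (*-congʳ nn-0)))))))
      (solve 5 (λ c t x y z → :0 :+ c :* (½ · (:0 :* x)) :* t :+ ½ · (c :* c :* (⅙ · (:0 :* y :* z)) :- c :* (½ · (:0 :* x))) :* (t :* t) := :0) refl (zz c) t _ _ _))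
  ∑-multiples c (suc n) = begin
      ∑ (λ i → X (+ m ℤ.* (c ℤ.* + i))) (suc n) ≈⟨ Sum.fold-snoc _ n ⟩
      ∑ (λ i → X (+ m ℤ.* (c ℤ.* + i))) n + X (+ m ℤ.* (c ℤ.* + n)) ≈⟨ +-cong (∑-multiples c n) (trans (X-multiple (c ℤ.* + n)) (qPower-cong (zz-* c (+ n)))) ⟩
      _ + qPower (zz c * nn n)
        ≈⟨ solve 3 (λ n c t → n :+ c :* (½ · (n :* (n :- :1))) :* t :+ ½ · (c :* c :* (⅙ · (n :* (n :- :1) :* (n :+ n :- :1))) :- c :* (½ · (n :* (n :- :1)))) :* (t :* t)
             :+ (:1 :+ c :* n :* t :+ ½ · (c :* n :* (c :* n :- :1)) :* (t :* t))
             := let n′ = :1 :+ n in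
                n′ :+ c :* (½ · (n′ :* (n′ :- :1))) :* t :+ ½ · (c :* c :* (⅙ · (n′ :* (n′ :- :1) :* (n′ :+ n′ :- :1))) :- c :* (½ · (n′ :* (n′ :- :1)))) :* (t :* t)) refl (nn n) (zz c) t ⟩
      _ ≈⟨ quad-cong e (*-congˡ (*-congˡ (*-cong e (+-congʳ e))))
             (*-congˡ (+-cong (*-congˡ (*-congˡ (*-cong (*-cong e (+-congʳ e)) (+-congʳ (+-cong e e))))) (-‿cong (*-congˡ (*-congˡ (*-cong e (+-congʳ e))))))) ⟨
      _ ∎
    where
    e = nn-suc n

  X-multiple-t : ∀ k → ∃ λ y → X (+ m ℤ.* k) ≈ 1# + t * y
  X-multiple-t k = zz k + ι ½ * (zz k * (zz k - 1#)) * t , trans (X-multiple k)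
    (solve 3 (λ k t c → :1 :+ k :* t :+ c :* (t :* t) := :1 :+ t :* (k :+ c :* t)) refl (zz k) t (ι ½ * (zz k * (zz k - 1#))))

  X-shift : ∀ {a b} k → a ≡ b ℤ.+ + m ℤ.* k → ∃ λ y → X a ≈ X b + t * y
  X-shift {a} {b} k e =
    let (y , h) = X-multiple-t k
    in X b * y , (begin
      X a ≈⟨ trans (X-congʳ e) (X-+ _ _) ⟩
      X b * X (+ m ℤ.* k) ≈⟨ *-congˡ h ⟩
      X b * (1# + t * y) ≈⟨ solve 3 (λ b t y → b :* (:1 :+ t :* y) := b :+ t :* (b :* y)) refl (X b) t y ⟩
      X b + t * (X b * y) ∎)

  t²-shift : ∀ {x y z} w → x ≈ y + t * z → t * t * (x * w) ≈ t * t * (y * w)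
  t²-shift {x} {y} {z} w e = trans (*-congˡ (*-congʳ e))
    (trans (solve 4 (λ t y z w → t :* t :* ((y :+ t :* z) :* w) := t :* t :* (y :* w) :+ z :* w :* (t :* (t :* t))) refl t y z w) (drop _ _))

  t²-one-minus : ∀ {x y z} w → x ≈ y + t * z → t * t * ((1# - x) * w) ≈ t * t * ((1# - y) * w)
  t²-one-minus {x} {y} {z} w e = t²-shift {z = - z} w (trans (+-congˡ (-‿cong e)) (solve 3 (λ t y z → :1 :- (y :+ t :* z) := (:1 :- y) :+ t :* (:- z)) refl t y z))

  -- The q-binomials binom(mn, k)_q with k between multiples of m.

  suc-index : ∀ j i → + suc (j ℕ.* m ℕ.+ i) ≡ + suc i ℤ.+ + m ℤ.* + j
  suc-index j i = ≡.trans (≡.cong (λ x → + 1 ℤ.+ (x ℤ.+ + i)) (ℤₚ.pos-* j m))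
    (ℤS.solve 3 (λ i j m → :1ᶻ :+ᶻ (j :*ᶻ m :+ᶻ i) :=ᶻ (:1ᶻ :+ᶻ i) :+ᶻ m :*ᶻ j) ≡.refl (+ i) (+ j) (+ m))

  unit-index : ∀ j i → i ℕ.< M → IsUnit (1# - X (+ suc (j ℕ.* m ℕ.+ i)))
  unit-index j i i<M =
    let (y , h) = X-shift (+ j) (suc-index j i)
    in unit-cong (sym (trans (+-congˡ (-‿cong h)) (solve 3 (λ x t y → :1 :- (x :+ t :* y) := (:1 :- x) :+ t :* (:- y)) refl (X (+ suc i)) t y)))
      (unit-perturb _ (units i i<M))

  -- The lower index has residue i + 1 modulo m, so i < `M` runs over the nonzero residues. Writing
  -- n as j + l avoids truncated subtraction.
  offBlock : ℕ → ℕ → ℕ → Carrier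
  offBlock j l i = gauss ((j ℕ.+ l) ℕ.* m) (suc (j ℕ.* m ℕ.+ i))

  sub-index : ∀ j l i → + ((j ℕ.+ l) ℕ.* m) ℤ.- + (j ℕ.* m ℕ.+ i) ≡ (ℤ.- + i) ℤ.+ + m ℤ.* + l
  sub-index j l i = ≡.trans (≡.cong₂ (λ x y → x ℤ.- (y ℤ.+ + i)) (ℤₚ.pos-* (j ℕ.+ l) m) (ℤₚ.pos-* j m))
    (ℤS.solve 4 (λ i j l m → (j :+ᶻ l) :*ᶻ m :-ᶻ (j :*ᶻ m :+ᶻ i) :=ᶻ (:-ᶻ i) :+ᶻ m :*ᶻ l) ≡.refl (+ i) (+ j) (+ l) (+ m))

  -- The step from jm to jm + 1 multiplies by (1 - Q^l)/(1 - q^(jm+1)), a multiple of t over a unit.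
  -- Up to the next multiple of m all further denominators are units, so the factor t persists.
  t∣offBlock : ∀ j l i → i ℕ.< M → ∃ λ e → offBlock j l i ≈ t * e
  t∣offBlock j l zero i<M =
    let (v , vh) = unit-index j 0 i<M
        (y , h) = X-shift (+ l) (sub-index j l 0)
    in v * (- (y * G)) , unit-cancelˡ (unit-index j 0 i<M) (begin
      a * offBlock j l 0 ≈⟨ absorb ((j ℕ.+ l) ℕ.* m) (j ℕ.* m ℕ.+ 0) ⟩
      (1# - X (+ ((j ℕ.+ l) ℕ.* m) ℤ.- + (j ℕ.* m ℕ.+ 0))) * G ≈⟨ *-congʳ (+-congˡ (-‿cong (trans h (+-congʳ X-0)))) ⟩
      (1# - (1# + t * y)) * G ≈⟨ solve 3 (λ t y G → (:1 :- (:1 :+ t :* y)) :* G := :1 :* (t :* (:- (y :* G)))) refl t y G ⟩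
      1# * (t * (- (y * G))) ≈⟨ *-congʳ vh ⟨
      a * v * (t * (- (y * G))) ≈⟨ solve 4 (λ a v t x → a :* v :* (t :* x) := a :* (t :* (v :* x))) refl a v t _ ⟩
      a * (t * (v * (- (y * G)))) ∎)
    where
    a = 1# - X (+ suc (j ℕ.* m ℕ.+ 0))
    G = gauss ((j ℕ.+ l) ℕ.* m) (j ℕ.* m ℕ.+ 0)
  t∣offBlock j l (suc i) i<M =
    let (v , vh) = unit-index j (suc i) i<M
        (e , h) = t∣offBlock j l i (ℕₚ.<-trans (ℕₚ.n<1+n i) i<M)
    in v * (b * e) , unit-cancelˡ (unit-index j (suc i) i<M) (begin
      a * offBlock j l (suc i) ≈⟨ absorb ((j ℕ.+ l) ℕ.* m) (j ℕ.* m ℕ.+ suc i) ⟩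
      b * gauss ((j ℕ.+ l) ℕ.* m) (j ℕ.* m ℕ.+ suc i) ≈⟨ *-congˡ (trans (reflexive (≡.cong (gauss ((j ℕ.+ l) ℕ.* m)) (ℕₚ.+-suc (j ℕ.* m) i))) h) ⟩
      b * (t * e) ≈⟨ trans (solve 3 (λ b t e → b :* (t :* e) := :1 :* (t :* (b :* e))) refl b t e) (*-congʳ (sym vh)) ⟩
      a * v * (t * (b * e)) ≈⟨ solve 4 (λ a v t x → a :* v :* (t :* x) := a :* (t :* (v :* x))) refl a v t _ ⟩
      a * (t * (v * (b * e))) ∎)
    where
    a = 1# - X (+ suc (j ℕ.* m ℕ.+ suc i))
    b = 1# - X (+ ((j ℕ.+ l) ℕ.* m) ℤ.- + (j ℕ.* m ℕ.+ suc i))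

  t-one-minus : ∀ {x y z w e} → w ≈ t * e → x ≈ y + t * z → t * ((1# - x) * w) ≈ t * ((1# - y) * w)
  t-one-minus {x} {y} {z} {w} {e} hw hx = begin
      t * ((1# - x) * w) ≈⟨ *-congˡ (*-congˡ hw) ⟩
      t * ((1# - x) * (t * e)) ≈⟨ solve 3 (λ t x e → t :* ((:1 :- x) :* (t :* e)) := t :* t :* ((:1 :- x) :* e)) refl t x e ⟩
      t * t * ((1# - x) * e) ≈⟨ t²-one-minus e hx ⟩
      t * t * ((1# - y) * e) ≈⟨ solve 3 (λ t x e → t :* ((:1 :- x) :* (t :* e)) := t :* t :* ((:1 :- x) :* e)) refl t y e ⟨
      t * ((1# - y) * (t * e)) ≈⟨ *-congˡ (*-congˡ hw) ⟨
      t * ((1# - y) * w) ∎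

  -- The numerator at the block boundary is 1 - Q^l = -l t modulo t². This is the origin of the
  -- factor n - j in the case λ = 2.
  offBlock-zero : ∀ j l → 0 ℕ.< M → t * ((1# - X (+ 1)) * offBlock j l 0) ≈ - nn l * (t * t * onBlock j l)
  offBlock-zero j l 0<M =
    let (e , h) = t∣offBlock j l 0 0<M
        (y , hy) = X-shift (+ j) (suc-index j 0)
    in begin
      t * ((1# - X (+ 1)) * E) ≈⟨ t-one-minus h hy ⟨
      t * ((1# - X (+ suc (j ℕ.* m ℕ.+ 0))) * E) ≈⟨ *-congˡ (absorb ((j ℕ.+ l) ℕ.* m) (j ℕ.* m ℕ.+ 0)) ⟩
      t * ((1# - X (+ ((j ℕ.+ l) ℕ.* m) ℤ.- + (j ℕ.* m ℕ.+ 0))) * gauss ((j ℕ.+ l) ℕ.* m) (j ℕ.* m ℕ.+ 0))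
        ≈⟨ *-congˡ (*-cong (+-congˡ (-‿cong (trans (X-congʳ (≡.trans (sub-index j l 0) (ℤₚ.+-identityˡ _))) (X-nat l))))
             (reflexive (≡.cong (gauss ((j ℕ.+ l) ℕ.* m)) (ℕₚ.+-identityʳ (j ℕ.* m))))) ⟩
      t * ((1# - qPower (nn l)) * G)
        ≈⟨ solve 4 (λ t n c G → t :* ((:1 :- (:1 :+ n :* t :+ c :* (t :* t))) :* G) := (:- n) :* (t :* t :* G) :+ (:- (c :* G)) :* (t :* (t :* t))) refl t (nn l) _ G ⟩
      - nn l * (t * t * G) + (- (ι ½ * (nn l * (nn l - 1#)) * G)) * (t * (t * t)) ≈⟨ drop _ _ ⟩
      - nn l * (t * t * G) ∎
    where
    E = offBlock j l 0
    G = onBlock j l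

  offBlock-suc : ∀ j l i → suc i ℕ.< M →
    t * ((1# - X (+ suc (suc i))) * offBlock j l (suc i)) ≈ t * ((1# - X (ℤ.- + suc i)) * offBlock j l i)
  offBlock-suc j l i i<M =
    let (_ , h) = t∣offBlock j l (suc i) i<M
        (_ , h′) = t∣offBlock j l i (ℕₚ.<-trans (ℕₚ.n<1+n i) i<M)
        (_ , hy) = X-shift (+ j) (suc-index j (suc i))
        (_ , hz) = X-shift (+ l) (sub-index j l (suc i))
    in begin
      t * ((1# - X (+ suc (suc i))) * offBlock j l (suc i)) ≈⟨ t-one-minus h hy ⟨
      t * ((1# - X (+ suc (j ℕ.* m ℕ.+ suc i))) * offBlock j l (suc i)) ≈⟨ *-congˡ (absorb ((j ℕ.+ l) ℕ.* m) (j ℕ.* m ℕ.+ suc i)) ⟩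
      t * ((1# - X (+ ((j ℕ.+ l) ℕ.* m) ℤ.- + (j ℕ.* m ℕ.+ suc i))) * gauss ((j ℕ.+ l) ℕ.* m) (j ℕ.* m ℕ.+ suc i))
        ≈⟨ *-congˡ (*-congˡ (reflexive (≡.cong (gauss ((j ℕ.+ l) ℕ.* m)) (ℕₚ.+-suc (j ℕ.* m) i)))) ⟩
      t * ((1# - X (+ ((j ℕ.+ l) ℕ.* m) ℤ.- + (j ℕ.* m ℕ.+ suc i))) * offBlock j l i) ≈⟨ t-one-minus h′ hz ⟩
      t * ((1# - X (ℤ.- + suc i)) * offBlock j l i) ∎

  -- After multiplication by t both sequences in i obey the recursion `offBlock-suc`, whose
  -- coefficients depend on neither j nor l, and their initial values have ratio l c. Here
  -- `offBlock 0 1 i` is binom(m, i+1)_q, and c will be binom(j+l, j).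
  offBlock-compare : ∀ j l c → t * t * onBlock j l ≈ t * t * c →
    ∀ i → i ℕ.< M → t * offBlock j l i ≈ nn l * c * (t * offBlock 0 1 i)
  offBlock-compare j l c hc zero i<M = unit-cancelˡ (units 0 i<M) (begin
      a * (t * offBlock j l 0) ≈⟨ solve 3 (λ a t e → a :* (t :* e) := t :* (a :* e)) refl a t _ ⟩
      t * (a * offBlock j l 0) ≈⟨ offBlock-zero j l i<M ⟩
      - nn l * (t * t * onBlock j l) ≈⟨ *-congˡ hc ⟩
      - nn l * (t * t * c) ≈⟨ solve 3 (λ n t c → (:- n) :* (t :* t :* c) := n :* c :* ((:- :1) :* (t :* t :* :1))) refl (nn l) t c ⟩
      nn l * c * ((- 1#) * (t * t * 1#)) ≈⟨ *-congˡ (*-congʳ (-‿cong ι-1)) ⟨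
      nn l * c * ((- nn 1) * (t * t * 1#)) ≈⟨ *-congˡ (offBlock-zero 0 1 i<M) ⟨
      nn l * c * (t * (a * offBlock 0 1 0)) ≈⟨ solve 4 (λ a t e n → n :* (t :* (a :* e)) := a :* (n :* (t :* e))) refl a t _ _ ⟩
      a * (nn l * c * (t * offBlock 0 1 0)) ∎)
    where
    a = 1# - X (+ 1)
  offBlock-compare j l c hc (suc i) i<M = unit-cancelˡ (units (suc i) i<M) (begin
      a * (t * offBlock j l (suc i)) ≈⟨ solve 3 (λ a t e → a :* (t :* e) := t :* (a :* e)) refl a t _ ⟩
      t * (a * offBlock j l (suc i)) ≈⟨ offBlock-suc j l i i<M ⟩
      t * (b * offBlock j l i) ≈⟨ solve 3 (λ a t e → a :* (t :* e) := t :* (a :* e)) refl b t _ ⟨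
      b * (t * offBlock j l i) ≈⟨ *-congˡ (offBlock-compare j l c hc i (ℕₚ.<-trans (ℕₚ.n<1+n i) i<M)) ⟩
      b * (nn l * c * (t * offBlock 0 1 i)) ≈⟨ solve 4 (λ a t e n → n :* (t :* (a :* e)) := a :* (n :* (t :* e))) refl b t _ _ ⟨
      nn l * c * (t * (b * offBlock 0 1 i)) ≈⟨ *-congˡ (offBlock-suc 0 1 i i<M) ⟨
      nn l * c * (t * (a * offBlock 0 1 (suc i))) ≈⟨ solve 4 (λ a t e n → n :* (t :* (a :* e)) := a :* (n :* (t :* e))) refl a t _ _ ⟩
      a * (nn l * c * (t * offBlock 0 1 (suc i))) ∎)
    where
    a = 1# - X (+ suc (suc i))
    b = 1# - X (ℤ.- + suc i)

  -- Both factors are multiples of t, so the comparison modulo t² determines the square modulo t³.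
  offBlock-square : ∀ j l c → t * t * onBlock j l ≈ t * t * c →
    ∀ i → i ℕ.< M → offBlock j l i * offBlock j l i ≈ nn l * c * (nn l * c) * (offBlock 0 1 i * offBlock 0 1 i)
  offBlock-square j l c hc i i<M =
    let (e , h) = t∣offBlock j l i i<M
        (e₀ , h₀) = t∣offBlock 0 1 i i<M
    in begin
      E * E ≈⟨ *-congʳ h ⟩
      t * e * E ≈⟨ solve 3 (λ t e E → t :* e :* E := e :* (t :* E)) refl t e E ⟩
      e * (t * E) ≈⟨ *-congˡ (offBlock-compare j l c hc i i<M) ⟩
      e * (d * (t * E₀)) ≈⟨ solve 4 (λ t e d E → e :* (d :* (t :* E)) := d :* (t :* e :* E)) refl t e d E₀ ⟩
      d * (t * e * E₀) ≈⟨ *-congˡ (*-cong (sym h) h₀) ⟩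
      d * (E * (t * e₀)) ≈⟨ solve 4 (λ t e d E → d :* (E :* (t :* e)) := d :* (e :* (t :* E))) refl t e₀ d E ⟩
      d * (e₀ * (t * E)) ≈⟨ *-congˡ (*-congˡ (offBlock-compare j l c hc i i<M)) ⟩
      d * (e₀ * (d * (t * E₀))) ≈⟨ solve 4 (λ t e d E → d :* (e :* (d :* (t :* E))) := d :* d :* (t :* e :* E)) refl t e₀ d E₀ ⟩
      d * d * (t * e₀ * E₀) ≈⟨ *-congˡ (*-congʳ h₀) ⟨
      d * d * (E₀ * E₀) ∎
    where
    d = nn l * c
    E = offBlock j l i
    E₀ = offBlock 0 1 i

  -- Raising both indices multiplies the coefficient by (1 - q^(N+1))/(1 - q^(k+1)). As N - k = nm,
  -- numerator and denominator agree modulo t, and the denominator is a unit.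
  gauss-rises : ∀ n j c → t * t * gauss ((n ℕ.+ j) ℕ.* m) (j ℕ.* m) ≈ t * t * c →
    ∀ i → i ℕ.≤ M → t * t * gauss (n ℕ.* m ℕ.+ (j ℕ.* m ℕ.+ i)) (j ℕ.* m ℕ.+ i) ≈ t * t * c
  gauss-rises n j c hc zero _ = trans (*-congˡ (reflexive (≡.cong₂ gauss
      (≡.trans (≡.cong (n ℕ.* m ℕ.+_) (ℕₚ.+-identityʳ (j ℕ.* m))) (≡.sym (ℕₚ.*-distribʳ-+ m n j))) (ℕₚ.+-identityʳ (j ℕ.* m))))) hc
  gauss-rises n j c hc (suc i) i<M =
    let (_ , hy) = X-shift (+ j) (suc-index j i)
        (_ , hz) = X-shift (+ (n ℕ.+ j)) (suc-index (n ℕ.+ j) i)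
    in unit-cancelˡ (units i i<M) (begin
      a * (t * t * gauss (n ℕ.* m ℕ.+ (j ℕ.* m ℕ.+ suc i)) (j ℕ.* m ℕ.+ suc i))
        ≈⟨ *-congˡ (*-congˡ (reflexive (≡.cong₂ gauss (≡.trans (≡.cong (n ℕ.* m ℕ.+_) (ℕₚ.+-suc (j ℕ.* m) i)) (ℕₚ.+-suc (n ℕ.* m) _)) (ℕₚ.+-suc (j ℕ.* m) i)))) ⟩
      a * (t * t * gauss (suc N) (suc k)) ≈⟨ solve 3 (λ a t e → a :* (t :* t :* e) := t :* t :* (a :* e)) refl a t _ ⟩
      t * t * (a * gauss (suc N) (suc k)) ≈⟨ t²-one-minus _ hy ⟨
      t * t * ((1# - X (+ suc k)) * gauss (suc N) (suc k)) ≈⟨ *-congˡ (absorb-both N k) ⟩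
      t * t * ((1# - X (+ suc N)) * gauss N k) ≈⟨ *-congˡ (*-congʳ (+-congˡ (-‿cong (X-congʳ (≡.cong (λ x → + suc x) N≡))))) ⟩
      t * t * ((1# - X (+ suc ((n ℕ.+ j) ℕ.* m ℕ.+ i))) * gauss N k) ≈⟨ t²-one-minus _ hz ⟩
      t * t * (a * gauss N k) ≈⟨ solve 3 (λ a t e → a :* (t :* t :* e) := t :* t :* (a :* e)) refl a t _ ⟨
      a * (t * t * gauss N k) ≈⟨ *-congˡ (gauss-rises n j c hc i (ℕₚ.<⇒≤ i<M)) ⟩
      a * (t * t * c) ∎)
    where
    a = 1# - X (+ suc i)
    k = j ℕ.* m ℕ.+ i
    N = n ℕ.* m ℕ.+ k
    N≡ : N ≡ (n ℕ.+ j) ℕ.* m ℕ.+ i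
    N≡ = ≡.trans (≡.sym (ℕₚ.+-assoc (n ℕ.* m) (j ℕ.* m) i)) (≡.cong (ℕ._+ i) (≡.sym (ℕₚ.*-distribʳ-+ m n j)))

  -- The expansion of F(s) and the ratio F(s)/F(0).

  coefficient : ℕ → Carrier
  coefficient j = sign j * gauss M j

  -- `coefficient j` is the T_j of the overview. As binom(m, j+1)_q is a multiple of t, Pascal's
  -- rule times t² says that q^(j+1) binom(m-1, j+1)_q and -binom(m-1, j)_q agree; the sign and the
  -- power of q in T_j compensate exactly this.
  t²-coefficient : ∀ j → j ℕ.≤ M → t * t * coefficient j ≈ t * t
  t²-coefficient zero _ = trans (*-congˡ (*-identityˡ _)) (*-identityʳ _)
  t²-coefficient (suc j) j<M = begin
      t * t * (- (x * s) * G′)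
        ≈⟨ solve 5 (λ t x s G′ G → t :* t :* ((:- (x :* s)) :* G′) := t :* t :* (s :* G) :- s :* (t :* t :* (x :* G′ :+ G))) refl t x s G′ G ⟩
      t * t * (s * G) - s * (t * t * gauss m (suc j))
        ≈⟨ +-cong (t²-coefficient j (ℕₚ.<⇒≤ j<M)) (-‿cong (*-congˡ vanish)) ⟩
      t * t - s * 0#
        ≈⟨ solve 2 (λ t s → t :* t :- s :* :0 := t :* t) refl t s ⟩
      t * t ∎
    where
    x = X (+ suc j)
    s = sign j
    G′ = gauss M (suc j)
    G = gauss M j
    vanish : t * t * gauss m (suc j) ≈ 0#
    vanish = let (e , h) = t∣offBlock 0 1 j j<M in begin
      t * t * gauss m (suc j) ≈⟨ *-congˡ (reflexive (≡.cong (λ n → gauss n (suc j)) (≡.sym (ℕₚ.+-identityʳ m)))) ⟩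
      t * t * offBlock 0 1 j ≈⟨ *-congˡ h ⟩
      t * t * (t * e) ≈⟨ solve 2 (λ t e → t :* t :* (t :* e) := :0 :+ e :* (t :* (t :* t))) refl t e ⟩
      0# + e * (t * (t * t)) ≈⟨ drop 0# e ⟩
      0# ∎

  c₀ c₁ s₁ s₂ : Carrier
  c₀ = ∑ coefficient m
  c₁ = ∑ (λ j → t * (coefficient j * nn j)) m
  s₁ = ∑ nn m
  s₂ = ∑ (λ j → nn j * nn j) m

  ∑-linear : ∀ (f g h k : ℕ → Carrier) a b c n →
    ∑ (λ j → f j + a * g j + c * (b * h j - a * k j)) n ≈ ∑ f n + a * ∑ g n + c * (b * ∑ h n - a * ∑ k n)
  ∑-linear f g h k a b c zero = solve 3 (λ a b c → :0 := :0 :+ a :* :0 :+ c :* (b :* :0 :- a :* :0)) refl a b c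
  ∑-linear f g h k a b c (suc n) = trans (+-congˡ (∑-linear _ _ _ _ a b c n))
    (solve 11 (λ a b c f g h k F G H K → f :+ a :* g :+ c :* (b :* h :- a :* k) :+ (F :+ a :* G :+ c :* (b :* H :- a :* K))
        := f :+ F :+ a :* (g :+ G) :+ c :* (b :* (h :+ H) :- a :* (k :+ K))) refl
      a b c (f 0) (g 0) (h 0) (k 0) (∑ (λ j → f (suc j)) n) (∑ (λ j → g (suc j)) n) (∑ (λ j → h (suc j)) n) (∑ (λ j → k (suc j)) n))

  -- In T_j Q^(sj) = T_j (1 + sj t + sj(sj-1)/2 t²) the T_j next to t² may be replaced by 1. So F(s)
  -- is quadratic in s with only `c₀` and `c₁` unknown; the rest is power sums of j.
  block-expand : ∀ s → block s ≈ c₀ + zz s * c₁ + t * t * ι ½ * (zz s * zz s * s₂ - zz s * s₁)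
  block-expand s = begin
      block s ≈⟨ qBinomial (+ m ℤ.* s) M ⟩
      ∑ (qBinomialTerm (+ m ℤ.* s) M) m ≈⟨ Sum.fold-cong< m (λ j j<m → term j (ℕₚ.≤-pred j<m)) ⟩
      ∑ (λ j → coefficient j + zz s * (t * (coefficient j * nn j)) + t * t * ι ½ * (zz s * zz s * (nn j * nn j) - zz s * nn j)) m
        ≈⟨ ∑-linear coefficient (λ j → t * (coefficient j * nn j)) (λ j → nn j * nn j) nn (zz s) (zz s * zz s) (t * t * ι ½) m ⟩
      c₀ + zz s * c₁ + t * t * ι ½ * (zz s * zz s * s₂ - zz s * s₁) ∎
    where
    term : ∀ j → j ℕ.≤ M → coefficient j * X (+ m ℤ.* s ℤ.* + j) ≈
      coefficient j + zz s * (t * (coefficient j * nn j)) + t * t * ι ½ * (zz s * zz s * (nn j * nn j) - zz s * nn j)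
    term j j≤M = begin
      coefficient j * X (+ m ℤ.* s ℤ.* + j)
        ≈⟨ *-congˡ (trans (X-congʳ (ℤₚ.*-assoc (+ m) s (+ j))) (trans (X-multiple (s ℤ.* + j)) (qPower-cong (zz-* s (+ j))))) ⟩
      coefficient j * qPower (zz s * nn j)
        ≈⟨ solve 4 (λ T z n t → T :* (:1 :+ z :* n :* t :+ ½ · (z :* n :* (z :* n :- :1)) :* (t :* t))
             := T :+ z :* (t :* (T :* n)) :+ (t :* t :* T) :* con ½ :* (z :* z :* (n :* n) :- z :* n)) refl (coefficient j) (zz s) (nn j) t ⟩
      coefficient j + zz s * (t * (coefficient j * nn j)) + (t * t * coefficient j) * ι ½ * (zz s * zz s * (nn j * nn j) - zz s * nn j)
        ≈⟨ +-congˡ (*-congʳ (*-congʳ (t²-coefficient j j≤M))) ⟩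
      coefficient j + zz s * (t * (coefficient j * nn j)) + t * t * ι ½ * (zz s * zz s * (nn j * nn j) - zz s * nn j) ∎

  block-0 : block 0ℤ ≈ c₀
  block-0 = trans (block-expand 0ℤ) (trans
    (+-cong (+-congˡ (*-congʳ ι-0)) (*-congˡ (+-cong (*-congʳ (*-congʳ ι-0)) (-‿cong (*-congʳ ι-0)))))
    (solve 6 (λ c₀ c₁ d z s₂ s₁ → c₀ :+ :0 :* c₁ :+ d :* (:0 :* z :* s₂ :- :0 :* s₁) := c₀) refl c₀ c₁ (t * t * ι ½) (zz 0ℤ) s₂ s₁))

  block-unit : IsUnit c₀
  block-unit = unit-cong block-0 (unit-∏ _ M (λ r r<M → unit-cong
    (+-congˡ (-‿cong (X-congʳ (≡.sym (≡.trans (≡.cong (ℤ._+ + suc r) (ℤₚ.*-zeroʳ (+ m))) (ℤₚ.+-identityˡ _)))))) (units r r<M)))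

  reflection : ℕ → Carrier
  reflection = ∏ (λ r → - X (ℤ.- + suc r))

  -- Reversing the product pairs r with m - r, and 1 - q^(-r) = -q^(-r) (1 - q^r). The collected
  -- factors -q^(-r) form ε.
  block-reflect : block (ℤ.- 1ℤ) ≈ reflection M * c₀
  block-reflect = begin
      block (ℤ.- 1ℤ) ≈⟨ Product.fold-reverse _ M ⟩
      ∏ (λ i → 1# - X (+ m ℤ.* (ℤ.- 1ℤ) ℤ.+ + suc (M ℕ.∸ suc i))) M ≈⟨ Product.fold-cong< M step ⟩
      ∏ (λ i → (- X (ℤ.- + suc i)) * (1# - X (+ m ℤ.* 0ℤ ℤ.+ + suc i))) M ≈⟨ Product.fold-∙ (λ i → - X (ℤ.- + suc i)) (λ i → 1# - X (+ m ℤ.* 0ℤ ℤ.+ + suc i)) M ⟩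
      reflection M * block 0ℤ ≈⟨ *-congˡ block-0 ⟩
      reflection M * c₀ ∎
    where
    step : ∀ i → i ℕ.< M → 1# - X (+ m ℤ.* (ℤ.- 1ℤ) ℤ.+ + suc (M ℕ.∸ suc i)) ≈ (- X (ℤ.- + suc i)) * (1# - X (+ m ℤ.* 0ℤ ℤ.+ + suc i))
    step i i<M = begin
      1# - X (+ m ℤ.* (ℤ.- 1ℤ) ℤ.+ + suc d) ≈⟨ +-cong (sym X-0) (-‿cong (X-congʳ e₁)) ⟩
      X 0ℤ - X (ℤ.- + suc i) ≈⟨ +-congʳ (trans (X-congʳ e₂) (X-+ _ _)) ⟩
      X (ℤ.- + suc i) * X (+ m ℤ.* 0ℤ ℤ.+ + suc i) - X (ℤ.- + suc i)
        ≈⟨ solve 2 (λ a b → a :* b :- a := (:- a) :* (:1 :- b)) refl (X (ℤ.- + suc i)) (X (+ m ℤ.* 0ℤ ℤ.+ + suc i)) ⟩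
      (- X (ℤ.- + suc i)) * (1# - X (+ m ℤ.* 0ℤ ℤ.+ + suc i)) ∎
      where
      d = M ℕ.∸ suc i
      e₁ : + m ℤ.* (ℤ.- 1ℤ) ℤ.+ + suc d ≡ ℤ.- + suc i
      e₁ = ≡.trans (≡.cong (λ M → + suc M ℤ.* (ℤ.- 1ℤ) ℤ.+ + suc d) (≡.sym (ℕₚ.m∸n+n≡m i<M)))
        (ℤS.solve 2 (λ d i → (:1ᶻ :+ᶻ (d :+ᶻ (:1ᶻ :+ᶻ i))) :*ᶻ (:-ᶻ :1ᶻ) :+ᶻ (:1ᶻ :+ᶻ d) :=ᶻ :-ᶻ (:1ᶻ :+ᶻ i)) ≡.refl (+ d) (+ i))
      e₂ : 0ℤ ≡ (ℤ.- + suc i) ℤ.+ (+ m ℤ.* 0ℤ ℤ.+ + suc i)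
      e₂ = ℤS.solve 2 (λ m i → ℤS.con 0ℤ :=ᶻ (:-ᶻ i) :+ᶻ (m :*ᶻ ℤS.con 0ℤ :+ᶻ i)) ≡.refl (+ m) (+ suc i)

  -- Squaring removes the sign and doubles the exponent, so that for n = m - 1 a power of Q results.
  -- The exponent m(m-1)/2 belonging to ε itself is not a multiple of m when m is even.
  reflection-square : ∀ n → reflection n * reflection n ≈ X (+ suc n ℤ.* (ℤ.- + n))
  reflection-square zero = trans (*-identityˡ _) (sym X-0)
  reflection-square (suc n) = begin
      reflection (suc n) * reflection (suc n) ≈⟨ *-cong (Product.fold-snoc _ n) (Product.fold-snoc _ n) ⟩
      (reflection n * - x) * (reflection n * - x) ≈⟨ solve 2 (λ r x → (r :* (:- x)) :* (r :* (:- x)) := r :* r :* (x :* x)) refl (reflection n) x ⟩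
      reflection n * reflection n * (x * x) ≈⟨ *-cong (reflection-square n) (X-merge ≡.refl) ⟩
      X (+ suc n ℤ.* (ℤ.- + n)) * X ((ℤ.- + suc n) ℤ.+ (ℤ.- + suc n)) ≈⟨ X-merge (ℤS.solve 1 (λ n → (:1ᶻ :+ᶻ n) :*ᶻ (:-ᶻ n) :+ᶻ ((:-ᶻ (:1ᶻ :+ᶻ n)) :+ᶻ (:-ᶻ (:1ᶻ :+ᶻ n))) :=ᶻ (ℤS.con (+ 2) :+ᶻ n) :*ᶻ (:-ᶻ (:1ᶻ :+ᶻ n))) ≡.refl (+ n)) ⟩
      X (+ suc (suc n) ℤ.* (ℤ.- + suc n)) ∎
    where
    x = X (ℤ.- + suc n)

  ¼ ⅛ : ℚ
  ¼ = + 1 ℚ./ 4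
  ⅛ = + 1 ℚ./ 8

  -- The square of ε = reflection M is known exactly; that ε ≡ 1 modulo t selects the square root.
  reflection-expand : reflection M ≈ quad 1# (- (ι ½ * nn M)) (ι ¼ * (nn M * (nn M + 1#)) - ι ⅛ * (nn M * nn M))
  reflection-expand = begin
      ε ≈⟨ ε≈ ⟩
      1# + t * d
        -- For x = t d: x = ((1+x)² - 1)/2 - x²/2. The square is ε², and x² requires x only modulo
        -- t², which `t²d` supplies.
        ≈⟨ solve 2 (λ t d → :1 :+ t :* d := :1 :+ ½ · ((:1 :+ t :* d) :* (:1 :+ t :* d) :- :1) :- ½ · (d :* (t :* t :* d))) refl t d ⟩
      1# + ι ½ * ((1# + t * d) * (1# + t * d) - 1#) - ι ½ * (d * (t * t * d))
        ≈⟨ +-cong (+-congˡ (*-congˡ (+-congʳ square))) (-‿cong (*-congˡ t²d²)) ⟩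
      1# + ι ½ * (qPower (- nn M) - 1#) - ι ½ * (ι ¼ * (nn M * nn M * (t * t)))
        ≈⟨ solve 2 (λ t n → :1 :+ ½ · ((:1 :+ (:- n) :* t :+ ½ · ((:- n) :* ((:- n) :- :1)) :* (t :* t)) :- :1) :- ½ · (¼ · (n :* n :* (t :* t)))
             := :1 :+ (:- (½ · n)) :* t :+ (¼ · (n :* (n :+ :1)) :- ⅛ · (n :* n)) :* (t :* t)) refl t (nn M) ⟩
      quad 1# (- (ι ½ * nn M)) (ι ¼ * (nn M * (nn M + 1#)) - ι ⅛ * (nn M * nn M)) ∎
    where
    ε = reflection M
    v y d : Carrier
    v = proj₁ block-unit
    y = ∑ (λ j → coefficient j * nn j) m
    -- F(-1) = ε F(0) gives (ε - 1) F(0) = t² (s₂ + s₁)/2 - c₁ with c₁ = t y; d is the right side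
    -- divided by t and by F(0).
    d = v * (t * ι ½ * (s₂ + s₁) - y)
    c₁≈ : c₁ ≈ t * y
    c₁≈ = sym (∑-*ˡ t (λ j → coefficient j * nn j) m)
    ε≈ : ε ≈ 1# + t * d
    ε≈ = begin
      ε ≈⟨ solve 1 (λ e → e := :1 :+ (e :- :1) :* :1) refl ε ⟩
      1# + (ε - 1#) * 1# ≈⟨ +-congˡ (*-congˡ (proj₂ block-unit)) ⟨
      1# + (ε - 1#) * (c₀ * v) ≈⟨ solve 3 (λ e c v → :1 :+ (e :- :1) :* (c :* v) := :1 :+ v :* (e :* c :- c)) refl ε c₀ v ⟩
      1# + v * (ε * c₀ - c₀) ≈⟨ +-congˡ (*-congˡ (+-congʳ (trans (sym block-reflect) (block-expand (ℤ.- 1ℤ))))) ⟩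
      1# + v * (c₀ + zz (ℤ.- 1ℤ) * c₁ + t * t * ι ½ * (zz (ℤ.- 1ℤ) * zz (ℤ.- 1ℤ) * s₂ - zz (ℤ.- 1ℤ) * s₁) - c₀)
        ≈⟨ +-congˡ (*-congˡ (+-congʳ (+-cong (+-congˡ (*-cong z≈ c₁≈)) (*-congˡ (+-cong (*-congʳ (*-cong z≈ z≈)) (-‿cong (*-congʳ z≈))))))) ⟩
      1# + v * (c₀ + (- 1#) * (t * y) + t * t * ι ½ * ((- 1#) * (- 1#) * s₂ - (- 1#) * s₁) - c₀)
        ≈⟨ solve 6 (λ v c t y s₂ s₁ → :1 :+ v :* (c :+ (:- :1) :* (t :* y) :+ t :* t :* con ½ :* ((:- :1) :* (:- :1) :* s₂ :- (:- :1) :* s₁) :- c)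
             := :1 :+ t :* (v :* (t :* con ½ :* (s₂ :+ s₁) :- y))) refl v c₀ t y s₂ s₁ ⟩
      1# + t * d ∎
      where
      z≈ : zz (ℤ.- 1ℤ) ≈ - 1#
      z≈ = trans (zz-neg 1ℤ) (-‿cong ι-1)
    square : (1# + t * d) * (1# + t * d) ≈ qPower (- nn M)
    square = begin
      (1# + t * d) * (1# + t * d) ≈⟨ *-cong ε≈ ε≈ ⟨
      ε * ε ≈⟨ reflection-square M ⟩
      X (+ m ℤ.* (ℤ.- + M)) ≈⟨ X-multiple (ℤ.- + M) ⟩
      qPower (zz (ℤ.- + M)) ≈⟨ qPower-cong (zz-neg (+ M)) ⟩
      qPower (- nn M) ∎
    t²d : t * t * d ≈ - (ι ½ * nn M) * (t * t)
    t²d = begin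
      t * t * d
        ≈⟨ solve 2 (λ t d → t :* t :* d := ½ · (t :* ((:1 :+ t :* d) :* (:1 :+ t :* d) :- :1)) :+ (:- (½ · (d :* d))) :* (t :* (t :* t))) refl t d ⟩
      ι ½ * (t * ((1# + t * d) * (1# + t * d) - 1#)) + (- (ι ½ * (d * d))) * (t * (t * t)) ≈⟨ drop _ _ ⟩
      ι ½ * (t * ((1# + t * d) * (1# + t * d) - 1#)) ≈⟨ *-congˡ (*-congˡ (+-congʳ square)) ⟩
      ι ½ * (t * (qPower (- nn M) - 1#))
        ≈⟨ solve 3 (λ t n c → ½ · (t :* ((:1 :+ (:- n) :* t :+ c :* (t :* t)) :- :1)) := (:- (½ · n)) :* (t :* t) :+ ½ · c :* (t :* (t :* t))) refl t (nn M) (ι ½ * ((- nn M) * ((- nn M) - 1#))) ⟩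
      - (ι ½ * nn M) * (t * t) + ι ½ * (ι ½ * ((- nn M) * ((- nn M) - 1#))) * (t * (t * t)) ≈⟨ drop _ _ ⟩
      - (ι ½ * nn M) * (t * t) ∎
    t²d² : d * (t * t * d) ≈ ι ¼ * (nn M * nn M * (t * t))
    t²d² = begin
      d * (t * t * d) ≈⟨ *-congˡ t²d ⟩
      d * (- (ι ½ * nn M) * (t * t)) ≈⟨ solve 3 (λ t d n → d :* ((:- (½ · n)) :* (t :* t)) := (:- (½ · n)) :* (t :* t :* d)) refl t d (nn M) ⟩
      - (ι ½ * nn M) * (t * t * d) ≈⟨ *-congˡ t²d ⟩
      - (ι ½ * nn M) * (- (ι ½ * nn M) * (t * t)) ≈⟨ solve 2 (λ t n → (:- (½ · n)) :* ((:- (½ · n)) :* (t :* t)) := ¼ · (n :* n :* (t :* t))) refl t (nn M) ⟩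
      ι ¼ * (nn M * nn M * (t * t)) ∎

  1/12 1/24 : ℚ
  1/12 = + 1 ℚ./ 12
  1/24 = + 1 ℚ./ 24

  -- F(0) is the sum of the m coefficients T_j, each equal to 1 up to the factor t². It is the
  -- counterpart of ∏ (1 - ζ^r) = m for a primitive m-th root of unity ζ.
  t²-c₀ : t * t * c₀ ≈ t * t * (1# + nn M)
  t²-c₀ = trans (∑-*ˡ (t * t) coefficient m) (trans (Sum.fold-cong< m (λ j j<m → t²-coefficient j (ℕₚ.≤-pred j<m))) (trans (const m) (*-congˡ (nn-suc M))))
    where
    const : ∀ n → ∑ (λ _ → t * t) n ≈ t * t * nn n
    const zero = sym (trans (*-congˡ nn-0) (zeroʳ _))
    const (suc n) = trans (+-congˡ (const n)) (trans (solve 2 (λ x n → x :+ x :* n := x :* (:1 :+ n)) refl (t * t) (nn n)) (*-congˡ (sym (nn-suc n))))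

  -- F(s)/F(0), with M for m - 1. The terms with s alone are s (1 - ε); M(2M+1)/12, the factor of s²
  -- + s, is ∑ j² divided by 2m.
  blockSeries : Carrier → Carrier → Carrier
  blockSeries M s = quad 1# (s * (ι ½ * M)) (s * (ι ⅛ * (M * M) - ι ¼ * (M * (M + 1#))) + ι 1/12 * (M * (M + M + 1#)) * (s * s + s))

  -- `c₁` is eliminated through F(-1) = ε F(0): it equals (1 - ε) F(0) + t² (s₂ + s₁)/2, and `s₁`
  -- then cancels.
  block-series : ∀ s → block s ≈ c₀ * blockSeries (nn M) (zz s)
  block-series s = begin
      block s ≈⟨ block-expand s ⟩
      c₀ + z * c₁ + t * t * ι ½ * (z * z * s₂ - z * s₁)
        ≈⟨ +-congʳ (+-congˡ (*-congˡ c₁≈)) ⟩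
      c₀ + z * ((1# - reflection M) * c₀ + t * t * ι ½ * (s₂ + s₁)) + t * t * ι ½ * (z * z * s₂ - z * s₁)
        ≈⟨ solve 6 (λ c z e t s₂ s₁ → c :+ z :* ((:1 :- e) :* c :+ t :* t :* con ½ :* (s₂ :+ s₁)) :+ t :* t :* con ½ :* (z :* z :* s₂ :- z :* s₁)
             := c :* (:1 :+ z :* (:1 :- e)) :+ t :* t :* con ½ :* (s₂ :* (z :* z :+ z))) refl c₀ z (reflection M) t s₂ s₁ ⟩
      c₀ * (1# + z * (1# - reflection M)) + t * t * ι ½ * (s₂ * (z * z + z))
        ≈⟨ +-cong (*-congˡ (+-congˡ (*-congˡ (+-congˡ (-‿cong reflection-expand))))) (*-congˡ (*-congʳ s₂≈)) ⟩
      c₀ * (1# + z * (1# - quad 1# (- (ι ½ * nn M)) (ι ¼ * (nn M * (nn M + 1#)) - ι ⅛ * (nn M * nn M))))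
        + t * t * ι ½ * (ι ⅙ * ((1# + nn M) * ((1# + nn M) - 1#) * ((1# + nn M) + (1# + nn M) - 1#)) * (z * z + z))
        ≈⟨ solve 4 (λ c z t n → c :* (:1 :+ z :* (:1 :- (:1 :+ (:- (½ · n)) :* t :+ (¼ · (n :* (n :+ :1)) :- ⅛ · (n :* n)) :* (t :* t))))
               :+ t :* t :* con ½ :* (⅙ · ((:1 :+ n) :* ((:1 :+ n) :- :1) :* ((:1 :+ n) :+ (:1 :+ n) :- :1)) :* (z :* z :+ z))
             := c :* (:1 :+ z :* (½ · n) :* t :+ z :* (⅛ · (n :* n) :- ¼ · (n :* (n :+ :1))) :* (t :* t))
               :+ t :* t :* (:1 :+ n) :* (1/12 · (n :* (n :+ n :+ :1)) :* (z :* z :+ z))) refl c₀ z t (nn M) ⟩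
      c₀ * (1# + z * (ι ½ * nn M) * t + z * (ι ⅛ * (nn M * nn M) - ι ¼ * (nn M * (nn M + 1#))) * (t * t))
        + t * t * (1# + nn M) * (ι 1/12 * (nn M * (nn M + nn M + 1#)) * (z * z + z))
        -- Replacing t² m by t² F(0) gives the last term the common factor F(0).
        ≈⟨ +-congˡ (*-congʳ t²-c₀) ⟨
      c₀ * (1# + z * (ι ½ * nn M) * t + z * (ι ⅛ * (nn M * nn M) - ι ¼ * (nn M * (nn M + 1#))) * (t * t))
        + t * t * c₀ * (ι 1/12 * (nn M * (nn M + nn M + 1#)) * (z * z + z))
        ≈⟨ solve 5 (λ c a b t e → c :* (:1 :+ a :* t :+ b :* (t :* t)) :+ t :* t :* c :* e := c :* (:1 :+ a :* t :+ (b :+ e) :* (t :* t))) refl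
             c₀ (z * (ι ½ * nn M)) (z * (ι ⅛ * (nn M * nn M) - ι ¼ * (nn M * (nn M + 1#)))) t (ι 1/12 * (nn M * (nn M + nn M + 1#)) * (z * z + z)) ⟩
      c₀ * blockSeries (nn M) z ∎
    where
    z = zz s
    s₂≈ : s₂ ≈ ι ⅙ * ((1# + nn M) * ((1# + nn M) - 1#) * ((1# + nn M) + (1# + nn M) - 1#))
    s₂≈ = trans (sumOfSquares m) (*-congˡ (*-cong (*-cong (nn-suc M) (+-congʳ (nn-suc M))) (+-congʳ (+-cong (nn-suc M) (nn-suc M)))))
    c₁≈ : c₁ ≈ (1# - reflection M) * c₀ + t * t * ι ½ * (s₂ + s₁)
    c₁≈ = begin
      c₁ ≈⟨ solve 5 (λ c₁ c₀ d s₂ s₁ → c₁ := c₀ :- (c₀ :+ (:- :1) :* c₁ :+ d :* ((:- :1) :* (:- :1) :* s₂ :- (:- :1) :* s₁)) :+ d :* (s₂ :+ s₁)) refl c₁ c₀ (t * t * ι ½) s₂ s₁ ⟩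
      c₀ - (c₀ + (- 1#) * c₁ + t * t * ι ½ * ((- 1#) * (- 1#) * s₂ - (- 1#) * s₁)) + t * t * ι ½ * (s₂ + s₁)
        ≈⟨ +-congʳ (+-congˡ (-‿cong (+-cong (+-congˡ (*-congʳ z≈)) (*-congˡ (+-cong (*-congʳ (*-cong z≈ z≈)) (-‿cong (*-congʳ z≈))))))) ⟨
      c₀ - (c₀ + zz (ℤ.- 1ℤ) * c₁ + t * t * ι ½ * (zz (ℤ.- 1ℤ) * zz (ℤ.- 1ℤ) * s₂ - zz (ℤ.- 1ℤ) * s₁)) + t * t * ι ½ * (s₂ + s₁)
        ≈⟨ +-congʳ (+-congˡ (-‿cong (trans (sym (block-expand (ℤ.- 1ℤ))) block-reflect))) ⟩
      c₀ - reflection M * c₀ + t * t * ι ½ * (s₂ + s₁)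
        ≈⟨ +-congʳ (solve 2 (λ c e → c :- e :* c := (:1 :- e) :* c) refl c₀ (reflection M)) ⟩
      (1# - reflection M) * c₀ + t * t * ι ½ * (s₂ + s₁) ∎
      where
      z≈ : zz (ℤ.- 1ℤ) ≈ - 1#
      z≈ = trans (zz-neg 1ℤ) (-‿cong ι-1)

  -- Comparison with q-binomials at q^(m²).

  base² : LaurentAlgebra
  base² = rebase (+ (m ℕ.* m)) A

  module Q² = QBinomial base²

  multiplesSum : Carrier → Carrier → Carrier
  multiplesSum c n = quad n (c * (ι ½ * (n * (n - 1#)))) (ι ½ * (c * c * (ι ⅙ * (n * (n - 1#) * (n + n - 1#))) - c * (ι ½ * (n * (n - 1#)))))

  multiplesSum-cong : ∀ {c c′ n n′} → c ≈ c′ → n ≈ n′ → multiplesSum c n ≈ multiplesSum c′ n′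
  multiplesSum-cong p q = quad-cong q (*-cong p (*-congˡ (*-cong q (+-congʳ q))))
    (*-congˡ (+-cong (*-cong (*-cong p p) (*-congˡ (*-cong (*-cong q (+-congʳ q)) (+-congʳ (+-cong q q))))) (-‿cong (*-cong p (*-congˡ (*-cong q (+-congʳ q)))))))

  qint₁-series : ∀ s → qint₁ (suc s) ≈ multiplesSum 1# (1# + nn s)
  qint₁-series s = trans (Sum.fold-cong (suc s) (λ i → X-congʳ (≡.cong (+ m ℤ.*_) (≡.sym (ℤₚ.*-identityˡ (+ i))))))
    (trans (∑-multiples 1ℤ (suc s)) (multiplesSum-cong ι-1 (nn-suc s)))

  qint²-series : ∀ s → Q².qnum (suc s) ≈ multiplesSum (1# + nn M) (1# + nn s)
  qint²-series s = trans (Sum.fold-cong (suc s) (λ i → X-congʳ (≡.trans (≡.cong (ℤ._* + i) (ℤₚ.pos-* m m)) (ℤₚ.*-assoc (+ m) (+ m) (+ i)))))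
    (trans (∑-multiples (+ m) (suc s)) (multiplesSum-cong (nn-suc M) (nn-suc s)))

  κ : Carrier
  κ = ι 1/24 * ((1# + nn M) * (1# + nn M) - 1#)

  shrink : Carrier → Carrier
  shrink x = 1# - x * (t * t)

  shrink-cong : ∀ {x y} → x ≈ y → shrink x ≈ shrink y
  shrink-cong e = +-congˡ (-‿cong (*-congʳ e))

  shrink-* : ∀ x y → shrink x * shrink y ≈ shrink (x + y)
  shrink-* x y = trans (solve 3 (λ x y t → (:1 :- x :* (t :* t)) :* (:1 :- y :* (t :* t)) := (:1 :- (x :+ y) :* (t :* t)) :+ x :* y :* t :* (t :* (t :* t))) refl x y t) (drop _ _)

  shrink-0 : shrink 0# ≈ 1#
  shrink-0 = solve 1 (λ t → :1 :- :0 :* (t :* t) := :1) refl t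

  shrink-unit : ∀ x → IsUnit (shrink x)
  shrink-unit x = unit-cong (solve 2 (λ t x → :1 :+ t :* (:- (x :* t)) := :1 :- x :* (t :* t)) refl t x) (unit-perturb (- (x * t)) unit-1)

  shrink-pow : ∀ x n → pow (shrink x) n ≈ shrink (nn n * x)
  shrink-pow x zero = sym (trans (shrink-cong (trans (*-congʳ nn-0) (zeroˡ x))) shrink-0)
  shrink-pow x (suc n) = trans (*-congˡ (shrink-pow x n)) (trans (shrink-* _ _)
    (shrink-cong (trans (solve 2 (λ x n → x :+ n :* x := (:1 :+ n) :* x) refl x (nn n)) (*-congʳ (sym (nn-suc n))))))

  -- The linear terms cancel, and the coefficient of t² turns out to be linear in s.
  series-identity : ∀ M s → blockSeries M s * multiplesSum 1# (1# + s) ≈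
    multiplesSum (1# + M) (1# + s) * quad 1# 0# (- (ι 1/24 * ((1# + M) * (1# + M) - 1#) * s))
  series-identity M s = trans (quad-* _ _ _ _ _ _) (trans (quad-cong
      (*-comm _ _)
      (solve 2 (λ M s → let n = :1 :+ s; h = ½ · (n :* (n :- :1)) in
        :1 :* (:1 :* h) :+ s :* (½ · M) :* n := n :* :0 :+ (:1 :+ M) :* h :* :1) refl M s)
      (solve 2 (λ M s → let n = :1 :+ s; h = ½ · (n :* (n :- :1)); c = :1 :+ M
                            f = ⅙ · (n :* (n :- :1) :* (n :+ n :- :1)) in
        :1 :* (½ · (:1 :* :1 :* f :- :1 :* h)) :+ s :* (½ · M) :* (:1 :* h)
          :+ (s :* (⅛ · (M :* M) :- ¼ · (M :* (M :+ :1))) :+ 1/12 · (M :* (M :+ M :+ :1)) :* (s :* s :+ s)) :* n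
        := n :* (:- (1/24 · (c :* c :- :1) :* s)) :+ c :* h :* :0 :+ ½ · (c :* c :* f :- c :* h) :* :1) refl M s))
    (sym (quad-* _ _ _ _ _ _)))

  blockFactor-series : ∀ s → blockFactor s ≈ c₀ * (Q².qnum (suc s) * shrink (κ * nn s))
  blockFactor-series s = begin
      block (+ s) * qint₁ (suc s) ≈⟨ *-cong (block-series (+ s)) (qint₁-series s) ⟩
      c₀ * blockSeries (nn M) (nn s) * multiplesSum 1# (1# + nn s) ≈⟨ *-assoc _ _ _ ⟩
      c₀ * (blockSeries (nn M) (nn s) * multiplesSum 1# (1# + nn s)) ≈⟨ *-congˡ (series-identity (nn M) (nn s)) ⟩
      c₀ * (multiplesSum (1# + nn M) (1# + nn s) * quad 1# 0# (- (κ * nn s)))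
        ≈⟨ *-congˡ (*-cong (sym (qint²-series s)) (solve 2 (λ t k → :1 :+ :0 :* t :+ (:- k) :* (t :* t) := :1 :- k :* (t :* t)) refl t (κ * nn s))) ⟩
      c₀ * (Q².qnum (suc s) * shrink (κ * nn s)) ∎

  -- The constant term of the expansion in t is the positive integer s + 1, invertible because the
  -- coefficients are rational.
  qint²-unit : ∀ s → IsUnit (Q².qnum (suc s))
  qint²-unit s = unit-cong (sym (qint²-series s)) (unit-quad _ _ (unit-cong (nn-suc s) (unit-nn s)))

  fac² : ℕ → Carrier
  fac² = Q².QFactorial.fac

  blockProduct-series : ∀ n → blockProduct n ≈ pow c₀ n * (fac² n * shrink (κ * ∑ nn n))
  blockProduct-series zero = sym (trans (*-identityˡ _) (trans (*-identityˡ _) (trans (shrink-cong (zeroʳ κ)) shrink-0)))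
  blockProduct-series (suc n) = begin
      blockProduct (suc n) ≈⟨ Product.fold-snoc blockFactor n ⟩
      blockProduct n * blockFactor n ≈⟨ *-cong (blockProduct-series n) (blockFactor-series n) ⟩
      pow c₀ n * (fac² n * shrink (κ * ∑ nn n)) * (c₀ * (Q².qnum (suc n) * shrink (κ * nn n)))
        ≈⟨ solve 6 (λ p f w c q v → p :* (f :* w) :* (c :* (q :* v)) := c :* p :* (f :* q :* (w :* v))) refl (pow c₀ n) (fac² n) (shrink (κ * ∑ nn n)) c₀ (Q².qnum (suc n)) (shrink (κ * nn n)) ⟩
      c₀ * pow c₀ n * (fac² n * Q².qnum (suc n) * (shrink (κ * ∑ nn n) * shrink (κ * nn n)))
        ≈⟨ *-congˡ (*-cong (sym (Product.fold-snoc (λ i → Q².qnum (suc i)) n)) (trans (shrink-* _ _) (shrink-cong (trans (sym (distribˡ κ _ _)) (*-congˡ (sym (Sum.fold-snoc nn n))))))) ⟩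
      pow c₀ (suc n) * (fac² (suc n) * shrink (κ * ∑ nn (suc n))) ∎

  -- The triangular number of k + l exceeds those of k and l by k l: this becomes the k(n-k) in the
  -- formula for binom(mn,mk)_q.
  ∑nn-+ : ∀ k l → ∑ nn (k ℕ.+ l) ≈ nn k * nn l + (∑ nn k + ∑ nn l)
  ∑nn-+ k l = trans (∑nn (k ℕ.+ l)) (trans (*-congˡ (*-cong (nn-+ k l) (+-congʳ (nn-+ k l))))
    (trans (solve 2 (λ k l → ½ · ((k :+ l) :* (k :+ l :- :1)) := k :* l :+ (½ · (k :* (k :- :1)) :+ ½ · (l :* (l :- :1)))) refl (nn k) (nn l))
      (+-congˡ (sym (+-cong (∑nn k) (∑nn l))))))

  infix 4 _~_
  -- A stand-in for congruence modulo t, since t² kills multiples of t. It suffices for factors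
  -- accompanied by t² and spares a second quotient ring.
  _~_ : Carrier → Carrier → Set
  x ~ y = t * t * x ≈ t * t * y

  ≈⇒~ : ∀ {x y} → x ≈ y → x ~ y
  ≈⇒~ = *-congˡ

  ~-* : ∀ {x x′ y y′} → x ~ x′ → y ~ y′ → x * y ~ x′ * y′
  ~-* {x} {x′} {y} {y′} p q = begin
      t * t * (x * y) ≈⟨ *-assoc _ _ _ ⟨
      t * t * x * y ≈⟨ *-congʳ p ⟩
      t * t * x′ * y ≈⟨ solve 3 (λ t x y → t :* t :* x :* y := x :* (t :* t :* y)) refl t x′ y ⟩
      x′ * (t * t * y) ≈⟨ *-congˡ q ⟩
      x′ * (t * t * y′) ≈⟨ solve 3 (λ t x y → x :* (t :* t :* y) := t :* t :* (x :* y)) refl t x′ y′ ⟩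
      t * t * (x′ * y′) ∎

  ~-+ : ∀ {x x′ y y′} → x ~ x′ → y ~ y′ → x + y ~ x′ + y′
  ~-+ p q = trans (distribˡ _ _ _) (trans (+-cong p q) (sym (distribˡ _ _ _)))

  ~-pow : ∀ {x y} n → x ~ y → pow x n ~ pow y n
  ~-pow zero p = refl
  ~-pow (suc n) p = ~-* p (~-pow n p)

  X~ : ∀ {a b} k → a ≡ b ℤ.+ + m ℤ.* k → X a ~ X b
  X~ {a} {b} k e = let (y , h) = X-shift k e in
    trans (*-congˡ (sym (*-identityʳ (X a)))) (trans (t²-shift 1# h) (*-congˡ (*-identityʳ (X b))))

  X~1 : ∀ k → X (+ (m ℕ.* m) ℤ.* k) ~ 1#
  X~1 k = trans (X~ (+ m ℤ.* k) (≡.trans (≡.cong (ℤ._* k) (ℤₚ.pos-* m m)) (≡.trans (ℤₚ.*-assoc (+ m) (+ m) k) (≡.sym (ℤₚ.+-identityˡ _))))) (*-congˡ X-0)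

  shrink~ : ∀ x → shrink x ~ 1#
  shrink~ x = trans (solve 2 (λ t x → t :* t :* (:1 :- x :* (t :* t)) := t :* t :* :1 :+ (:- (x :* t)) :* (t :* (t :* t))) refl t x) (drop _ _)

  -- The powers of q^(m²) in Pascal's rule are 1 modulo t, which leaves the recursion of the
  -- ordinary binomial coefficients.
  gauss²~ : ∀ n k → Q².gauss n k ~ nn (n C k)
  gauss²~ n zero = *-congˡ (sym (trans (reflexive (≡.cong nn (≡.trans (nCk≡nC[n∸k] {0} {n} ℕ.z≤n) (nCn≡1 n)))) ι-1))
  gauss²~ zero (suc k) = *-congˡ (sym (trans (reflexive (≡.cong nn (k>n⇒nCk≡0 {n = 0} {k = suc k} (ℕ.s≤s ℕ.z≤n)))) nn-0))
  gauss²~ (suc n) (suc k) = begin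
      t * t * (X (+ (m ℕ.* m) ℤ.* + suc k) * Q².gauss n (suc k) + Q².gauss n k)
        ≈⟨ ~-+ (~-* (X~1 (+ suc k)) (gauss²~ n (suc k))) (gauss²~ n k) ⟩
      t * t * (1# * nn (n C suc k) + nn (n C k))
        ≈⟨ *-congˡ (trans (+-congʳ (*-identityˡ _)) (trans (+-comm _ _) (sym (nn-+ (n C k) (n C suc k))))) ⟩
      t * t * nn (n C k ℕ.+ n C suc k) ≈⟨ *-congˡ (reflexive (≡.cong nn (nCk+nC[k+1]≡[n+1]C[k+1] n k))) ⟩
      t * t * nn (suc n C suc k) ∎

  -- A parameter because its proof cancels 1 - Q = -t, which is nilpotent here; it is supplied by
  -- transport from Laurent polynomials.
  module WithFactorization
    (factorization : ∀ k l → onBlock k l * (blockProduct k * blockProduct l) ≈ blockProduct (k ℕ.+ l)) where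

    -- In the block factorisation the powers of F(0) balance, the factorials at q^(m²) form the
    -- binomial, and the triangular corrections leave κ k l. What is cancelled is a product of
    -- units.
    gauss-multiple : ∀ k l → onBlock k l ≈ Q².gauss (k ℕ.+ l) k * shrink (κ * (nn k * nn l))
    gauss-multiple k l = unit-cancelˡ unit (begin
        U * onBlock k l
          ≈⟨ solve 7 (λ p f w q e v g → p :* (f :* w) :* (q :* (e :* v)) :* g := g :* (p :* (f :* w) :* (q :* (e :* v)))) refl
              (pow c₀ k) (fac² k) wk (pow c₀ l) (fac² l) wl (onBlock k l) ⟩
        onBlock k l * U
          ≈⟨ *-congˡ (*-cong (blockProduct-series k) (blockProduct-series l)) ⟨
        onBlock k l * (blockProduct k * blockProduct l)
          ≈⟨ factorization k l ⟩
        blockProduct (k ℕ.+ l)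
          ≈⟨ blockProduct-series (k ℕ.+ l) ⟩
        pow c₀ (k ℕ.+ l) * (fac² (k ℕ.+ l) * shrink (κ * ∑ nn (k ℕ.+ l)))
          ≈⟨ *-cong (pow-+ c₀ k l) (*-cong (sym (Q².QFactorial.gauss-fac (k ℕ.+ l) k l ≡.refl)) split) ⟩
        pow c₀ k * pow c₀ l * (G * (fac² k * fac² l) * (w * (wk * wl)))
          ≈⟨ solve 8 (λ p q g f e w v u → p :* q :* (g :* (f :* e) :* (w :* (v :* u))) := p :* (f :* v) :* (q :* (e :* u)) :* (g :* w)) refl
              (pow c₀ k) (pow c₀ l) G (fac² k) (fac² l) w wk wl ⟩
        U * (G * w) ∎)
      where
      w = shrink (κ * (nn k * nn l))
      wk = shrink (κ * ∑ nn k)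
      wl = shrink (κ * ∑ nn l)
      G = Q².gauss (k ℕ.+ l) k
      U = pow c₀ k * (fac² k * wk) * (pow c₀ l * (fac² l * wl))
      unit : IsUnit U
      unit = unit-* (unit-* (unit-pow k block-unit) (unit-* (unit-∏ _ k (λ i _ → qint²-unit i)) (shrink-unit _)))
                    (unit-* (unit-pow l block-unit) (unit-* (unit-∏ _ l (λ i _ → qint²-unit i)) (shrink-unit _)))
      split : shrink (κ * ∑ nn (k ℕ.+ l)) ≈ w * (wk * wl)
      split = trans (shrink-cong (trans (*-congˡ (∑nn-+ k l)) (trans (distribˡ κ _ _) (+-congˡ (distribˡ κ _ _)))))
        (sym (trans (*-congˡ (shrink-* _ _)) (shrink-* _ _)))

    gauss-multiple~ : ∀ k l → onBlock k l ~ nn ((k ℕ.+ l) C k)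
    gauss-multiple~ k l = trans (≈⇒~ (gauss-multiple k l)) (trans (~-* (gauss²~ (k ℕ.+ l) k) (shrink~ _)) (*-congˡ (*-identityʳ _)))

    squareTerm : ℕ → Carrier
    squareTerm i = X (+ suc i ℤ.* + suc i) * (offBlock 0 1 i * offBlock 0 1 i)

    -- In q-Vandermonde for binom(2m,m)_q the outer terms q^(m²) and 1 already add up to binom(2,1)
    -- at q^(m²). The inner terms are therefore the defect -κ t² (q^(m²) + 1), where q^(m²) = 1
    -- modulo t.
    squares : ∑ squareTerm M ≈ - ((κ + κ) * (t * t))
    squares = begin
        S ≈⟨ solve 3 (λ s a b → s := a :+ (s :+ b) :- a :- b) refl S (X′) 1# ⟩
        X′ + (S + 1#) - X′ - 1# ≈⟨ +-congʳ (+-congʳ total) ⟨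
        gauss (m ℕ.+ m) m - X′ - 1# ≈⟨ +-congʳ (+-congʳ central) ⟩
        (X′ * (X′ * 0# + 1#) + 1#) * shrink (κ * (1# * 1#)) - X′ - 1#
          ≈⟨ solve 3 (λ x t k → (x :* (x :* :0 :+ :1) :+ :1) :* (:1 :- k :* (:1 :* :1) :* (t :* t)) :- x :- :1
               := :- (k :* (t :* t :* x)) :- k :* (t :* t)) refl X′ t κ ⟩
        - (κ * (t * t * X′)) - κ * (t * t) ≈⟨ +-congʳ (-‿cong (*-congˡ (X~1 1ℤ))) ⟩
        - (κ * (t * t * 1#)) - κ * (t * t)
          ≈⟨ solve 2 (λ t k → :- (k :* (t :* t :* :1)) :- k :* (t :* t) := :- ((k :+ k) :* (t :* t))) refl t κ ⟩
        - ((κ + κ) * (t * t)) ∎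
      where
      X′ = X (+ (m ℕ.* m) ℤ.* 1ℤ)
      S = ∑ squareTerm M
      central : gauss (m ℕ.+ m) m ≈ (X′ * (X′ * 0# + 1#) + 1#) * shrink (κ * (1# * 1#))
      central = trans (reflexive (≡.cong₂ gauss (≡.cong (m ℕ.+_) (≡.sym (ℕₚ.+-identityʳ m))) (≡.sym (ℕₚ.+-identityʳ m))))
        (trans (gauss-multiple 1 1) (*-congˡ (shrink-cong (*-congˡ (*-cong ι-1 ι-1)))))
      total : gauss (m ℕ.+ m) m ≈ X′ + (S + 1#)
      total = begin
        gauss (m ℕ.+ m) m ≈⟨ vandermonde m m m ⟩
        vandermondeTerm m m m 0 + ∑ (λ i → vandermondeTerm m m m (suc i)) m
          ≈⟨ +-congˡ (Sum.fold-snoc (λ i → vandermondeTerm m m m (suc i)) M) ⟩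
        vandermondeTerm m m m 0 + (∑ (λ i → vandermondeTerm m m m (suc i)) M + vandermondeTerm m m m m)
          ≈⟨ +-cong first (+-cong (Sum.fold-cong< M middle) last) ⟩
        X′ + (S + 1#) ∎
        where
        first : vandermondeTerm m m m 0 ≈ X′
        first = trans (*-cong (X-congʳ (≡.trans (≡.cong (ℤ._* + m) (ℤₚ.+-identityʳ (+ m))) (≡.trans (≡.sym (ℤₚ.pos-* m m)) (≡.sym (ℤₚ.*-identityʳ _)))))
                 (trans (*-identityˡ _) (gauss-diag m))) (*-identityʳ _)
        last : vandermondeTerm m m m m ≈ 1#
        last = trans (*-cong (trans (X-congʳ (≡.cong (ℤ._* + (m ℕ.∸ m)) (ℤₚ.+-inverseʳ (+ m)))) X-0)
                 (*-cong (gauss-diag m) (reflexive (≡.cong (gauss m) (ℕₚ.n∸n≡0 m))))) (trans (*-identityˡ _) (*-identityˡ _))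
        middle : ∀ i → i ℕ.< M → vandermondeTerm m m m (suc i) ≈ squareTerm i
        middle i i<M = let (e , h) = t∣offBlock 0 1 i i<M; (y , hx) = X-shift shift-by exponent in begin
          X ((+ m ℤ.- + suc i) ℤ.* + (m ℕ.∸ suc i)) * (gauss m (suc i) * gauss m (m ℕ.∸ suc i))
            ≈⟨ *-congˡ (*-cong G≈ (trans (gauss-sym m (m ℕ.∸ suc i) (suc i) (ℕₚ.m∸n+n≡m i≤m)) G≈)) ⟩
          X ((+ m ℤ.- + suc i) ℤ.* + (m ℕ.∸ suc i)) * (E * E) ≈⟨ *-congˡ (*-cong h h) ⟩
          X ((+ m ℤ.- + suc i) ℤ.* + (m ℕ.∸ suc i)) * (t * e * (t * e))
            ≈⟨ solve 3 (λ x t e → x :* (t :* e :* (t :* e)) := t :* t :* (x :* (e :* e))) refl _ t e ⟩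
          t * t * (X ((+ m ℤ.- + suc i) ℤ.* + (m ℕ.∸ suc i)) * (e * e)) ≈⟨ t²-shift (e * e) hx ⟩
          t * t * (X (+ suc i ℤ.* + suc i) * (e * e))
            ≈⟨ solve 3 (λ x t e → t :* t :* (x :* (e :* e)) := x :* (t :* e :* (t :* e))) refl _ t e ⟩
          X (+ suc i ℤ.* + suc i) * (t * e * (t * e)) ≈⟨ *-congˡ (*-cong h h) ⟨
          X (+ suc i ℤ.* + suc i) * (E * E) ∎
          where
          i≤m : suc i ℕ.≤ m
          i≤m = ℕₚ.m≤n⇒m≤1+n i<M
          E = offBlock 0 1 i
          G≈ : gauss m (suc i) ≈ E
          G≈ = reflexive (≡.cong (λ n → gauss n (suc i)) (≡.sym (ℕₚ.+-identityʳ m)))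
          d = m ℕ.∸ suc i
          -- With d = m - r: d² - r² = (d - r)(d + r) = (d - r) m, so the Vandermonde exponent
          -- (m-r)² is r² modulo m.
          shift-by = + d ℤ.- + suc i
          exponent : (+ m ℤ.- + suc i) ℤ.* + d ≡ + suc i ℤ.* + suc i ℤ.+ + m ℤ.* shift-by
          exponent = ≡.trans (≡.cong (λ m → (+ m ℤ.- + suc i) ℤ.* + d) (≡.sym (ℕₚ.m∸n+n≡m i≤m)))
            (≡.trans (ℤS.solve 2 (λ d i → (d :+ᶻ i :-ᶻ i) :*ᶻ d :=ᶻ i :*ᶻ i :+ᶻ (d :+ᶻ i) :*ᶻ (d :-ᶻ i)) ≡.refl (+ d) (+ suc i))
              (≡.cong (λ m → + suc i ℤ.* + suc i ℤ.+ + m ℤ.* shift-by) (ℕₚ.m∸n+n≡m i≤m)))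

  -- Summation over k and comparison with the constants c_{n,k}.

  nn-pow : ∀ a k → nn (a ℕ.^ k) ≈ pow (nn a) k
  nn-pow a zero = ι-1
  nn-pow a (suc k) = trans (nn-* a (a ℕ.^ k)) (*-congˡ (nn-pow a k))

  ι-/ : ∀ i d .{{_ : ℕ.NonZero d}} → ι (i ℚ./ d) ≈ zz i * ι (1ℤ ℚ./ d)
  ι-/ i d = trans (reflexive (≡.cong ι (/-as-* i d))) (ι-* _ _)

  ι-foldr : ∀ (f : ℕ → ℚ) (g : ℕ → ℕ) n → ι (foldr ℚ._+_ 0ℚ (map f (applyUpTo g n))) ≈ ∑ (λ i → ι (f (g i))) n
  ι-foldr f g zero = ι-0
  ι-foldr f g (suc n) = trans (ι-+ _ _) (+-congˡ (ι-foldr f (λ i → g (suc i)) n))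

  nn-minus : ∀ j l {n} → j ℕ.+ l ≡ n → nn l ≈ nn n - nn j
  nn-minus j l ≡.refl = trans (solve 2 (λ j l → l := j :+ l :- j) refl (nn j) (nn l)) (+-congʳ (sym (nn-+ j l)))

  t³-vanish : ∀ {x e} y → x ≈ t * e → x * (x * (x * y)) ≈ 0#
  t³-vanish {x} {e} y h = trans (*-cong h (*-cong h (*-congʳ h)))
    (trans (solve 3 (λ t e y → t :* e :* (t :* e :* (t :* e :* y)) := :0 :+ e :* e :* e :* y :* (t :* (t :* t))) refl t e y) (drop 0# (e * e * e * y)))

  -- α enters through two facts: at k = jm homogeneity makes the exponent m² times the one at (n,
  -- j), and at other k the exponent is r² modulo m, where r is the residue of k.
  module Summation
    (factorization : ∀ k l → onBlock k l * (blockProduct k * blockProduct l) ≈ blockProduct (k ℕ.+ l))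
    (μ n : ℕ) (α α′ : ℕ → ℤ)
    (α-multiple : ∀ j → α (j ℕ.* m) ≡ + (m ℕ.* m) ℤ.* α′ j)
    (α-residue : ∀ j i → ∃ λ z → α (suc (j ℕ.* m ℕ.+ i)) ≡ + suc i ℤ.* + suc i ℤ.+ + m ℤ.* z)
    where

    open WithFactorization factorization

    summand summand² weight : ℕ → ℕ → Carrier
    summand λ′ k = X (α k) * (pow (gauss (n ℕ.* m) k) λ′ * pow (gauss (n ℕ.* m ℕ.+ k) k) μ)
    summand² λ′ j = X (+ (m ℕ.* m) ℤ.* α′ j) * (pow (Q².gauss n j) λ′ * pow (Q².gauss (n ℕ.+ j) j) μ)
    weight λ′ j = nn ((n C j) ℕ.^ λ′ ℕ.* ((n ℕ.+ j) C j) ℕ.^ μ)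

    weight-pow : ∀ λ′ j → weight λ′ j ≈ pow (nn (n C j)) λ′ * pow (nn ((n ℕ.+ j) C j)) μ
    weight-pow λ′ j = trans (nn-* ((n C j) ℕ.^ λ′) _) (*-cong (nn-pow _ λ′) (nn-pow _ μ))

    upper-multiple : ∀ j → gauss (n ℕ.* m ℕ.+ j ℕ.* m) (j ℕ.* m) ≈ Q².gauss (n ℕ.+ j) j * shrink (κ * (nn j * nn n))
    upper-multiple j = trans (reflexive (≡.cong (λ N → gauss N (j ℕ.* m))
        (≡.trans (≡.sym (ℕₚ.*-distribʳ-+ m n j)) (≡.cong (ℕ._* m) (ℕₚ.+-comm n j)))))
      (trans (gauss-multiple j n) (*-congʳ (reflexive (≡.cong (λ N → Q².gauss N j) (ℕₚ.+-comm j n)))))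

    -- Each factor binom(mn,mj)_q contributes κ j(n-j) to the correction, each binom(mn+mj,mj)_q
    -- contributes κ j n. Next to t² the summand may be taken at q = 1, where it is `weight`.
    multiple-summand : ∀ λ′ j l → j ℕ.+ l ≡ n →
      summand λ′ (j ℕ.* m) ≈ summand² λ′ j - t * t * (κ * (nn λ′ * (nn j * (nn n - nn j)) + nn μ * (nn j * nn n)) * weight λ′ j)
    multiple-summand λ′ j l e = begin
        X (α (j ℕ.* m)) * (pow (gauss (n ℕ.* m) (j ℕ.* m)) λ′ * pow (gauss (n ℕ.* m ℕ.+ j ℕ.* m) (j ℕ.* m)) μ)
          ≈⟨ *-cong (X-congʳ (α-multiple j)) (*-cong
               (trans (pow-cong λ′ (lower e)) (trans (pow-* G _ λ′) (*-congˡ (shrink-pow _ λ′))))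
               (trans (pow-cong μ (upper-multiple j)) (trans (pow-* G′ _ μ) (*-congˡ (shrink-pow _ μ))))) ⟩
        x * (pow G λ′ * shrink a * (pow G′ μ * shrink b))
          ≈⟨ solve 5 (λ x g v h w → x :* (g :* v :* (h :* w)) := x :* (g :* h) :* (v :* w)) refl x (pow G λ′) (shrink a) (pow G′ μ) (shrink b) ⟩
        summand² λ′ j * (shrink a * shrink b)
          ≈⟨ *-congˡ (trans (shrink-* a b) (shrink-cong ab)) ⟩
        summand² λ′ j * shrink c
          ≈⟨ solve 3 (λ s c t → s :* (:1 :- c :* (t :* t)) := s :- c :* (t :* t :* s)) refl (summand² λ′ j) c t ⟩
        summand² λ′ j - c * (t * t * summand² λ′ j)
          ≈⟨ +-congˡ (-‿cong (*-congˡ summand²~)) ⟩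
        summand² λ′ j - c * (t * t * weight λ′ j)
          ≈⟨ +-congˡ (-‿cong (solve 3 (λ c t w → c :* (t :* t :* w) := t :* t :* (c :* w)) refl c t (weight λ′ j))) ⟩
        summand² λ′ j - t * t * (c * weight λ′ j) ∎
      where
      x = X (+ (m ℕ.* m) ℤ.* α′ j)
      G = Q².gauss n j
      G′ = Q².gauss (n ℕ.+ j) j
      a = nn λ′ * (κ * (nn j * nn l))
      b = nn μ * (κ * (nn j * nn n))
      c = κ * (nn λ′ * (nn j * (nn n - nn j)) + nn μ * (nn j * nn n))
      lower : ∀ {N} → j ℕ.+ l ≡ N → gauss (N ℕ.* m) (j ℕ.* m) ≈ Q².gauss N j * shrink (κ * (nn j * nn l))
      lower ≡.refl = gauss-multiple j l
      ab : a + b ≈ c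
      ab = trans (+-congʳ (*-congˡ (*-congˡ (*-congˡ (nn-minus j l e)))))
        (solve 5 (λ k L j n u → L :* (k :* (j :* (n :- j))) :+ u :* (k :* (j :* n)) := k :* (L :* (j :* (n :- j)) :+ u :* (j :* n))) refl κ (nn λ′) (nn j) (nn n) (nn μ))
      summand²~ : summand² λ′ j ~ weight λ′ j
      summand²~ = trans (~-* (X~1 (α′ j)) (~-* (~-pow λ′ (gauss²~ n j)) (~-pow μ (gauss²~ (n ℕ.+ j) j))))
        (*-congˡ (trans (*-identityˡ _) (sym (weight-pow λ′ j))))

    off-summand-3 : ∀ λ′ j l → j ℕ.+ l ≡ n → ∀ i → i ℕ.< M → summand (3 ℕ.+ λ′) (suc (j ℕ.* m ℕ.+ i)) ≈ 0#
    off-summand-3 λ′ j l e i i<M =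
      let (d , h) = t∣ e in trans (*-congˡ (trans (*-congʳ (t³-vanish {e = d} (pow E λ′) h)) (zeroˡ _))) (zeroʳ _)
      where
      E = gauss (n ℕ.* m) (suc (j ℕ.* m ℕ.+ i))
      t∣ : ∀ {N} → j ℕ.+ l ≡ N → ∃ λ d → gauss (N ℕ.* m) (suc (j ℕ.* m ℕ.+ i)) ≈ t * d
      t∣ ≡.refl = t∣offBlock j l i i<M

    -- The square of binom(mn,k)_q already carries t², so the power of q and binom(mn+k,k)_q^μ
    -- matter only modulo t, where they are q^(r²) and binom(n+j,j)^μ with r = i + 1.
    off-summand-2 : ∀ j l → j ℕ.+ l ≡ n → ∀ i → i ℕ.< M → summand 2 (suc (j ℕ.* m ℕ.+ i)) ≈
      (nn n - nn j) * (nn n - nn j) * weight 2 j * squareTerm i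
    off-summand-2 j l e i i<M =
      let (d , h) = t∣offBlock 0 1 i i<M; (z , hz) = α-residue j i in begin
        X (α k) * (E * (E * 1#) * pow H μ)
          ≈⟨ solve 3 (λ x E h → x :* (E :* (E :* :1) :* h) := E :* E :* (x :* h)) refl (X (α k)) E (pow H μ) ⟩
        E * E * (X (α k) * pow H μ) ≈⟨ *-congʳ (square e) ⟩
        nn l * c * (nn l * c) * (E₀ * E₀) * (X (α k) * pow H μ) ≈⟨ *-congʳ (*-congˡ (*-cong h h)) ⟩
        nn l * c * (nn l * c) * (t * d * (t * d)) * (X (α k) * pow H μ)
          ≈⟨ solve 4 (λ L t d y → L :* (t :* d :* (t :* d)) :* y := L :* (d :* d) :* (t :* t :* y)) refl (nn l * c * (nn l * c)) t d (X (α k) * pow H μ) ⟩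
        nn l * c * (nn l * c) * (d * d) * (t * t * (X (α k) * pow H μ))
          ≈⟨ *-congˡ (~-* (X~ z hz) (~-pow μ H~)) ⟩
        nn l * c * (nn l * c) * (d * d) * (t * t * (X (+ suc i ℤ.* + suc i) * pow c′ μ))
          ≈⟨ solve 6 (λ l c t d x h → l :* c :* (l :* c) :* (d :* d) :* (t :* t :* (x :* h)) := l :* l :* (c :* (c :* :1) :* h) :* (x :* (t :* d :* (t :* d)))) refl
               (nn l) c t d (X (+ suc i ℤ.* + suc i)) (pow c′ μ) ⟩
        nn l * nn l * (c * (c * 1#) * pow c′ μ) * (X (+ suc i ℤ.* + suc i) * (t * d * (t * d)))
          ≈⟨ *-cong (*-cong (*-cong (nn-minus j l e) (nn-minus j l e)) (sym (weight-pow 2 j))) (*-congˡ (sym (*-cong h h))) ⟩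
        (nn n - nn j) * (nn n - nn j) * weight 2 j * (X (+ suc i ℤ.* + suc i) * (E₀ * E₀)) ∎
      where
      k = suc (j ℕ.* m ℕ.+ i)
      E = gauss (n ℕ.* m) k
      E₀ = offBlock 0 1 i
      H = gauss (n ℕ.* m ℕ.+ k) k
      c = nn (n C j)
      c′ = nn ((n ℕ.+ j) C j)
      square : ∀ {N} → j ℕ.+ l ≡ N → gauss (N ℕ.* m) k * gauss (N ℕ.* m) k ≈ nn l * nn (N C j) * (nn l * nn (N C j)) * (E₀ * E₀)
      square ≡.refl = offBlock-square j l (nn ((j ℕ.+ l) C j)) (gauss-multiple~ j l) i i<M
      H~ : H ~ c′
      H~ = ≡.subst (λ k → gauss (n ℕ.* m ℕ.+ k) k ~ c′) (ℕₚ.+-suc (j ℕ.* m) i)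
        (gauss-rises n j c′ (≡.subst (λ N → gauss (N ℕ.* m) (j ℕ.* m) ~ nn (N C j)) (ℕₚ.+-comm j n) (gauss-multiple~ j n)) (suc i) i<M)

    split-blocks : ∀ λ′ → ∑ (summand λ′) (suc (n ℕ.* m)) ≈
      ∑ (λ j → summand λ′ (j ℕ.* m)) (suc n) + ∑ (λ j → ∑ (λ i → summand λ′ (suc (j ℕ.* m ℕ.+ i))) M) n
    split-blocks λ′ = begin
        ∑ f (suc (n ℕ.* m)) ≈⟨ Sum.fold-snoc f (n ℕ.* m) ⟩
        ∑ f (n ℕ.* m) + f (n ℕ.* m) ≈⟨ +-congʳ (Sum.fold-blocks f n m) ⟩
        ∑ (λ j → ∑ (λ r → f (j ℕ.* m ℕ.+ r)) m) n + f (n ℕ.* m)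
          ≈⟨ +-congʳ (Sum.fold-cong n (λ j → +-cong (reflexive (≡.cong f (ℕₚ.+-identityʳ _))) (Sum.fold-cong M (λ i → reflexive (≡.cong f (ℕₚ.+-suc _ i)))))) ⟩
        ∑ (λ j → f (j ℕ.* m) + off j) n + f (n ℕ.* m) ≈⟨ +-congʳ (Sum.fold-∙ (λ j → f (j ℕ.* m)) off n) ⟩
        ∑ (λ j → f (j ℕ.* m)) n + ∑ off n + f (n ℕ.* m)
          ≈⟨ solve 3 (λ a b c → a :+ b :+ c := a :+ c :+ b) refl (∑ (λ j → f (j ℕ.* m)) n) (∑ off n) (f (n ℕ.* m)) ⟩
        ∑ (λ j → f (j ℕ.* m)) n + f (n ℕ.* m) + ∑ off n ≈⟨ +-congʳ (Sum.fold-snoc (λ j → f (j ℕ.* m)) n) ⟨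
        ∑ (λ j → f (j ℕ.* m)) (suc n) + ∑ off n ∎
      where
      f = summand λ′
      off : ℕ → Carrier
      off j = ∑ (λ i → f (suc (j ℕ.* m ℕ.+ i))) M

    -- `S j` stands for the contribution of the indices strictly between jm and (j+1)m. Together
    -- with the correction at k = jm it has to produce -2κ t² c_{n,j} times the weight, where 2κ =
    -- (m²-1)/12; `hC` is this identity for each j.
    combine : ∀ λ′ (S : ℕ → Carrier) → ∑ (λ j → ∑ (λ i → summand λ′ (suc (j ℕ.* m ℕ.+ i))) M) n ≈ ∑ S (suc n) →
      (∀ j → S j - t * t * (κ * (nn λ′ * (nn j * (nn n - nn j)) + nn μ * (nn j * nn n)) * weight λ′ j)
             ≈ - ((κ + κ) * (t * t)) * (ι (cc λ′ μ n j) * weight λ′ j)) →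
      ∑ (summand λ′) (suc (n ℕ.* m)) ≈ ∑ (summand² λ′) (suc n) - ι (((+ (m ℕ.* m)) ℤ.- (+ 1)) ℚ./ 12 ℚ.* R λ′ μ n) * (t * t)
    combine λ′ S hS hC = begin
        ∑ (summand λ′) (suc (n ℕ.* m)) ≈⟨ trans (split-blocks λ′) (+-congˡ hS) ⟩
        ∑ (λ j → summand λ′ (j ℕ.* m)) (suc n) + ∑ S (suc n) ≈⟨ Sum.fold-∙ (λ j → summand λ′ (j ℕ.* m)) S (suc n) ⟨
        ∑ (λ j → summand λ′ (j ℕ.* m) + S j) (suc n)
          ≈⟨ Sum.fold-cong< (suc n) (λ j j≤n → trans (+-congʳ (multiple-summand λ′ j (n ℕ.∸ j) (ℕₚ.m+[n∸m]≡n (ℕₚ.≤-pred j≤n))))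
               (trans (solve 3 (λ a b s → a :- b :+ s := a :+ (s :- b)) refl _ _ (S j)) (+-congˡ (hC j)))) ⟩
        ∑ (λ j → summand² λ′ j + - ((κ + κ) * (t * t)) * (ι (cc λ′ μ n j) * weight λ′ j)) (suc n)
          ≈⟨ trans (Sum.fold-∙ (summand² λ′) (λ j → - ((κ + κ) * (t * t)) * (ι (cc λ′ μ n j) * weight λ′ j)) (suc n))
               (+-congˡ (sym (∑-*ˡ _ (λ j → ι (cc λ′ μ n j) * weight λ′ j) (suc n)))) ⟩
        ∑ (summand² λ′) (suc n) + - ((κ + κ) * (t * t)) * ∑ (λ j → ι (cc λ′ μ n j) * weight λ′ j) (suc n)
          ≈⟨ +-congˡ (*-congˡ (sym ιR)) ⟩
        ∑ (summand² λ′) (suc n) + - ((κ + κ) * (t * t)) * ι (R λ′ μ n)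
          ≈⟨ +-congˡ (trans (solve 3 (λ k t r → (:- (k :* (t :* t))) :* r := :- (k :* r :* (t :* t))) refl (κ + κ) t (ι (R λ′ μ n)))
               (-‿cong (*-congʳ (trans (*-congʳ (sym constant)) (sym (ι-* _ _)))))) ⟩
        ∑ (summand² λ′) (suc n) - ι (((+ (m ℕ.* m)) ℤ.- (+ 1)) ℚ./ 12 ℚ.* R λ′ μ n) * (t * t) ∎
      where
      ιR : ι (R λ′ μ n) ≈ ∑ (λ j → ι (cc λ′ μ n j) * weight λ′ j) (suc n)
      ιR = trans (ι-foldr (λ k → cc λ′ μ n k ℚ.* fromℤ (+ ((n C k) ℕ.^ λ′ ℕ.* ((n ℕ.+ k) C k) ℕ.^ μ))) (λ i → i) (suc n)) (Sum.fold-cong (suc n) (λ j → ι-* (cc λ′ μ n j) (fromℤ (+ ((n C j) ℕ.^ λ′ ℕ.* ((n ℕ.+ j) C j) ℕ.^ μ)))))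
      constant : ι (((+ (m ℕ.* m)) ℤ.- (+ 1)) ℚ./ 12) ≈ κ + κ
      constant = begin
        ι (((+ (m ℕ.* m)) ℤ.- (+ 1)) ℚ./ 12) ≈⟨ ι-/ ((+ (m ℕ.* m)) ℤ.- (+ 1)) 12 ⟩
        zz ((+ (m ℕ.* m)) ℤ.- (+ 1)) * ι 1/12
          ≈⟨ *-congʳ (trans (zz-+ (+ (m ℕ.* m)) (ℤ.- + 1)) (+-cong (trans (nn-* m m) (*-cong (nn-suc M) (nn-suc M))) (trans (zz-neg (+ 1)) (-‿cong ι-1)))) ⟩
        ((1# + nn M) * (1# + nn M) - 1#) * ι 1/12
          ≈⟨ solve 1 (λ M → ((:1 :+ M) :* (:1 :+ M) :- :1) :* con 1/12 := let k = 1/24 · ((:1 :+ M) :* (:1 :+ M) :- :1) in k :+ k) refl (nn M) ⟩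
        κ + κ ∎

    cc-2 : ∀ j → ι (cc 2 μ n j) ≈ nn n * nn n + (nn μ - ι (+ 2 ℚ./ 1)) * (nn n * nn j) * ι ½
    cc-2 j = trans (ι-+ _ _) (+-cong (nn-* n n) (trans (ι-/ ((+ μ ℤ.- + 2) ℤ.* + (n ℕ.* j)) 2) (*-congʳ
      (trans (zz-* (+ μ ℤ.- + 2) (+ (n ℕ.* j))) (*-cong (trans (zz-+ (+ μ) (ℤ.- + 2)) (+-congˡ (zz-neg (+ 2)))) (nn-* n j))))))

    cc-3 : ∀ λ′ j → ι (cc (3 ℕ.+ λ′) μ n j) ≈ ((nn (3 ℕ.+ λ′) + nn μ) * nn n - nn (3 ℕ.+ λ′) * nn j) * nn j * ι ½
    cc-3 λ′ j = trans (ι-/ ((+ ((L ℕ.+ μ) ℕ.* n) ℤ.- + (L ℕ.* j)) ℤ.* + j) 2) (*-congʳ (trans (zz-* (+ ((L ℕ.+ μ) ℕ.* n) ℤ.- + (L ℕ.* j)) (+ j))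
      (*-congʳ (trans (zz-+ (+ ((L ℕ.+ μ) ℕ.* n)) (ℤ.- + (L ℕ.* j))) (+-cong (trans (nn-* (L ℕ.+ μ) n) (*-congʳ (nn-+ L μ))) (trans (zz-neg (+ (L ℕ.* j))) (-‿cong (nn-* L j))))))))
      where L = 3 ℕ.+ λ′

    congruence : ∀ λ′ → 2 ℕ.≤ λ′ →
      ∑ (summand λ′) (suc (n ℕ.* m)) ≈ ∑ (summand² λ′) (suc n) - ι (((+ (m ℕ.* m)) ℤ.- (+ 1)) ℚ./ 12 ℚ.* R λ′ μ n) * (t * t)
    congruence 2 (ℕ.s≤s (ℕ.s≤s ℕ.z≤n)) = combine 2 S
        (trans (Sum.fold-cong< n off) (sym (trans (Sum.fold-snoc S n) (trans (+-congˡ S-last) (+-identityʳ _)))))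
        (λ j →
          -- The identity is (n-j)² + j(n-j) + μ j n/2 = n² + (μ-2) n j/2; the square comes from the
          -- indices between multiples of m.
          trans (solve 6 (λ n j w k t u → (n :- j) :* (n :- j) :* w :* (:- ((k :+ k) :* (t :* t))) :- t :* t :* (k :* (con (+ 2 ℚ./ 1) :* (j :* (n :- j)) :+ u :* (j :* n)) :* w)
              := (:- ((k :+ k) :* (t :* t))) :* ((n :* n :+ (u :- con (+ 2 ℚ./ 1)) :* (n :* j) :* con ½) :* w)) refl (nn n) (nn j) (weight 2 j) κ t (nn μ))
            (*-congˡ (*-congʳ (sym (cc-2 j)))))
      where
      S : ℕ → Carrier
      S j = (nn n - nn j) * (nn n - nn j) * weight 2 j * - ((κ + κ) * (t * t))
      S-last : S n ≈ 0#
      S-last = solve 3 (λ n w k → (n :- n) :* (n :- n) :* w :* k := :0) refl (nn n) (weight 2 n) (- ((κ + κ) * (t * t)))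
      off : ∀ j → j ℕ.< n → ∑ (λ i → summand 2 (suc (j ℕ.* m ℕ.+ i))) M ≈ S j
      off j j<n = trans (Sum.fold-cong< M (off-summand-2 j (n ℕ.∸ j) (ℕₚ.m+[n∸m]≡n (ℕₚ.<⇒≤ j<n))))
        (trans (sym (∑-*ˡ ((nn n - nn j) * (nn n - nn j) * weight 2 j) squareTerm M)) (*-congˡ squares))
    congruence (suc (suc (suc λ′))) _ = combine (3 ℕ.+ λ′) (λ _ → 0#)
        (trans (Sum.fold-ε n (λ j j<n → Sum.fold-ε M (off-summand-3 λ′ j (n ℕ.∸ j) (ℕₚ.m+[n∸m]≡n (ℕₚ.<⇒≤ j<n))))) (sym (Sum.fold-ε (suc n) (λ _ _ → refl))))
        -- Only corrections at multiples of m remain: (λ j(n-j) + μ j n)/2 = ((λ+μ) n - λ j) j/2.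
        (λ j → trans (solve 7 (λ L n j w k t u → :0 :- t :* t :* (k :* (L :* (j :* (n :- j)) :+ u :* (j :* n)) :* w)
              := (:- ((k :+ k) :* (t :* t))) :* (((L :+ u) :* n :- L :* j) :* j :* con ½ :* w)) refl (nn (3 ℕ.+ λ′)) (nn n) (nn j) (weight (3 ℕ.+ λ′) j) κ t (nn μ))
            (*-congˡ (*-congʳ (sym (cc-3 λ′ j)))))

-- Long division by monic polynomials

data Monic : ℕ → ZPoly → Set where
  monic-1 : Monic 0 (+ 1 ∷ [])
  monic-∷ : ∀ {n p} a → Monic n p → Monic (suc n) (a ∷ p)

-- Guards against division that is exact in ℚ[q^±] but not in ℚ[q]: q divides 1 among Laurent
-- polynomials, yet long division of 1 by q returns the empty list.
HeadUnit : ZPoly → Set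
HeadUnit [] = ⊥
HeadUnit (a ∷ _) = ∃ λ r → fromℤ a ℚ.* r ≡ 1ℚ

monic-length : ∀ {n p} → Monic n p → length p ≡ suc n
monic-length monic-1 = ≡.refl
monic-length (monic-∷ a h) = ≡.cong suc (monic-length h)

zadd-[] : ∀ p → zadd p [] ≡ p
zadd-[] [] = ≡.refl
zadd-[] (_ ∷ _) = ≡.refl

monic-zadd : ∀ {n s} r → Monic n s → length r ℕ.≤ n → Monic n (zadd r s)
monic-zadd [] h l = h
monic-zadd (x ∷ r) (monic-∷ a h) (ℕ.s≤s l) = monic-∷ (x ℤ.+ a) (monic-zadd r h l)

zscale-1 : ∀ p → zscale (+ 1) p ≡ p
zscale-1 [] = ≡.refl
zscale-1 (a ∷ p) = ≡.cong₂ _∷_ (ℤₚ.*-identityˡ a) (zscale-1 p)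

monic-zmul : ∀ {a b p q} → Monic a p → Monic b q → Monic (a ℕ.+ b) (zmul p q)
monic-zmul {b = b} {q = q} monic-1 hq = ≡.subst (λ q′ → Monic b (zadd q′ (+ 0 ∷ []))) (≡.sym (zscale-1 q)) (add-0 hq)
  where
  add-0 : ∀ {n q} → Monic n q → Monic n (zadd q (+ 0 ∷ []))
  add-0 monic-1 = monic-1
  add-0 (monic-∷ {n} {p} a h) = monic-∷ (a ℤ.+ + 0) (≡.subst (Monic n) (≡.sym (zadd-[] p)) h)
monic-zmul {suc a} {b} {q = q} (monic-∷ x hp) hq = monic-zadd (zscale x q) (monic-∷ (+ 0) (monic-zmul hp hq))
  (ℕₚ.≤-trans (ℕₚ.≤-reflexive (≡.trans (Listₚ.length-map _ q) (monic-length hq))) (ℕ.s≤s (ℕₚ.m≤n+m b a)))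

monic-snoc : ∀ xs → Monic (length xs) (xs ++ + 1 ∷ [])
monic-snoc [] = monic-1
monic-snoc (x ∷ xs) = monic-∷ x (monic-snoc xs)

monic-reverse : ∀ {n p} → Monic n p → ∃ λ bt → reverse p ≡ + 1 ∷ bt
monic-reverse monic-1 = [] , ≡.refl
monic-reverse (monic-∷ {p = p} a h) = let (bt , e) = monic-reverse h in
  bt ++ a ∷ [] , ≡.trans (Listₚ.unfold-reverse a p) (≡.cong (_++ a ∷ []) e)

reverse-monic : ∀ xs → Monic (length (reverse xs)) (reverse (+ 1 ∷ xs))
reverse-monic xs = ≡.subst (Monic (length (reverse xs))) (≡.sym (Listₚ.unfold-reverse (+ 1) xs)) (monic-snoc (reverse xs))

headUnit-zmul : ∀ p q → HeadUnit p → HeadUnit q → HeadUnit (zmul p q)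
headUnit-zmul (a ∷ p) (b ∷ q) (r , hr) (s , hs) = r ℚ.* s , (begin
    fromℤ (a ℤ.* b ℤ.+ + 0) ℚ.* (r ℚ.* s) ≡⟨ ≡.cong (λ i → fromℤ i ℚ.* (r ℚ.* s)) (ℤₚ.+-identityʳ (a ℤ.* b)) ⟩
    fromℤ (a ℤ.* b) ℚ.* (r ℚ.* s) ≡⟨ ≡.cong (ℚ._* (r ℚ.* s)) (fromℤ-* a b) ⟩
    fromℤ a ℚ.* fromℤ b ℚ.* (r ℚ.* s) ≡⟨ ℚS.solve 4 (λ a b r s → a ℚS.:* b ℚS.:* (r ℚS.:* s) ℚS.:= a ℚS.:* r ℚS.:* (b ℚS.:* s)) ≡.refl (fromℤ a) (fromℤ b) r s ⟩
    fromℤ a ℚ.* r ℚ.* (fromℤ b ℚ.* s) ≡⟨ ≡.cong₂ ℚ._*_ hr hs ⟩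
    1ℚ ∎)
  where open ≡.≡-Reasoning

Good : ZPoly → Set
Good p = (∃ λ n → Monic n p) × HeadUnit p

good-one : Good zone
good-one = (0 , monic-1) , (1ℚ , ≡.refl)

good-zmul : ∀ {p q} → Good p → Good q → Good (zmul p q)
good-zmul {p} {q} ((_ , hp) , up) ((_ , hq) , uq) = (_ , monic-zmul hp hq) , headUnit-zmul p q up uq

good-qint : ∀ n → Good (qint (suc n))
good-qint n = (n , monic n) , (1ℚ , ≡.refl)
  where
  monic : ∀ n → Monic n (qint (suc n))
  monic zero = monic-1
  monic (suc n) = monic-∷ (+ 1) (monic n)

good-qfact : ∀ n → Good (qfact n)
good-qfact zero = good-one
good-qfact (suc n) = good-zmul (good-qint n) (good-qfact n)

monic-qpowMinusOne : ∀ n → Monic (suc n) (qpowMinusOne (suc n))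
monic-qpowMinusOne n = monic-∷ ℤ.-[1+ 0 ] (≡.subst (λ k → Monic k (replicate n (+ 0) ++ + 1 ∷ [])) (Listₚ.length-replicate n) (monic-snoc (replicate n (+ 0))))

zdivMonic-unfold : ∀ a b {bt} → reverse b ≡ + 1 ∷ bt → zdivMonic a b ≡ reverse (divHF (length a) (reverse a) bt)
zdivMonic-unfold a b e with reverse b | e
... | _ | ≡.refl = ≡.refl

-- The first coefficient emitted is the leading coefficient 1 of the dividend, so the quotient is
-- monic as soon as it is nonempty. For `cyclo` the empty case is excluded by the constant
-- coefficient.
zdivMonic-monic : ∀ {n k} a b → Monic n a → Monic k b → (zdivMonic a b ≡ []) ⊎ (∃ λ l → Monic l (zdivMonic a b))
zdivMonic-monic {n} a b ha hb with monic-reverse ha | monic-reverse hb | length a | monic-length ha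
... | at , ea | bt , eb | _ | ≡.refl rewrite zdivMonic-unfold a b eb | ea | monic-length ha with length bt ℕ.≤ᵇ length at
...   | true = inj₂ (_ , reverse-monic (divHF n (subHF (+ 1) at bt) bt))
...   | false = inj₁ ≡.refl

length-subHF : ∀ c as bt → length (subHF c as bt) ≡ length as
length-subHF c as [] = ≡.refl
length-subHF c [] (b ∷ bt) = ≡.refl
length-subHF c (a ∷ as) (b ∷ bt) = ≡.cong suc (length-subHF c as bt)

length-divHF : ∀ f a bt → length a ℕ.≤ f → length (divHF f a bt) ≡ length a ℕ.∸ length bt
length-divHF zero [] bt l = ≡.sym (ℕₚ.0∸n≡0 (length bt))
length-divHF (suc f) [] bt l = ≡.sym (ℕₚ.0∸n≡0 (length bt))
length-divHF (suc f) (c ∷ as) bt (ℕ.s≤s l) with length bt ℕ.≤ᵇ length as in eq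
... | true = ≡.trans (≡.cong suc (≡.trans (length-divHF f (subHF c as bt) bt (ℕₚ.≤-trans (ℕₚ.≤-reflexive (length-subHF c as bt)) l))
        (≡.cong (ℕ._∸ length bt) (length-subHF c as bt))))
      (≡.sym (ℕₚ.+-∸-assoc 1 (ℕₚ.≤ᵇ⇒≤ (length bt) (length as) (≡.subst T (≡.sym eq) _))))
... | false = ≡.sym (ℕₚ.m≤n⇒m∸n≡0 {suc (length as)} {length bt} (ℕₚ.≰⇒> (λ le → ≡.subst T eq (ℕₚ.≤⇒≤ᵇ le))))

-- Values of coefficient lists and correctness of long division.

module Polynomials (A : LaurentAlgebra) where
  open QBinomial A
  open Kit A

  q : Carrier
  q = X 1ℤ

  X-suc : ∀ n → X (+ suc n) ≈ q * X (+ n)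
  X-suc n = X-+ 1ℤ (+ n)

  horner : ZPoly → Carrier
  horner [] = 0#
  horner (a ∷ p) = zz a + q * horner p

  horner-zadd : ∀ p r → horner (zadd p r) ≈ horner p + horner r
  horner-zadd [] r = sym (+-identityˡ _)
  horner-zadd (a ∷ p) [] = sym (+-identityʳ _)
  horner-zadd (a ∷ p) (b ∷ r) = trans (+-cong (zz-+ a b) (*-congˡ (horner-zadd p r)))
    (solve 5 (λ a b q p r → a :+ b :+ q :* (p :+ r) := a :+ q :* p :+ (b :+ q :* r)) refl (zz a) (zz b) q (horner p) (horner r))

  horner-zscale : ∀ c p → horner (zscale c p) ≈ zz c * horner p
  horner-zscale c [] = sym (zeroʳ _)
  horner-zscale c (a ∷ p) = trans (+-cong (zz-* c a) (*-congˡ (horner-zscale c p)))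
    (solve 4 (λ c a q p → c :* a :+ q :* (c :* p) := c :* (a :+ q :* p)) refl (zz c) (zz a) q (horner p))

  horner-zmul : ∀ p r → horner (zmul p r) ≈ horner p * horner r
  horner-zmul [] r = sym (zeroˡ _)
  horner-zmul (a ∷ p) r = trans (horner-zadd (zscale a r) _) (trans (+-cong (horner-zscale a r) (+-cong ι-0 (*-congˡ (horner-zmul p r))))
    (solve 4 (λ a r q p → a :* r :+ (:0 :+ q :* (p :* r)) := (a :+ q :* p) :* r) refl (zz a) (horner r) q (horner p)))

  horner-zone : horner zone ≈ 1#
  horner-zone = trans (+-cong ι-1 (zeroʳ q)) (+-identityʳ _)

  horner-qpow : ∀ n → horner (replicate n (+ 0) ++ + 1 ∷ []) ≈ X (+ n)
  horner-qpow zero = trans horner-zone (sym X-0)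
  horner-qpow (suc n) = trans (+-cong ι-0 (*-congˡ (horner-qpow n))) (trans (+-identityˡ _) (sym (X-suc n)))

  horner-qpowMinusOne : ∀ n → horner (qpowMinusOne (suc n)) ≈ X (+ suc n) - 1#
  horner-qpowMinusOne n = trans (+-cong (trans (zz-neg (+ 1)) (-‿cong ι-1)) (trans (*-congˡ (horner-qpow n)) (sym (X-suc n)))) (+-comm _ _)

  horner-qint : ∀ n → horner (qint n) ≈ qnum n
  horner-qint zero = refl
  horner-qint (suc n) = +-cong (trans ι-1 (sym X-0)) (trans (*-congˡ (horner-qint n)) (trans (∑-*ˡ q _ n) (Sum.fold-cong n (λ i → sym (X-suc i)))))

  horner-qfact : ∀ n → horner (qfact n) ≈ QFactorial.fac n
  horner-qfact zero = horner-zone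
  horner-qfact (suc n) = trans (horner-zmul (qint (suc n)) (qfact n)) (trans (*-cong (horner-qint (suc n)) (horner-qfact n))
    (trans (*-comm _ _) (sym (Product.fold-snoc (λ i → qnum (suc i)) n))))

  hf : List ℤ → Carrier
  hf [] = 0#
  hf (a ∷ as) = zz a * X (+ length as) + hf as

  hf-snoc : ∀ xs a → hf (xs ++ a ∷ []) ≈ q * hf xs + zz a
  hf-snoc [] a = trans (+-identityʳ _) (trans (trans (*-congˡ X-0) (*-identityʳ _)) (sym (trans (+-congʳ (zeroʳ q)) (+-identityˡ _))))
  hf-snoc (x ∷ xs) a = begin
      zz x * X (+ length (xs ++ a ∷ [])) + hf (xs ++ a ∷ [])
        ≈⟨ +-cong (*-congˡ (trans (X-congʳ (≡.cong +_ (≡.trans (Listₚ.length-++ xs) (ℕₚ.+-comm (length xs) 1)))) (X-suc _))) (hf-snoc xs a) ⟩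
      zz x * (q * X (+ length xs)) + (q * hf xs + zz a)
        ≈⟨ solve 5 (λ x q l h a → x :* (q :* l) :+ (q :* h :+ a) := q :* (x :* l :+ h) :+ a) refl (zz x) q (X (+ length xs)) (hf xs) (zz a) ⟩
      q * (zz x * X (+ length xs) + hf xs) + zz a ∎

  hf-reverse : ∀ p → hf (reverse p) ≈ horner p
  hf-reverse [] = refl
  hf-reverse (a ∷ p) = trans (reflexive (≡.cong hf (Listₚ.unfold-reverse a p)))
    (trans (hf-snoc (reverse p) a) (trans (+-comm _ _) (+-congˡ (*-congˡ (hf-reverse p)))))

  horner-reverse : ∀ xs → horner (reverse xs) ≈ hf xs
  horner-reverse xs = trans (sym (hf-reverse (reverse xs))) (reflexive (≡.cong hf (Listₚ.reverse-involutive xs)))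

  hf-subHF : ∀ c as bt → length bt ℕ.≤ length as →
    hf (subHF c as bt) ≈ hf as - zz c * X (+ length as ℤ.- + length bt) * hf bt
  hf-subHF c as [] l = solve 3 (λ a c x → a := a :- c :* x :* :0) refl (hf as) (zz c) (X (+ length as ℤ.- + 0))
  hf-subHF c (a ∷ as) (b ∷ bt) (ℕ.s≤s l) = begin
      zz (a ℤ.- c ℤ.* b) * X (+ length (subHF c as bt)) + hf (subHF c as bt)
        ≈⟨ +-cong (*-cong (trans (zz-+ a _) (+-congˡ (trans (zz-neg (c ℤ.* b)) (-‿cong (zz-* c b))))) (X-congʳ (≡.cong +_ (length-subHF c as bt)))) (hf-subHF c as bt l) ⟩
      (zz a - zz c * zz b) * X (+ length as) + (hf as - zz c * x * hf bt)
        ≈⟨ solve 7 (λ a c b y h x t → (a :- c :* b) :* y :+ (h :- c :* x :* t) := a :* y :+ h :- (c :* b :* y :+ c :* x :* t)) refl (zz a) (zz c) (zz b) (X (+ length as)) (hf as) x (hf bt) ⟩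
      zz a * X (+ length as) + hf as - (zz c * zz b * X (+ length as) + zz c * x * hf bt)
        ≈⟨ +-congˡ (-‿cong (+-congʳ (*-congˡ (sym (X-merge (ℤS.solve 2 (λ a b → a :-ᶻ b :+ᶻ b :=ᶻ a) ≡.refl (+ length as) (+ length bt))))))) ⟩
      zz a * X (+ length as) + hf as - (zz c * zz b * (x * X (+ length bt)) + zz c * x * hf bt)
        ≈⟨ +-congˡ (-‿cong (solve 5 (λ c b x y t → c :* b :* (x :* y) :+ c :* x :* t := c :* x :* (b :* y :+ t)) refl (zz c) (zz b) x (X (+ length bt)) (hf bt))) ⟩
      zz a * X (+ length as) + hf as - zz c * x * (zz b * X (+ length bt) + hf bt)
        ≈⟨ +-congˡ (-‿cong (*-congʳ (*-congˡ (X-congʳ (ℤS.solve 2 (λ a b → a :-ᶻ b :=ᶻ (:1ᶻ :+ᶻ a) :-ᶻ (:1ᶻ :+ᶻ b)) ≡.refl (+ length as) (+ length bt)))))) ⟩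
      hf (a ∷ as) - zz c * X (+ suc (length as) ℤ.- + suc (length bt)) * hf (b ∷ bt) ∎
    where
    x = X (+ length as ℤ.- + length bt)

  -- Each step shortens the dividend by one entry, so fuel equal to its length suffices.
  -- `hf (+ 1 ∷ bt)` is the divisor; the length bound says that the remainder has smaller degree.
  divHF-spec : ∀ f a bt → length a ℕ.≤ f →
    ∃ λ rem → length rem ℕ.≤ length bt × hf a ≈ hf (+ 1 ∷ bt) * hf (divHF f a bt) + hf rem
  divHF-spec zero [] bt l = [] , ℕ.z≤n , sym (trans (+-identityʳ _) (zeroʳ _))
  divHF-spec (suc f) [] bt l = [] , ℕ.z≤n , sym (trans (+-identityʳ _) (zeroʳ _))
  divHF-spec (suc f) (c ∷ as) bt (ℕ.s≤s l) with length bt ℕ.≤ᵇ length as in eq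
  ... | false = c ∷ as , ℕₚ.≰⇒> (λ le → ≡.subst T eq (ℕₚ.≤⇒≤ᵇ le)) , sym (trans (+-congʳ (zeroʳ _)) (+-identityˡ _))
  ... | true =
    let l′ = ℕₚ.≤-trans (ℕₚ.≤-reflexive (length-subHF c as bt)) l
        le = ℕₚ.≤ᵇ⇒≤ (length bt) (length as) (≡.subst T (≡.sym eq) _)
        (rem , hr , h) = divHF-spec f (subHF c as bt) bt l′
        Q = divHF f (subHF c as bt) bt
        x = X (+ length as ℤ.- + length bt)
        ex = X-congʳ (≡.trans (≡.cong +_ (≡.trans (length-divHF f (subHF c as bt) bt l′) (≡.cong (ℕ._∸ length bt) (length-subHF c as bt))))
               (≡.sym (≡.trans (ℤₚ.m-n≡m⊖n (length as) (length bt)) (ℤₚ.⊖-≥ le))))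
    in rem , hr , (begin
      zz c * X (+ length as) + hf as
        ≈⟨ solve 4 (λ cx h c t → cx :+ h := cx :+ c :* t :+ (h :- c :* t)) refl (zz c * X (+ length as)) (hf as) (zz c * x) (hf bt) ⟩
      zz c * X (+ length as) + zz c * x * hf bt + (hf as - zz c * x * hf bt)
        ≈⟨ +-cong (+-congʳ (*-congˡ (sym (X-merge (ℤS.solve 2 (λ a b → a :-ᶻ b :+ᶻ b :=ᶻ a) ≡.refl (+ length as) (+ length bt)))))) (trans (sym (hf-subHF c as bt le)) h) ⟩
      zz c * (x * X (+ length bt)) + zz c * x * hf bt + (hf (+ 1 ∷ bt) * hf Q + hf rem)
        ≈⟨ solve 7 (λ c x y t o Q r → c :* (x :* y) :+ c :* x :* t :+ ((o :* y :+ t) :* Q :+ r) := (:1 :* y :+ t) :* (c :* x) :+ (o :* y :+ t) :* Q :+ r) refl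
             (zz c) x (X (+ length bt)) (hf bt) (zz (+ 1)) (hf Q) (hf rem) ⟩
      (1# * X (+ length bt) + hf bt) * (zz c * x) + hf (+ 1 ∷ bt) * hf Q + hf rem
        ≈⟨ +-congʳ (+-congʳ (*-cong (+-congʳ (*-congʳ (sym ι-1))) (*-congˡ (sym ex)))) ⟩
      hf (+ 1 ∷ bt) * (zz c * X (+ length Q)) + hf (+ 1 ∷ bt) * hf Q + hf rem
        ≈⟨ +-congʳ (distribˡ _ _ _) ⟨
      hf (+ 1 ∷ bt) * (zz c * X (+ length Q) + hf Q) + hf rem ∎)

  gauss-division : ∀ n k → k ℕ.≤ n → horner (zmul (qfact k) (qfact (n ℕ.∸ k))) * gauss n k ≈ horner (qfact n)
  gauss-division n k k≤n = trans (*-congʳ (trans (horner-zmul (qfact k) _) (*-cong (horner-qfact k) (horner-qfact (n ℕ.∸ k)))))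
    (trans (*-comm _ _) (trans (QFactorial.gauss-fac n k (n ℕ.∸ k) (ℕₚ.m+[n∸m]≡n k≤n)) (sym (horner-qfact n))))

-- Cyclotomic polynomials

Cancellable : LaurentAlgebra → Set
Cancellable A = ∀ k f g → (1# - X (+ suc k)) * f ≈ (1# - X (+ suc k)) * g → f ≈ g
  where open LaurentAlgebra A

ExactDivision : LaurentAlgebra → Set
ExactDivision A = ∀ {n} a b c → Monic n b → HeadUnit b → horner b * c ≈ horner a → horner (zdivMonic a b) ≈ c
  where
  open LaurentAlgebra A
  open Polynomials A

HeadUnitFactors : LaurentAlgebra → Set
HeadUnitFactors A = ∀ p r n → horner p * horner r ≈ X (+ suc n) - 1# → HeadUnit p
  where
  open LaurentAlgebra A
  open Polynomials A

module Cyclotomic (A : LaurentAlgebra) (cancel : Cancellable A) (exact : ExactDivision A) (headUnit : HeadUnitFactors A) where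

  open QBinomial A
  open Kit A
  open Polynomials A

  infix 4 _∣ᴿ_
  _∣ᴿ_ : Carrier → Carrier → Set
  a ∣ᴿ b = ∃ λ c → a * c ≈ b

  ∣ᴿ-trans : ∀ {a b c} → a ∣ᴿ b → b ∣ᴿ c → a ∣ᴿ c
  ∣ᴿ-trans (u , p) (v , q) = u * v , trans (sym (*-assoc _ u v)) (trans (*-congʳ p) q)

  ∣ᴿ-* : ∀ {a b c d} → a ∣ᴿ b → c ∣ᴿ d → a * c ∣ᴿ b * d
  ∣ᴿ-* {a} {b} {c} {d} (u , p) (v , q) = u * v ,
    trans (solve 4 (λ a c u v → a :* c :* (u :* v) := a :* u :* (c :* v)) refl a c u v) (*-cong p q)

  -- Comaximality rather than absence of common factors: the Bézout identity itself is what later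
  -- inverts 1 - q^r modulo Φ_m³.
  Coprime : Carrier → Carrier → Set
  Coprime a b = ∃ λ u → ∃ λ v → a * u + b * v ≈ 1#

  coprime-sym : ∀ {a b} → Coprime a b → Coprime b a
  coprime-sym (u , v , p) = v , u , trans (+-comm _ _) p

  coprime-1 : ∀ b → Coprime 1# b
  coprime-1 b = 1# , 0# , solve 1 (λ b → :1 :* :1 :+ b :* :0 := :1) refl b

  coprime-* : ∀ {a b c} → Coprime a c → Coprime b c → Coprime (a * b) c
  coprime-* {a} {b} {c} (u , v , p) (x , y , q) = u * x , a * u * y + v , (begin
      a * b * (u * x) + c * (a * u * y + v)
        ≈⟨ solve 7 (λ a b c u v x y → a :* b :* (u :* x) :+ c :* (a :* u :* y :+ v) := a :* u :* (b :* x :+ c :* y) :+ c :* v) refl a b c u v x y ⟩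
      a * u * (b * x + c * y) + c * v ≈⟨ +-congʳ (trans (*-congˡ q) (*-identityʳ _)) ⟩
      a * u + c * v ≈⟨ p ⟩
      1# ∎)

  coprime-∣ : ∀ {a b c} → b ∣ᴿ c → Coprime a c → Coprime a b
  coprime-∣ {a} {b} {c} (w , p) (u , v , q) = u , w * v , trans (+-congˡ (trans (sym (*-assoc b w v)) (*-congʳ p))) q

  coprime-lcm : ∀ {a b c} → Coprime a b → a ∣ᴿ c → b ∣ᴿ c → a * b ∣ᴿ c
  coprime-lcm {a} {b} {c} (u , v , p) (x , hx) (y , hy) = u * y + v * x , (begin
      a * b * (u * y + v * x) ≈⟨ solve 6 (λ a b u v x y → a :* b :* (u :* y :+ v :* x) := a :* u :* (b :* y) :+ b :* v :* (a :* x)) refl a b u v x y ⟩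
      a * u * (b * y) + b * v * (a * x) ≈⟨ +-cong (*-congˡ hy) (*-congˡ hx) ⟩
      a * u * c + b * v * c ≈⟨ distribʳ c _ _ ⟨
      (a * u + b * v) * c ≈⟨ *-congʳ p ⟩
      1# * c ≈⟨ *-identityˡ c ⟩
      c ∎)

  xMinusOne : ℕ → Carrier
  xMinusOne n = X (+ n) - 1#

  xMinusOne-∣ : ∀ g k → xMinusOne g ∣ᴿ xMinusOne (k ℕ.* g)
  xMinusOne-∣ g k = S , (begin
      xMinusOne g * S ≈⟨ solve 2 (λ x s → (x :- :1) :* s := :- ((:1 :- x) :* s)) refl (X (+ g)) S ⟩
      - ((1# - X (+ g)) * S) ≈⟨ -‿cong (geometric (+ g) k) ⟩
      - (1# - X (+ g ℤ.* + k)) ≈⟨ solve 1 (λ x → :- (:1 :- x) := x :- :1) refl (X (+ g ℤ.* + k)) ⟩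
      X (+ g ℤ.* + k) - 1# ≈⟨ +-congʳ (X-congʳ (≡.trans (ℤₚ.*-comm (+ g) (+ k)) (≡.sym (ℤₚ.pos-* k g)))) ⟩
      xMinusOne (k ℕ.* g) ∎)
    where
    S = ∑ (λ i → X (+ g ℤ.* + i)) k

  ∣⇒xMinusOne-∣ : ∀ {g m} → g ∣ m → xMinusOne g ∣ᴿ xMinusOne m
  ∣⇒xMinusOne-∣ {g} (divides k e) = ≡.subst (λ m → xMinusOne g ∣ᴿ xMinusOne m) (≡.sym e) (xMinusOne-∣ g k)

  Combination : Carrier → Carrier → Carrier → Set
  Combination c a b = ∃ λ u → ∃ λ v → a * u + b * v ≈ c

  -- q^d - 1 = (q^(am) - 1) - q^d (q^(br) - 1). With d = gcd(m,r) it lifts Bézout's identity from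
  -- exponents to polynomials.
  difference-combination : ∀ d a b m r → d ℕ.+ b ℕ.* r ≡ a ℕ.* m → Combination (xMinusOne d) (xMinusOne m) (xMinusOne r)
  difference-combination d a b m r e =
    let (s , hs) = xMinusOne-∣ m a
        (w , hw) = xMinusOne-∣ r b
    in s , - (X (+ d) * w) , (begin
      xMinusOne m * s + xMinusOne r * - (X (+ d) * w)
        ≈⟨ +-cong hs (solve 3 (λ x d w → x :* (:- (d :* w)) := :- (d :* (x :* w))) refl (xMinusOne r) (X (+ d)) w) ⟩
      xMinusOne (a ℕ.* m) - X (+ d) * (xMinusOne r * w)
        ≈⟨ +-cong (+-congʳ (trans (X-congʳ (≡.cong +_ (≡.sym e))) (X-+ (+ d) (+ (b ℕ.* r))))) (-‿cong (*-congˡ hw)) ⟩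
      X (+ d) * X (+ (b ℕ.* r)) - 1# - X (+ d) * xMinusOne (b ℕ.* r)
        ≈⟨ solve 2 (λ d y → d :* y :- :1 :- d :* (y :- :1) := d :- :1) refl (X (+ d)) (X (+ (b ℕ.* r))) ⟩
      xMinusOne d ∎)

  gcd-combination : ∀ m r → Combination (xMinusOne (gcd m r)) (xMinusOne m) (xMinusOne r)
  gcd-combination m r with Bézout.identity (gcd-GCD m r)
  ... | Bézout.+- x y e = difference-combination (gcd m r) x y m r e
  ... | Bézout.-+ x y e = let (u , v , h) = difference-combination (gcd m r) y x r m e in v , u , trans (+-comm _ _) h

  geometric-remainder : ∀ g k → ∃ λ w → ∑ (λ i → X (+ g ℤ.* + i)) k ≈ nn k + xMinusOne g * w
  geometric-remainder g zero = 0# , sym (trans (+-cong nn-0 (zeroʳ _)) (+-identityʳ _))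
  geometric-remainder g (suc k) =
    let (w , h) = geometric-remainder g k
        (v , hv) = xMinusOne-∣ g k
    in w + v , (begin
      ∑ (λ i → X (+ g ℤ.* + i)) (suc k) ≈⟨ Sum.fold-snoc (λ i → X (+ g ℤ.* + i)) k ⟩
      ∑ (λ i → X (+ g ℤ.* + i)) k + X (+ g ℤ.* + k)
        ≈⟨ +-cong h (X-congʳ (≡.trans (ℤₚ.*-comm (+ g) (+ k)) (≡.sym (ℤₚ.pos-* k g)))) ⟩
      nn k + xMinusOne g * w + X (+ (k ℕ.* g))
        ≈⟨ solve 4 (λ n a w x → n :+ a :* w :+ x := :1 :+ n :+ (a :* w :+ (x :- :1))) refl (nn k) (xMinusOne g) w (X (+ (k ℕ.* g))) ⟩
      1# + nn k + (xMinusOne g * w + xMinusOne (k ℕ.* g))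
        ≈⟨ +-cong (sym (nn-suc k)) (trans (+-congˡ (sym hv)) (sym (distribˡ (xMinusOne g) w v))) ⟩
      nn (suc k) + xMinusOne g * (w + v) ∎)

  Φ : ℕ → Carrier
  Φ d = horner (cyclo d)

  factor : ℕ → ℕ → Carrier
  factor m d = if ⌊ d ∣? m ⌋ then Φ d else 1#

  divisorProduct : ℕ → ℕ → Carrier
  divisorProduct m zero = 1#
  divisorProduct m (suc n) = divisorProduct m n * factor m (suc n)

  horner-zprod-++ : ∀ xs ys → horner (zprod (xs ++ ys)) ≈ horner (zprod xs) * horner (zprod ys)
  horner-zprod-++ [] ys = sym (trans (*-congʳ horner-zone) (*-identityˡ _))
  horner-zprod-++ (x ∷ xs) ys = trans (horner-zmul x (zprod (xs ++ ys))) (trans (*-congˡ (horner-zprod-++ xs ys))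
    (trans (sym (*-assoc _ _ _)) (*-congʳ (sym (horner-zmul x (zprod xs))))))

  good-zprod : ∀ {xs} → All Good xs → Good (zprod xs)
  good-zprod All.[] = good-one
  good-zprod (g All.∷ gs) = good-zmul g (good-zprod gs)

  -- `cyclo` filters its table by an anonymous function, which `h` stands for; `h-def` records its
  -- behaviour and holds by `refl` when `h` is that function.
  module Table (m : ℕ) (h : ℕ × ZPoly → List ZPoly) (h-def : ∀ d p → h (d , p) ≡ (if ⌊ d ∣? m ⌋ then p ∷ [] else [])) where

    concatMap-suc : ∀ n → concatMap h (cycloTable (suc n)) ≡ concatMap h (cycloTable n) ++ (if ⌊ suc n ∣? m ⌋ then cyclo (suc n) ∷ [] else [])
    concatMap-suc n = ≡.trans (Listₚ.concatMap-++ h (cycloTable n) _)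
      (≡.cong (concatMap h (cycloTable n) ++_) (≡.trans (Listₚ.++-identityʳ _) (h-def (suc n) (cyclo (suc n)))))

    horner-table : ∀ n → horner (zprod (concatMap h (cycloTable n))) ≈ divisorProduct m n
    horner-table zero = horner-zone
    horner-table (suc n) = trans (reflexive (≡.cong (λ l → horner (zprod l)) (concatMap-suc n)))
      (trans (horner-zprod-++ (concatMap h (cycloTable n)) _) (*-cong (horner-table n) last))
      where
      last : horner (zprod (if ⌊ suc n ∣? m ⌋ then cyclo (suc n) ∷ [] else [])) ≈ factor m (suc n)
      last with suc n ∣? m
      ... | yes _ = trans (horner-zmul (cyclo (suc n)) zone) (trans (*-congˡ horner-zone) (*-identityʳ _))
      ... | no _ = horner-zone

    all-good : ∀ n → (∀ d → d ℕ.< n → Good (cyclo (suc d))) → All Good (concatMap h (cycloTable n))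
    all-good zero g = All.[]
    all-good (suc n) g = ≡.subst (All Good) (≡.sym (concatMap-suc n)) (++⁺ (all-good n (λ d l → g d (ℕₚ.m<n⇒m<1+n l))) last)
      where
      last : All Good (if ⌊ suc n ∣? m ⌋ then cyclo (suc n) ∷ [] else [])
      last with suc n ∣? m
      ... | yes _ = g n (ℕₚ.n<1+n n) All.∷ All.[]
      ... | no _ = All.[]

  divisorPolynomial : ∀ n → ∃ λ D → cyclo (suc n) ≡ zdivMonic (qpowMinusOne (suc n)) D ×
    horner D ≈ divisorProduct (suc n) n × ((∀ d → d ℕ.< n → Good (cyclo (suc d))) → Good D)
  -- Unification with the next component `refl` solves the hole by the anonymous function inside
  -- `cyclo`.
  divisorPolynomial n = zprod (concatMap _ (cycloTable n)) , ≡.refl ,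
    Table.horner-table (suc n) _ (λ _ _ → ≡.refl) n , λ g → good-zprod (Table.all-good (suc n) _ (λ _ _ → ≡.refl) n g)

  -- Established together by strong induction: the division defining Φ_(n+1) is exact because the
  -- earlier Φ_d are pairwise comaximal, and `good` is what makes `zdivMonic` find the exact
  -- quotient.
  record Cyclotomic (n : ℕ) : Set where
    field
      good : Good (cyclo (suc n))
      product : Φ (suc n) * divisorProduct (suc n) n ≈ xMinusOne (suc n)
      coprime : ∀ r → suc n ∤ r → Coprime (Φ (suc n)) (xMinusOne r)

  open Cyclotomic

  divisorProduct-∣ : ∀ {g m} → g ∣ m → ∀ n → divisorProduct g n ∣ᴿ divisorProduct m n
  divisorProduct-∣ g∣m zero = 1# , *-identityˡ 1#
  divisorProduct-∣ {g} {m} g∣m (suc n) = ∣ᴿ-* (divisorProduct-∣ g∣m n) step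
    where
    step : factor g (suc n) ∣ᴿ factor m (suc n)
    step with suc n ∣? g | suc n ∣? m
    ... | yes _ | yes _ = 1# , *-identityʳ _
    ... | yes d | no ¬d = ⊥-elim (¬d (∣-trans d g∣m))
    ... | no _ | yes _ = Φ (suc n) , *-identityˡ _
    ... | no _ | no _ = 1# , *-identityʳ _

  divisorProduct-+ : ∀ m n k → divisorProduct m n ∣ᴿ divisorProduct m (k ℕ.+ n)
  divisorProduct-+ m n zero = 1# , *-identityʳ _
  divisorProduct-+ m n (suc k) = ∣ᴿ-trans (divisorProduct-+ m n k) (_ , refl)

  divisorProduct-self : ∀ n → Cyclotomic n → divisorProduct (suc n) (suc n) ≈ xMinusOne (suc n)
  divisorProduct-self n c with suc n ∣? suc n
  ... | yes _ = trans (*-comm _ _) (product c)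
  ... | no ¬d = ⊥-elim (¬d ∣-refl)

  Φ-∣ : ∀ {n} → Cyclotomic n → Φ (suc n) ∣ᴿ xMinusOne (suc n)
  Φ-∣ {n} c = divisorProduct (suc n) n , product c

  coprime-Φ : ∀ m n → Cyclotomic n → (∀ e → e ℕ.< n → Cyclotomic e) → ∀ k → k ℕ.≤ n → Coprime (divisorProduct m k) (Φ (suc n))
  coprime-Φ m n c below zero _ = coprime-1 _
  coprime-Φ m n c below (suc k) k<n = coprime-* (coprime-Φ m n c below k (ℕₚ.<⇒≤ k<n)) step
    where
    step : Coprime (factor m (suc k)) (Φ (suc n))
    step with suc k ∣? m
    ... | yes _ = coprime-sym (coprime-∣ (Φ-∣ (below k k<n)) (coprime c (suc k) (λ d → ℕₚ.<⇒≱ k<n (ℕₚ.≤-pred (∣⇒≤ d)))))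
    ... | no _ = coprime-1 _

  -- Comaximal divisors of q^m - 1 multiply to a divisor. With m = n + 1 this is the exactness of
  -- the division that defines Φ_m.
  divisorProduct-∣-xMinusOne : ∀ m n → (∀ e → e ℕ.< n → Cyclotomic e) → divisorProduct m n ∣ᴿ xMinusOne m
  divisorProduct-∣-xMinusOne m zero below = xMinusOne m , *-identityˡ _
  divisorProduct-∣-xMinusOne m (suc n) below = step
    where
    below′ : ∀ e → e ℕ.< n → Cyclotomic e
    below′ e l = below e (ℕₚ.m<n⇒m<1+n l)
    c = below n (ℕₚ.n<1+n n)
    rest = divisorProduct-∣-xMinusOne m n below′
    step : divisorProduct m n * factor m (suc n) ∣ᴿ xMinusOne m
    step with suc n ∣? m
    ... | yes d = coprime-lcm (coprime-Φ m n c below′ n ℕₚ.≤-refl) rest (∣ᴿ-trans (Φ-∣ c) (∣⇒xMinusOne-∣ d))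
    ... | no _ = proj₁ rest , trans (*-congʳ (*-identityʳ _)) (proj₂ rest)

  -- Φ_m divides (q^m - 1)/(q^g - 1), which is congruent to the nonzero constant m/g modulo q^g - 1.
  coprime-divisor : ∀ n → (∀ e → e ℕ.< n → Cyclotomic e) → Φ (suc n) * divisorProduct (suc n) n ≈ xMinusOne (suc n) →
    ∀ g → g ∣ suc n → g ≢ suc n → Coprime (Φ (suc n)) (xMinusOne g)
  coprime-divisor n below e zero d _ with () ← 0∣⇒≡0 d
  coprime-divisor n below e (suc g) d@(divides zero ()) _
  coprime-divisor n below e (suc g) d@(divides (suc k) eq) g≢m =
    let g<n = ℕₚ.≤-pred (ℕₚ.≤∧≢⇒< (∣⇒≤ d) g≢m)
        -- q^g - 1 is the product of Φ_d over the divisors d of g; all these d divide m and are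
        -- below m. So Φ_m (q^g - 1) divides q^m - 1.
        (y , hy) = ∣ᴿ-trans (∣ᴿ-trans (1# , trans (*-identityʳ _) (sym (divisorProduct-self g (below g g<n)))) (divisorProduct-∣ d (suc g)))
                     (≡.subst (λ j → divisorProduct (suc n) (suc g) ∣ᴿ divisorProduct (suc n) j) (ℕₚ.m∸n+n≡m g<n) (divisorProduct-+ (suc n) (suc g) (n ℕ.∸ suc g)))
        S = ∑ (λ i → X (+ suc g ℤ.* + i)) (suc k)
        quotient = cancel g (Φ (suc n) * y) S (begin
          (1# - X (+ suc g)) * (Φ (suc n) * y)
            ≈⟨ solve 3 (λ x p y → (:1 :- x) :* (p :* y) := :- (p :* ((x :- :1) :* y))) refl (X (+ suc g)) (Φ (suc n)) y ⟩
          - (Φ (suc n) * (xMinusOne (suc g) * y)) ≈⟨ -‿cong (trans (*-congˡ hy) e) ⟩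
          - xMinusOne (suc n) ≈⟨ solve 1 (λ x → :- (x :- :1) := :1 :- x) refl (X (+ suc n)) ⟩
          1# - X (+ suc n)
            ≈⟨ +-congˡ (-‿cong (X-congʳ (≡.trans (≡.cong +_ eq) (≡.trans (ℤₚ.pos-* (suc k) (suc g)) (ℤₚ.*-comm (+ suc k) (+ suc g)))))) ⟩
          1# - X (+ suc g ℤ.* + suc k) ≈⟨ geometric (+ suc g) (suc k) ⟨
          (1# - X (+ suc g)) * S ∎)
        (w , hw) = geometric-remainder (suc g) (suc k)
        (v , hv) = unit-nn k
    in y * v , - (w * v) , (begin
      Φ (suc n) * (y * v) + xMinusOne (suc g) * - (w * v)
        ≈⟨ solve 5 (λ p y v a w → p :* (y :* v) :+ a :* (:- (w :* v)) := (p :* y :- a :* w) :* v) refl (Φ (suc n)) y v (xMinusOne (suc g)) w ⟩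
      (Φ (suc n) * y - xMinusOne (suc g) * w) * v ≈⟨ *-congʳ (+-congʳ (trans quotient hw)) ⟩
      (nn (suc k) + xMinusOne (suc g) * w - xMinusOne (suc g) * w) * v
        ≈⟨ solve 3 (λ n a v → (n :+ a :- a) :* v := n :* v) refl (nn (suc k)) (xMinusOne (suc g) * w) v ⟩
      nn (suc k) * v ≈⟨ hv ⟩
      1# ∎)

  cyclotomic-step : ∀ n → (∀ e → e ℕ.< n → Cyclotomic e) → Cyclotomic n
  cyclotomic-step n below = record { good = good′ ; product = product′ ; coprime = coprime′ }
    where
    D = proj₁ (divisorPolynomial n)
    unfold = proj₁ (proj₂ (divisorPolynomial n))
    D≈ = proj₁ (proj₂ (proj₂ (divisorPolynomial n)))
    goodD : Good D
    goodD = proj₂ (proj₂ (proj₂ (divisorPolynomial n))) (λ d l → good (below d l))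
    division = divisorProduct-∣-xMinusOne (suc n) n below
    c = proj₁ division
    Φ≈ : Φ (suc n) ≈ c
    Φ≈ = trans (reflexive (≡.cong horner unfold)) (exact (qpowMinusOne (suc n)) D c (proj₂ (proj₁ goodD)) (proj₂ goodD)
      (trans (*-congʳ D≈) (trans (proj₂ division) (sym (horner-qpowMinusOne n)))))
    product′ : Φ (suc n) * divisorProduct (suc n) n ≈ xMinusOne (suc n)
    product′ = trans (*-congʳ Φ≈) (trans (*-comm _ _) (proj₂ division))
    head : HeadUnit (cyclo (suc n))
    head = headUnit (cyclo (suc n)) D n (trans (*-congˡ D≈) product′)
    good′ : Good (cyclo (suc n))
    good′ with zdivMonic-monic (qpowMinusOne (suc n)) D (monic-qpowMinusOne n) (proj₂ (proj₁ goodD))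
    ... | inj₁ empty = ⊥-elim (≡.subst HeadUnit (≡.trans unfold empty) head)
    ... | inj₂ (l , mon) = (l , ≡.subst (Monic l) (≡.sym unfold) mon) , head
    -- With g = gcd(m,r), a proper divisor of m: q^g - 1 is a combination of q^r - 1 and of q^m - 1,
    -- a multiple of Φ_m. So comaximality with q^g - 1 passes to q^r - 1.
    coprime′ : ∀ r → suc n ∤ r → Coprime (Φ (suc n)) (xMinusOne r)
    coprime′ r ¬d =
      let g = gcd (suc n) r
          (u , v , h) = coprime-divisor n below product′ g (gcd[m,n]∣m (suc n) r) (λ e → ¬d (≡.subst (_∣ r) e (gcd[m,n]∣n (suc n) r)))
          (a , b , k) = gcd-combination (suc n) r
          y = divisorProduct (suc n) n
      in u + y * a * v , b * v , (begin
        Φ (suc n) * (u + y * a * v) + xMinusOne r * (b * v)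
          ≈⟨ solve 7 (λ p u y a v x b → p :* (u :+ y :* a :* v) :+ x :* (b :* v) := p :* u :+ ((p :* y) :* a :+ x :* b) :* v) refl (Φ (suc n)) u y a v (xMinusOne r) b ⟩
        Φ (suc n) * u + (Φ (suc n) * y * a + xMinusOne r * b) * v ≈⟨ +-congˡ (*-congʳ (trans (+-congʳ (*-congʳ product′)) k)) ⟩
        Φ (suc n) * u + xMinusOne g * v ≈⟨ h ⟩
        1# ∎)

  cyclotomic-below : ∀ n e → e ℕ.< n → Cyclotomic e
  cyclotomic-below (suc n) e e<n = cyclotomic-step e (λ d d<e → cyclotomic-below n d (ℕₚ.<-≤-trans d<e (ℕₚ.≤-pred e<n)))

  cyclotomic : ∀ n → Cyclotomic n
  cyclotomic n = cyclotomic-below (suc n) n (ℕₚ.n<1+n n)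

-- The quotient of a Laurent algebra by a principal ideal.

module Modulo (A : LaurentAlgebra) (φ : LaurentAlgebra.Carrier A) where
  open Kit A

  -- The same data as in `CongMod`, so an equality in the quotient algebra already is a congruence
  -- of the form asserted in the theorem.
  record _≈φ_ (x y : Carrier) : Set where
    constructor congruent
    field
      cofactor : Carrier
      equation : x - y ≈ cofactor * φ

  lift : ∀ {x y} → x ≈ y → x ≈φ y
  lift {x} {y} e = congruent 0# (trans (+-congʳ e) (trans (-‿inverseʳ y) (sym (zeroˡ φ))))

  quotient : LaurentAlgebra
  quotient = record
    { commutativeRing = record
      { Carrier = Carrier ; _≈_ = _≈φ_ ; _+_ = _+_ ; _*_ = _*_ ; -_ = -_ ; 0# = 0# ; 1# = 1#
      ; isCommutativeRing = record
        { isRing = record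
          { +-isAbelianGroup = record
            { isGroup = record
              { isMonoid = record
                { isSemigroup = record
                  { isMagma = record
                    { isEquivalence = record
                      { refl = lift refl
                      ; sym = λ {x} {y} (congruent h e) → congruent (- h) (trans (solve 2 (λ x y → y :- x := :- (x :- y)) refl x y)
                          (trans (-‿cong e) (-‿distribˡ-* h φ)))
                      ; trans = λ {x} {y} {z} (congruent h e) (congruent k f) → congruent (h + k)
                          (trans (solve 3 (λ x y z → x :- z := (x :- y) :+ (y :- z)) refl x y z) (trans (+-cong e f) (sym (distribʳ φ h k)))) }
                    ; ∙-cong = λ {x} {x′} {y} {y′} (congruent h e) (congruent k f) → congruent (h + k)
                        (trans (solve 4 (λ x x′ y y′ → x :+ y :- (x′ :+ y′) := (x :- x′) :+ (y :- y′)) refl x x′ y y′) (trans (+-cong e f) (sym (distribʳ φ h k)))) }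
                  ; assoc = λ x y z → lift (+-assoc x y z) }
                ; identity = (λ x → lift (+-identityˡ x)) , (λ x → lift (+-identityʳ x)) }
              ; inverse = (λ x → lift (-‿inverseˡ x)) , (λ x → lift (-‿inverseʳ x))
              ; ⁻¹-cong = λ {x} {y} (congruent h e) → congruent (- h)
                  (trans (solve 2 (λ x y → :- x :- (:- y) := :- (x :- y)) refl x y) (trans (-‿cong e) (-‿distribˡ-* h φ))) }
            ; comm = λ x y → lift (+-comm x y) }
          ; *-cong = λ {x} {x′} {y} {y′} (congruent h e) (congruent k f) → congruent (h * y + x′ * k)
              (trans (solve 4 (λ x x′ y y′ → x :* y :- x′ :* y′ := (x :- x′) :* y :+ x′ :* (y :- y′)) refl x x′ y y′)
                (trans (+-cong (*-congʳ e) (*-congˡ f))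
                  (solve 5 (λ h k p y x → h :* p :* y :+ x :* (k :* p) := (h :* y :+ x :* k) :* p) refl h k φ y x′)))
          ; *-assoc = λ x y z → lift (*-assoc x y z)
          ; *-identity = (λ x → lift (*-identityˡ x)) , (λ x → lift (*-identityʳ x))
          ; distrib = (λ x y z → lift (distribˡ x y z)) , (λ x y z → lift (distribʳ x y z)) }
        ; *-comm = λ x y → lift (*-comm x y) } }
    ; ι = ι
    ; ι-+ = λ a b → lift (ι-+ a b)
    ; ι-* = λ a b → lift (ι-* a b)
    ; ι-neg = λ a → lift (ι-neg a)
    ; ι-0 = lift ι-0
    ; ι-1 = lift ι-1
    ; X = X
    ; X-+ = λ a b → lift (X-+ a b)
    ; X-0 = lift X-0
    }

  private
    module K′ = Kit quotient

  φ≈0 : φ ≈φ 0#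
  φ≈0 = congruent 1# (solve 1 (λ p → p :- :0 := :1 :* p) refl φ)

  -- The two algebras share carrier and operations, but for a variable bound their sums do not
  -- unfold to a common form; hence an induction.
  ∑-quotient : ∀ {f g} n → (∀ i → f i ≡ g i) → K′.∑ f n ≡ ∑ g n
  ∑-quotient zero h = ≡.refl
  ∑-quotient (suc n) h = ≡.cong₂ _+_ (h 0) (∑-quotient n (λ i → h (suc i)))

  ∏-quotient : ∀ {f g} n → (∀ i → f i ≡ g i) → K′.∏ f n ≡ ∏ g n
  ∏-quotient zero h = ≡.refl
  ∏-quotient (suc n) h = ≡.cong₂ _*_ (h 0) (∏-quotient n (λ i → h (suc i)))

  gauss-quotient : ∀ n k → QBinomial.gauss quotient n k ≡ QBinomial.gauss A n k
  gauss-quotient n zero = ≡.refl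
  gauss-quotient zero (suc k) = ≡.refl
  gauss-quotient (suc n) (suc k) = ≡.cong₂ (λ a b → X (+ suc k) * a + b) (gauss-quotient n (suc k)) (gauss-quotient n k)

  blockProduct-quotient : ∀ M n → BlockProducts.blockProduct quotient M n ≡ BlockProducts.blockProduct A M n
  blockProduct-quotient M n = ∏-quotient n (λ s → ≡.cong₂ _*_ (∏-quotient M (λ _ → ≡.refl)) (∑-quotient {λ i → X (+ suc M ℤ.* + i)} {λ i → X (+ suc M ℤ.* + i)} (suc s) (λ _ → ≡.refl)))

module NilpotentUnits (A : LaurentAlgebra) where
  open Kit A

  -- The cube is written as `powL F 3` unfolds; p and p′ are the forms `fromZPoly (cyclo m)` and
  -- `horner (cyclo m)` of Φ_m, and x will be q^m - 1.
  cube-of-multiple : ∀ p p′ x y → p * (p * (p * 1#)) ≈ 0# → p ≈ p′ → p′ * y ≈ x → x * (x * x) ≈ 0#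
  cube-of-multiple p p′ x y e p≈p′ h′ = trans (*-cong (sym h) (*-cong (sym h) (sym h)))
    (trans (solve 2 (λ p y → p :* y :* (p :* y :* (p :* y)) := p :* (p :* (p :* :1)) :* (y :* (y :* y))) refl p y) (trans (*-congʳ e) (zeroˡ _)))
    where
    h : p * y ≈ x
    h = trans (*-congʳ p≈p′) h′

  -- The Bézout identity reads (1 - x)(-v) = 1 - p u, and 1 - p u is inverted by the geometric
  -- series, which stops because p³ = 0.
  unit-modulo-nilpotent : ∀ p p′ x u v → p * (p * (p * 1#)) ≈ 0# → p ≈ p′ → p′ * u + (x - 1#) * v ≈ 1# → IsUnit (1# - x)
  unit-modulo-nilpotent p p′ x u v e p≈p′ h′ = - (v * (1# + p * u + p * u * (p * u))) , (begin
      (1# - x) * - (v * (1# + p * u + p * u * (p * u)))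
        ≈⟨ solve 4 (λ x v p u → (:1 :- x) :* (:- (v :* (:1 :+ p :* u :+ p :* u :* (p :* u))))
             := ((p :* u :+ (x :- :1) :* v) :- p :* u) :* (:1 :+ p :* u :+ p :* u :* (p :* u))) refl x v p u ⟩
      ((p * u + (x - 1#) * v) - p * u) * (1# + p * u + p * u * (p * u)) ≈⟨ *-congʳ (+-congʳ h) ⟩
      (1# - p * u) * (1# + p * u + p * u * (p * u))
        ≈⟨ solve 2 (λ p u → (:1 :- p :* u) :* (:1 :+ p :* u :+ p :* u :* (p :* u)) := :1 :- p :* (p :* (p :* :1)) :* (u :* (u :* u))) refl p u ⟩
      1# - p * (p * (p * 1#)) * (u * (u * u)) ≈⟨ +-congˡ (-‿cong (trans (*-congʳ e) (zeroˡ _))) ⟩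
      1# - 0# ≈⟨ solve 0 (:1 :- :0 := :1) refl ⟩
      1# ∎)
    where
    h : p * u + (x - 1#) * v ≈ 1#
    h = trans (+-congʳ (*-congʳ p≈p′)) h′

  square-pow : ∀ c t → c * (t * t) ≈ c * (t * (t * 1#))
  square-pow c t = *-congˡ (*-congˡ (sym (*-identityʳ t)))

  *-*-cong : ∀ x a a′ b b′ → a ≈ a′ → b ≈ b′ → x * (a * b) ≈ x * (a′ * b′)
  *-*-cong x a a′ b b′ p r = *-congˡ (*-cong p r)

-- The ring of Laurent polynomials

single : ℤ → ℚ → ℤ → ℚ
single e c x = if ⌊ e ℤ.≟ x ⌋ then c else 0ℚ

single-≡ : ∀ e c → single e c e ≡ c
single-≡ e c with e ℤ.≟ e
... | yes _ = ≡.refl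
... | no ne = ⊥-elim (ne ≡.refl)

single-≢ : ∀ e c {x} → e ≢ x → single e c x ≡ 0ℚ
single-≢ e c {x} ne with e ℤ.≟ x
... | yes p = ⊥-elim (ne p)
... | no _ = ≡.refl

coeff-∷ : ∀ e c f x → coeff ((e , c) ∷ f) x ≡ single e c x ℚ.+ coeff f x
coeff-∷ e c f x with e ℤ.≟ x
... | yes _ = ≡.refl
... | no _ = ≡.sym (ℚₚ.+-identityˡ _)

coeff-++ : ∀ f g x → coeff (f ++ g) x ≡ coeff f x ℚ.+ coeff g x
coeff-++ [] g x = ≡.sym (ℚₚ.+-identityˡ _)
coeff-++ ((e , c) ∷ f) g x = begin
    coeff ((e , c) ∷ f ++ g) x ≡⟨ coeff-∷ e c (f ++ g) x ⟩
    single e c x ℚ.+ coeff (f ++ g) x ≡⟨ cong (single e c x ℚ.+_) (coeff-++ f g x) ⟩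
    single e c x ℚ.+ (coeff f x ℚ.+ coeff g x) ≡⟨ ℚₚ.+-assoc (single e c x) _ _ ⟨
    single e c x ℚ.+ coeff f x ℚ.+ coeff g x ≡⟨ cong (ℚ._+ coeff g x) (coeff-∷ e c f x) ⟨
    coeff ((e , c) ∷ f) x ℚ.+ coeff g x ∎
  where open ≡.≡-Reasoning

single-neg : ∀ e c x → single e (ℚ.- c) x ≡ ℚ.- single e c x
single-neg e c x with e ℤ.≟ x
... | yes _ = ≡.refl
... | no _ = ≡.refl

coeff-neg : ∀ f x → coeff (-L f) x ≡ ℚ.- coeff f x
coeff-neg [] x = ≡.refl
coeff-neg ((e , c) ∷ f) x = begin
    coeff ((e , ℚ.- c) ∷ -L f) x ≡⟨ coeff-∷ e (ℚ.- c) (-L f) x ⟩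
    single e (ℚ.- c) x ℚ.+ coeff (-L f) x ≡⟨ cong₂ ℚ._+_ (single-neg e c x) (coeff-neg f x) ⟩
    (ℚ.- single e c x) ℚ.+ (ℚ.- coeff f x) ≡⟨ ℚₚ.neg-distrib-+ (single e c x) (coeff f x) ⟨
    ℚ.- (single e c x ℚ.+ coeff f x) ≡⟨ cong ℚ.-_ (coeff-∷ e c f x) ⟨
    ℚ.- coeff ((e , c) ∷ f) x ∎
  where open ≡.≡-Reasoning

-- Multiplication by f as an operator on coefficient functions. It sees its second argument only
-- through coefficients, so products can be compared where equality of Laurent polynomials is
-- defined.
convolve : LPoly → (ℤ → ℚ) → ℤ → ℚ
convolve [] G x = 0ℚ
convolve ((e , c) ∷ f) G x = c ℚ.* G (x ℤ.- e) ℚ.+ convolve f G x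

single-shift : ∀ e e′ c c′ x → single (e ℤ.+ e′) (c ℚ.* c′) x ≡ c ℚ.* single e′ c′ (x ℤ.- e)
single-shift e e′ c c′ x with (e ℤ.+ e′) ℤ.≟ x
... | yes ≡.refl rewrite ℤS.solve 2 (λ e e′ → e :+ᶻ e′ :-ᶻ e :=ᶻ e′) ≡.refl e e′ = cong (c ℚ.*_) (≡.sym (single-≡ e′ c′))
... | no ne = ≡.sym (≡.trans (cong (c ℚ.*_) (single-≢ e′ c′ {x ℤ.- e} (λ p → ne (≡.trans (cong (λ y → e ℤ.+ y) p)
      (ℤS.solve 2 (λ e x → e :+ᶻ (x :-ᶻ e) :=ᶻ x) ≡.refl e x))))) (ℚₚ.*-zeroʳ c))

coeff-map-shift : ∀ e c (h : ℤ × ℚ → ℤ × ℚ) → (∀ e′ c′ → h (e′ , c′) ≡ (e ℤ.+ e′ , c ℚ.* c′)) →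
  ∀ g x → coeff (map h g) x ≡ c ℚ.* coeff g (x ℤ.- e)
coeff-map-shift e c h hyp [] x = ≡.sym (ℚₚ.*-zeroʳ c)
coeff-map-shift e c h hyp ((e′ , c′) ∷ g) x rewrite hyp e′ c′ = begin
    coeff ((e ℤ.+ e′ , c ℚ.* c′) ∷ map h g) x ≡⟨ coeff-∷ (e ℤ.+ e′) (c ℚ.* c′) (map h g) x ⟩
    single (e ℤ.+ e′) (c ℚ.* c′) x ℚ.+ coeff (map h g) x ≡⟨ cong₂ ℚ._+_ (single-shift e e′ c c′ x) (coeff-map-shift e c h hyp g x) ⟩
    c ℚ.* single e′ c′ (x ℤ.- e) ℚ.+ c ℚ.* coeff g (x ℤ.- e) ≡⟨ ℚₚ.*-distribˡ-+ c _ _ ⟨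
    c ℚ.* (single e′ c′ (x ℤ.- e) ℚ.+ coeff g (x ℤ.- e)) ≡⟨ cong (c ℚ.*_) (coeff-∷ e′ c′ g _) ⟨
    c ℚ.* coeff ((e′ , c′) ∷ g) (x ℤ.- e) ∎
  where open ≡.≡-Reasoning

coeff-* : ∀ f g x → coeff (f *L g) x ≡ convolve f (coeff g) x
coeff-* [] g x = ≡.refl
coeff-* ((e , c) ∷ f) g x = ≡.trans (coeff-++ (map _ g) (f *L g) x)
  (cong₂ ℚ._+_ (coeff-map-shift e c _ (λ _ _ → ≡.refl) g x) (coeff-* f g x))

convolve-cong : ∀ f {G H} → (∀ x → G x ≡ H x) → ∀ x → convolve f G x ≡ convolve f H x
convolve-cong [] h x = ≡.refl
convolve-cong ((e , c) ∷ f) h x = cong₂ ℚ._+_ (cong (c ℚ.*_) (h _)) (convolve-cong f h x)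

convolve-0 : ∀ f x → convolve f (λ _ → 0ℚ) x ≡ 0ℚ
convolve-0 [] x = ≡.refl
convolve-0 ((e , c) ∷ f) x = ≡.trans (cong₂ ℚ._+_ (ℚₚ.*-zeroʳ c) (convolve-0 f x)) (ℚₚ.+-identityˡ _)

convolve-+ : ∀ f G H x → convolve f (λ y → G y ℚ.+ H y) x ≡ convolve f G x ℚ.+ convolve f H x
convolve-+ [] G H x = ≡.sym (ℚₚ.+-identityˡ _)
convolve-+ ((e , c) ∷ f) G H x = ≡.trans (cong (c ℚ.* (G (x ℤ.- e) ℚ.+ H (x ℤ.- e)) ℚ.+_) (convolve-+ f G H x))
  (ℚS.solve 5 (λ c g h a b → c ℚS.:* (g ℚS.:+ h) ℚS.:+ (a ℚS.:+ b) ℚS.:= (c ℚS.:* g ℚS.:+ a) ℚS.:+ (c ℚS.:* h ℚS.:+ b)) ≡.refl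
    c (G (x ℤ.- e)) (H (x ℤ.- e)) (convolve f G x) (convolve f H x))

convolve-++ : ∀ f g G x → convolve (f ++ g) G x ≡ convolve f G x ℚ.+ convolve g G x
convolve-++ [] g G x = ≡.sym (ℚₚ.+-identityˡ _)
convolve-++ ((e , c) ∷ f) g G x = ≡.trans (cong (c ℚ.* G (x ℤ.- e) ℚ.+_) (convolve-++ f g G x)) (≡.sym (ℚₚ.+-assoc (c ℚ.* G (x ℤ.- e)) _ _))

convolve-single : ∀ g e c x → convolve g (single e c) x ≡ c ℚ.* coeff g (x ℤ.- e)
convolve-single [] e c x = ≡.sym (ℚₚ.*-zeroʳ c)
convolve-single ((e′ , c′) ∷ g) e c x = begin
    c′ ℚ.* single e c (x ℤ.- e′) ℚ.+ convolve g (single e c) x ≡⟨ cong₂ ℚ._+_ flip (convolve-single g e c x) ⟩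
    c ℚ.* single e′ c′ (x ℤ.- e) ℚ.+ c ℚ.* coeff g (x ℤ.- e) ≡⟨ ℚₚ.*-distribˡ-+ c _ _ ⟨
    c ℚ.* (single e′ c′ (x ℤ.- e) ℚ.+ coeff g (x ℤ.- e)) ≡⟨ cong (c ℚ.*_) (coeff-∷ e′ c′ g _) ⟨
    c ℚ.* coeff ((e′ , c′) ∷ g) (x ℤ.- e) ∎
  where
  open ≡.≡-Reasoning
  flip : c′ ℚ.* single e c (x ℤ.- e′) ≡ c ℚ.* single e′ c′ (x ℤ.- e)
  flip = ≡.trans (≡.sym (single-shift e′ e c′ c x)) (≡.trans (cong₂ (λ a b → single a b x) (ℤₚ.+-comm e′ e) (ℚₚ.*-comm c′ c)) (single-shift e e′ c c′ x))

convolve-comm : ∀ f g x → convolve f (coeff g) x ≡ convolve g (coeff f) x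
convolve-comm [] g x = ≡.sym (convolve-0 g x)
convolve-comm ((e , c) ∷ f) g x = begin
    c ℚ.* coeff g (x ℤ.- e) ℚ.+ convolve f (coeff g) x ≡⟨ cong₂ ℚ._+_ (≡.sym (convolve-single g e c x)) (convolve-comm f g x) ⟩
    convolve g (single e c) x ℚ.+ convolve g (coeff f) x ≡⟨ convolve-+ g _ _ x ⟨
    convolve g (λ y → single e c y ℚ.+ coeff f y) x ≡⟨ convolve-cong g (λ y → ≡.sym (coeff-∷ e c f y)) x ⟩
    convolve g (coeff ((e , c) ∷ f)) x ∎
  where open ≡.≡-Reasoning

convolve-map-shift : ∀ e c (h : ℤ × ℚ → ℤ × ℚ) → (∀ e′ c′ → h (e′ , c′) ≡ (e ℤ.+ e′ , c ℚ.* c′)) →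
  ∀ g G x → convolve (map h g) G x ≡ c ℚ.* convolve g G (x ℤ.- e)
convolve-map-shift e c h hyp [] G x = ≡.sym (ℚₚ.*-zeroʳ c)
convolve-map-shift e c h hyp ((e′ , c′) ∷ g) G x rewrite hyp e′ c′ = begin
    c ℚ.* c′ ℚ.* G (x ℤ.- (e ℤ.+ e′)) ℚ.+ convolve (map h g) G x
      ≡⟨ cong₂ ℚ._+_ (cong (λ y → c ℚ.* c′ ℚ.* G y) (ℤS.solve 3 (λ x e e′ → x :-ᶻ (e :+ᶻ e′) :=ᶻ x :-ᶻ e :-ᶻ e′) ≡.refl x e e′)) (convolve-map-shift e c h hyp g G x) ⟩
    c ℚ.* c′ ℚ.* G (x ℤ.- e ℤ.- e′) ℚ.+ c ℚ.* convolve g G (x ℤ.- e)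
      ≡⟨ ℚS.solve 4 (λ c c′ a b → c ℚS.:* c′ ℚS.:* a ℚS.:+ c ℚS.:* b ℚS.:= c ℚS.:* (c′ ℚS.:* a ℚS.:+ b)) ≡.refl c c′ (G (x ℤ.- e ℤ.- e′)) (convolve g G (x ℤ.- e)) ⟩
    c ℚ.* (c′ ℚ.* G (x ℤ.- e ℤ.- e′) ℚ.+ convolve g G (x ℤ.- e)) ∎
  where open ≡.≡-Reasoning

convolve-* : ∀ f g G x → convolve (f *L g) G x ≡ convolve f (convolve g G) x
convolve-* [] g G x = ≡.refl
convolve-* ((e , c) ∷ f) g G x = ≡.trans (convolve-++ (map _ g) (f *L g) G x)
  (cong₂ ℚ._+_ (convolve-map-shift e c _ (λ _ _ → ≡.refl) g G x) (convolve-* f g G x))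

*L-comm : ∀ f g → (f *L g) ≈L (g *L f)
*L-comm f g x = ≡.trans (coeff-* f g x) (≡.trans (convolve-comm f g x) (≡.sym (coeff-* g f x)))

*L-congˡ : ∀ f {g h} → g ≈L h → (f *L g) ≈L (f *L h)
*L-congˡ f {g} {h} p x = ≡.trans (coeff-* f g x) (≡.trans (convolve-cong f p x) (≡.sym (coeff-* f h x)))

-- The product recurses on the terms of its left factor and so depends on their listing;
-- commutativity moves that factor to the right, where only coefficients matter.
*L-cong : ∀ {f f′ g g′} → f ≈L f′ → g ≈L g′ → (f *L g) ≈L (f′ *L g′)
*L-cong {f} {f′} {g} {g′} p q x = ≡.trans (*L-congˡ f q x) (≡.trans (*L-comm f g′ x) (≡.trans (*L-congˡ g′ p x) (*L-comm g′ f′ x)))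

*L-assoc : ∀ f g h → ((f *L g) *L h) ≈L (f *L (g *L h))
*L-assoc f g h x = ≡.trans (coeff-* (f *L g) h x) (≡.trans (convolve-* f g (coeff h) x)
  (≡.trans (convolve-cong f (λ y → ≡.sym (coeff-* g h y)) x) (≡.sym (coeff-* f (g *L h) x))))

*L-distribˡ : ∀ f g h → (f *L (g +L h)) ≈L ((f *L g) +L (f *L h))
*L-distribˡ f g h x = begin
    coeff (f *L (g +L h)) x ≡⟨ coeff-* f (g +L h) x ⟩
    convolve f (coeff (g +L h)) x ≡⟨ convolve-cong f (coeff-++ g h) x ⟩
    convolve f (λ y → coeff g y ℚ.+ coeff h y) x ≡⟨ convolve-+ f _ _ x ⟩
    convolve f (coeff g) x ℚ.+ convolve f (coeff h) x ≡⟨ cong₂ ℚ._+_ (coeff-* f g x) (coeff-* f h x) ⟨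
    coeff (f *L g) x ℚ.+ coeff (f *L h) x ≡⟨ coeff-++ (f *L g) (f *L h) x ⟨
    coeff ((f *L g) +L (f *L h)) x ∎
  where open ≡.≡-Reasoning

+L-cong : ∀ {f f′ g g′} → f ≈L f′ → g ≈L g′ → (f +L g) ≈L (f′ +L g′)
+L-cong {f} {f′} {g} {g′} p q x = ≡.trans (coeff-++ f g x) (≡.trans (cong₂ ℚ._+_ (p x) (q x)) (≡.sym (coeff-++ f′ g′ x)))

*L-distribʳ : ∀ f g h → ((g +L h) *L f) ≈L ((g *L f) +L (h *L f))
*L-distribʳ f g h x = ≡.trans (*L-comm (g +L h) f x) (≡.trans (*L-distribˡ f g h x)
  (+L-cong {f *L g} {g *L f} {f *L h} {h *L f} (*L-comm f g) (*L-comm f h) x))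

oneL-identityˡ : ∀ f → (oneL *L f) ≈L f
oneL-identityˡ f x = ≡.trans (coeff-* oneL f x) (≡.trans (ℚₚ.+-identityʳ _) (≡.trans (ℚₚ.*-identityˡ _) (cong (coeff f) (ℤₚ.+-identityʳ x))))

+L-comm : ∀ f g → (f +L g) ≈L (g +L f)
+L-comm f g x = ≡.trans (coeff-++ f g x) (≡.trans (ℚₚ.+-comm (coeff f x) (coeff g x)) (≡.sym (coeff-++ g f x)))

-L-inverseˡ : ∀ f → ((-L f) +L f) ≈L []
-L-inverseˡ f x = ≡.trans (coeff-++ (-L f) f x) (≡.trans (cong (ℚ._+ coeff f x) (coeff-neg f x)) (ℚₚ.+-inverseˡ (coeff f x)))

laurentRing : CommutativeRing 0ℓ 0ℓ
laurentRing = record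
  { Carrier = LPoly ; _≈_ = _≈L_ ; _+_ = _+L_ ; _*_ = _*L_ ; -_ = -L_ ; 0# = [] ; 1# = oneL
  ; isCommutativeRing = record
    { isRing = record
      { +-isAbelianGroup = record
        { isGroup = record
          { isMonoid = record
            { isSemigroup = record
              { isMagma = record
                { isEquivalence = record { refl = λ _ → ≡.refl ; sym = λ p x → ≡.sym (p x) ; trans = λ p q x → ≡.trans (p x) (q x) }
                ; ∙-cong = λ {f} {f′} {g} {g′} → +L-cong {f} {f′} {g} {g′} }
              ; assoc = λ f g h x → ≡.trans (coeff-++ (f ++ g) h x) (≡.trans (cong (ℚ._+ coeff h x) (coeff-++ f g x))
                  (≡.trans (ℚₚ.+-assoc (coeff f x) _ _) (≡.sym (≡.trans (coeff-++ f (g ++ h) x) (cong (coeff f x ℚ.+_) (coeff-++ g h x)))))) }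
            ; identity = (λ f x → ≡.refl) , (λ f x → ≡.trans (coeff-++ f [] x) (ℚₚ.+-identityʳ _)) }
          ; inverse = -L-inverseˡ , (λ f x → ≡.trans (+L-comm f (-L f) x) (-L-inverseˡ f x))
          ; ⁻¹-cong = λ {f} {g} p x → ≡.trans (coeff-neg f x) (≡.trans (cong ℚ.-_ (p x)) (≡.sym (coeff-neg g x))) }
        ; comm = +L-comm }
      ; *-cong = λ {f} {f′} {g} {g′} → *L-cong {f} {f′} {g} {g′}
      ; *-assoc = *L-assoc
      ; *-identity = oneL-identityˡ , (λ f x → ≡.trans (*L-comm f oneL x) (oneL-identityˡ f x))
      ; distrib = *L-distribˡ , *L-distribʳ }
    ; *-comm = *L-comm } }

single-+ : ∀ e a b x → single e (a ℚ.+ b) x ≡ single e a x ℚ.+ single e b x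
single-+ e a b x with e ℤ.≟ x
... | yes _ = ≡.refl
... | no _ = ≡.refl

coeff-single : ∀ e c x → coeff ((e , c) ∷ []) x ≡ single e c x
coeff-single e c x = ≡.trans (coeff-∷ e c [] x) (ℚₚ.+-identityʳ _)

laurent : LaurentAlgebra
laurent = record
  { commutativeRing = laurentRing
  ; ι = constL
  ; ι-+ = λ a b x → ≡.trans (coeff-single 0ℤ (a ℚ.+ b) x) (≡.trans (single-+ 0ℤ a b x)
      (≡.sym (≡.trans (coeff-++ (constL a) (constL b) x) (cong₂ ℚ._+_ (coeff-single 0ℤ a x) (coeff-single 0ℤ b x)))))
  ; ι-* = λ a b x → ≡.refl
  ; ι-neg = λ a x → ≡.refl
  ; ι-0 = λ x → ≡.trans (coeff-single 0ℤ 0ℚ x) (single-0 x)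
  ; ι-1 = λ x → ≡.refl
  ; X = monoL
  ; X-+ = λ a b x → ≡.refl
  ; X-0 = λ x → ≡.refl
  }
  where
  single-0 : ∀ x → single 0ℤ 0ℚ x ≡ 0ℚ
  single-0 x with 0ℤ ℤ.≟ x
  ... | yes _ = ≡.refl
  ... | no _ = ≡.refl

-- Exact division and cancellation for Laurent polynomials, by degree bounds.

open Polynomials laurent using (horner; hf; hf-reverse; horner-reverse; divHF-spec)

VanishBelow VanishFrom : LPoly → ℤ → Set
VanishBelow h x = ∀ n → coeff h (x ℤ.- + suc n) ≡ 0ℚ
VanishFrom h x = ∀ n → coeff h (x ℤ.+ + n) ≡ 0ℚ

bounded : ∀ h → ∃ λ N → ∀ x → N ℕ.< ℤ.∣ x ∣ → coeff h x ≡ 0ℚ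
bounded [] = 0 , λ _ _ → ≡.refl
bounded ((e , c) ∷ h) = let (N , b) = bounded h in
  ℤ.∣ e ∣ ℕ.+ N , λ x l → ≡.trans (coeff-∷ e c h x) (≡.trans (cong₂ ℚ._+_
    (single-≢ e c (λ p → ℕₚ.<⇒≱ l (ℕₚ.≤-trans (ℕₚ.≤-reflexive (cong ℤ.∣_∣ (≡.sym p))) (ℕₚ.m≤m+n _ N))))
    (b x (ℕₚ.≤-<-trans (ℕₚ.m≤n+m N ℤ.∣ e ∣) l))) (ℚₚ.+-identityˡ 0ℚ))

vanishBelow-bounded : ∀ h → ∃ λ N → VanishBelow h (ℤ.- + N)
vanishBelow-bounded h = let (N , b) = bounded h in
  N , λ n → ≡.trans (cong (coeff h) (ℤS.solve 2 (λ N n → (:-ᶻ N) :-ᶻ n :=ᶻ :-ᶻ (N :+ᶻ n)) ≡.refl (+ N) (+ suc n)))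
    (b (ℤ.- + (N ℕ.+ suc n)) (ℕₚ.≤-trans (ℕₚ.m<m+n N ℕ.z<s) (ℕₚ.≤-reflexive (≡.sym (ℤₚ.∣-i∣≡∣i∣ (+ (N ℕ.+ suc n)))))))

vanishFrom-bounded : ∀ h → ∃ λ N → VanishFrom h (+ N)
vanishFrom-bounded h = let (N , b) = bounded h in suc N , λ n → b (+ (suc N ℕ.+ n)) (ℕ.s≤s (ℕₚ.m≤m+n N n))

vanishBelow-suc : ∀ h x → VanishBelow h x → coeff h x ≡ 0ℚ → VanishBelow h (x ℤ.+ 1ℤ)
vanishBelow-suc h x b e zero = ≡.trans (cong (coeff h) (ℤS.solve 1 (λ x → x :+ᶻ :1ᶻ :-ᶻ :1ᶻ :=ᶻ x) ≡.refl x)) e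
vanishBelow-suc h x b e (suc n) = ≡.trans (cong (coeff h) (ℤS.solve 2 (λ x n → x :+ᶻ :1ᶻ :-ᶻ (:1ᶻ :+ᶻ n) :=ᶻ x :-ᶻ n) ≡.refl x (+ suc n))) (b n)

vanishFrom-pred : ∀ h k → VanishFrom h (+ suc k) → coeff h (+ k) ≡ 0ℚ → VanishFrom h (+ k)
vanishFrom-pred h k b e zero = ≡.trans (cong (λ n → coeff h (+ n)) (ℕₚ.+-identityʳ k)) e
vanishFrom-pred h k b e (suc n) = ≡.trans (cong (λ n → coeff h (+ n)) (ℕₚ.+-suc k n)) (b n)

coeff-scale : ∀ c f x → coeff (constL c *L f) x ≡ c ℚ.* coeff f x
coeff-scale c f x = ≡.trans (coeff-* (constL c) f x) (≡.trans (ℚₚ.+-identityʳ _) (cong (λ y → c ℚ.* coeff f y) (ℤₚ.+-identityʳ x)))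

coeff-shift : ∀ d f x → coeff (monoL d *L f) x ≡ coeff f (x ℤ.- d)
coeff-shift d f x = ≡.trans (coeff-* (monoL d) f x) (≡.trans (ℚₚ.+-identityʳ _) (ℚₚ.*-identityˡ _))

coeff-horner-∷ : ∀ a p h x → coeff (horner (a ∷ p) *L h) x ≡ fromℤ a ℚ.* coeff h x ℚ.+ coeff (horner p *L h) (x ℤ.- 1ℤ)
coeff-horner-∷ a p h x = begin
    coeff (horner (a ∷ p) *L h) x ≡⟨ *L-distribʳ h (constL (fromℤ a)) (monoL 1ℤ *L horner p) x ⟩
    coeff ((constL (fromℤ a) *L h) +L ((monoL 1ℤ *L horner p) *L h)) x ≡⟨ coeff-++ (constL (fromℤ a) *L h) _ x ⟩
    coeff (constL (fromℤ a) *L h) x ℚ.+ coeff ((monoL 1ℤ *L horner p) *L h) x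
      ≡⟨ cong₂ ℚ._+_ (coeff-scale (fromℤ a) h x) (≡.trans (*L-assoc (monoL 1ℤ) (horner p) h x) (coeff-shift 1ℤ (horner p *L h) x)) ⟩
    fromℤ a ℚ.* coeff h x ℚ.+ coeff (horner p *L h) (x ℤ.- 1ℤ) ∎
  where open ≡.≡-Reasoning

horner-vanishBelow : ∀ p h x → VanishBelow h x → VanishBelow (horner p *L h) x
horner-vanishBelow [] h x b n = ≡.refl
horner-vanishBelow (a ∷ p) h x b n = ≡.trans (coeff-horner-∷ a p h _) (≡.trans (cong₂ ℚ._+_
    (≡.trans (cong (fromℤ a ℚ.*_) (b n)) (ℚₚ.*-zeroʳ (fromℤ a)))
    (≡.trans (cong (coeff (horner p *L h)) (ℤS.solve 2 (λ x n → x :-ᶻ n :-ᶻ :1ᶻ :=ᶻ x :-ᶻ (:1ᶻ :+ᶻ n)) ≡.refl x (+ suc n)))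
      (horner-vanishBelow p h x b (suc n))))
  (ℚₚ.+-identityˡ 0ℚ))

coeff-lowest : ∀ a p h x → VanishBelow h x → coeff (horner (a ∷ p) *L h) x ≡ fromℤ a ℚ.* coeff h x
coeff-lowest a p h x b = ≡.trans (coeff-horner-∷ a p h x) (≡.trans (cong (fromℤ a ℚ.* coeff h x ℚ.+_) (horner-vanishBelow p h x b 0)) (ℚₚ.+-identityʳ _))

coeff-hf-∷ : ∀ a as h x → coeff (hf (a ∷ as) *L h) x ≡ fromℤ a ℚ.* coeff h (x ℤ.- + length as) ℚ.+ coeff (hf as *L h) x
coeff-hf-∷ a as h x = begin
    coeff (hf (a ∷ as) *L h) x ≡⟨ *L-distribʳ h (constL (fromℤ a) *L monoL (+ length as)) (hf as) x ⟩
    coeff (((constL (fromℤ a) *L monoL (+ length as)) *L h) +L (hf as *L h)) x ≡⟨ coeff-++ ((constL (fromℤ a) *L monoL (+ length as)) *L h) _ x ⟩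
    coeff ((constL (fromℤ a) *L monoL (+ length as)) *L h) x ℚ.+ coeff (hf as *L h) x
      ≡⟨ cong (ℚ._+ coeff (hf as *L h) x) (≡.trans (*L-assoc (constL (fromℤ a)) (monoL (+ length as)) h x)
           (≡.trans (coeff-scale (fromℤ a) (monoL (+ length as) *L h) x) (cong (fromℤ a ℚ.*_) (coeff-shift (+ length as) h x)))) ⟩
    fromℤ a ℚ.* coeff h (x ℤ.- + length as) ℚ.+ coeff (hf as *L h) x ∎
  where open ≡.≡-Reasoning

hf-vanishFrom : ∀ as h x → VanishFrom h (x ℤ.+ 1ℤ) → VanishFrom (hf as *L h) (x ℤ.+ + length as)
hf-vanishFrom [] h x b n = ≡.refl
hf-vanishFrom (a ∷ as) h x b n = ≡.trans (coeff-hf-∷ a as h _) (≡.trans (cong₂ ℚ._+_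
    (≡.trans (cong (fromℤ a ℚ.*_) (≡.trans (cong (coeff h) (ℤS.solve 3 (λ x l n → x :+ᶻ (:1ᶻ :+ᶻ l) :+ᶻ n :-ᶻ l :=ᶻ x :+ᶻ :1ᶻ :+ᶻ n) ≡.refl x (+ length as) (+ n))) (b n))) (ℚₚ.*-zeroʳ (fromℤ a)))
    (≡.trans (cong (coeff (hf as *L h)) (ℤS.solve 3 (λ x l n → x :+ᶻ (:1ᶻ :+ᶻ l) :+ᶻ n :=ᶻ x :+ᶻ l :+ᶻ (:1ᶻ :+ᶻ n)) ≡.refl x (+ length as) (+ n)))
      (hf-vanishFrom as h x b (suc n))))
  (ℚₚ.+-identityˡ 0ℚ))

coeff-highest : ∀ bt h x → VanishFrom h (x ℤ.+ 1ℤ) → coeff (hf (+ 1 ∷ bt) *L h) (x ℤ.+ + length bt) ≡ coeff h x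
coeff-highest bt h x b = ≡.trans (coeff-hf-∷ (+ 1) bt h _) (≡.trans (cong₂ ℚ._+_
    (≡.trans (ℚₚ.*-identityˡ _) (cong (coeff h) (ℤS.solve 2 (λ x l → x :+ᶻ l :-ᶻ l :=ᶻ x) ≡.refl x (+ length bt))))
    (≡.trans (cong (coeff (hf bt *L h)) (≡.sym (ℤₚ.+-identityʳ _))) (hf-vanishFrom bt h x b 0)))
  (ℚₚ.+-identityʳ _))

coeff-hf-list : ∀ a as x → coeff (hf (a ∷ as)) x ≡ fromℤ a ℚ.* single (+ length as) 1ℚ x ℚ.+ coeff (hf as) x
coeff-hf-list a as x = ≡.trans (coeff-++ (constL (fromℤ a) *L monoL (+ length as)) (hf as) x)
  (cong (ℚ._+ coeff (hf as) x) (≡.trans (coeff-scale (fromℤ a) (monoL (+ length as)) x) (cong (fromℤ a ℚ.*_) (coeff-single (+ length as) 1ℚ x))))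

hf-outside : ∀ as x → (∀ k → k ℕ.< length as → + k ≢ x) → coeff (hf as) x ≡ 0ℚ
hf-outside [] x out = ≡.refl
hf-outside (a ∷ as) x out = ≡.trans (coeff-hf-list a as x) (≡.trans (cong₂ ℚ._+_
    (≡.trans (cong (fromℤ a ℚ.*_) (single-≢ _ 1ℚ (out (length as) (ℕₚ.n<1+n _)))) (ℚₚ.*-zeroʳ (fromℤ a)))
    (hf-outside as x (λ k l → out k (ℕₚ.<-trans l (ℕₚ.n<1+n _)))))
  (ℚₚ.+-identityˡ 0ℚ))

unit-cancel : ∀ {a} r x → a ℚ.* r ≡ 1ℚ → a ℚ.* x ≡ 0ℚ → x ≡ 0ℚ
unit-cancel {a} r x u e = begin
    x ≡⟨ ℚₚ.*-identityˡ x ⟨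
    1ℚ ℚ.* x ≡⟨ cong (ℚ._* x) u ⟨
    a ℚ.* r ℚ.* x ≡⟨ ℚS.solve 3 (λ a r x → a ℚS.:* r ℚS.:* x ℚS.:= r ℚS.:* (a ℚS.:* x)) ≡.refl a r x ⟩
    r ℚ.* (a ℚ.* x) ≡⟨ cong (r ℚ.*_) e ⟩
    r ℚ.* 0ℚ ≡⟨ ℚₚ.*-zeroʳ r ⟩
    0ℚ ∎
  where open ≡.≡-Reasoning

-- The leading coefficient of the divisor forces h to vanish in degrees ≥ 0, its constant coefficient in degrees < 0.
small-multiple-vanishes : ∀ b bt rem h → HeadUnit b → hf (+ 1 ∷ bt) ≈L horner b → length rem ℕ.≤ length bt →
  (horner b *L h) ≈L hf rem → ∀ x → coeff h x ≡ 0ℚ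
small-multiple-vanishes (b₀ ∷ b) bt rem h (r , unit) same l e = λ where
    (+ k) → nonneg k
    -[1+ k ] → neg k
  where
  down : ∀ k → VanishFrom h (+ suc k) → VanishFrom h (+ k)
  down k v = vanishFrom-pred h k v (≡.trans (≡.sym (coeff-highest bt h (+ k) (λ n → ≡.trans (cong (λ y → coeff h (+ y ℤ.+ + n)) (ℕₚ.+-comm k 1)) (v n))))
    (≡.trans (*L-cong {hf (+ 1 ∷ bt)} {horner (b₀ ∷ b)} {h} {h} same (λ _ → ≡.refl) _)
      (≡.trans (e _) (hf-outside rem _ (λ j j<l → λ p → ℕₚ.<⇒≱ j<l (ℕₚ.≤-trans l (ℕₚ.≤-trans (ℕₚ.m≤n+m _ k) (ℕₚ.≤-reflexive (≡.sym (ℤₚ.+-injective p))))))))))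
  fallTo : ∀ N → VanishFrom h (+ N) → VanishFrom h 0ℤ
  fallTo zero v = v
  fallTo (suc N) v = fallTo N (down N v)
  nonneg : ∀ k → coeff h (+ k) ≡ 0ℚ
  nonneg k = let (N , v) = vanishFrom-bounded h in fallTo N v k
  up : ∀ k → VanishBelow h (ℤ.- + suc k) → VanishBelow h (ℤ.- + k)
  up k v n = ≡.trans (cong (coeff h) (cong (ℤ._- + suc n) (ℤS.solve 1 (λ k → :-ᶻ k :=ᶻ :-ᶻ (:1ᶻ :+ᶻ k) :+ᶻ :1ᶻ) ≡.refl (+ k))))
    (vanishBelow-suc h (ℤ.- + suc k) v (unit-cancel {fromℤ b₀} r _ unit (≡.trans (≡.sym (coeff-lowest b₀ b h (ℤ.- + suc k) v))
      (≡.trans (e (ℤ.- + suc k)) (hf-outside rem (ℤ.- + suc k) (λ _ _ ()))))) n)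
  riseTo : ∀ N → VanishBelow h (ℤ.- + N) → VanishBelow h 0ℤ
  riseTo zero v = v
  riseTo (suc N) v = riseTo N (up N v)
  neg : ∀ k → coeff h -[1+ k ] ≡ 0ℚ
  neg k = let (N , v) = vanishBelow-bounded h in ≡.trans (cong (coeff h) (≡.sym (ℤₚ.+-identityˡ -[1+ k ]))) (riseTo N v k)

-- For the computed quotient Q, b (c - Q) is the remainder, too short to be a nonzero multiple of b;
-- hence c = Q.
zdivMonic-exact : ∀ {n} a b c → Monic n b → HeadUnit b → (horner b *L c) ≈L horner a → horner (zdivMonic a b) ≈L c
zdivMonic-exact a b c mb hb e x =
  let (bt , eb) = monic-reverse mb
      A = reverse a
      (rem , l , spec) = divHF-spec (length a) A bt (ℕₚ.≤-reflexive (Listₚ.length-reverse a))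
      Q = divHF (length a) A bt
      same : hf (+ 1 ∷ bt) ≈L horner b
      same y = ≡.trans (cong (λ l → coeff (hf l) y) (≡.sym eb)) (hf-reverse b y)
      h = c -L hf Q
      multiple : (horner b *L h) ≈L hf rem
      multiple y = begin
        coeff (horner b *L h) y ≡⟨ *L-distribˡ (horner b) c (-L hf Q) y ⟩
        coeff ((horner b *L c) +L (horner b *L (-L hf Q))) y ≡⟨ coeff-++ (horner b *L c) _ y ⟩
        coeff (horner b *L c) y ℚ.+ coeff (horner b *L (-L hf Q)) y
          ≡⟨ cong₂ ℚ._+_ (≡.trans (e y) (≡.trans (≡.sym (hf-reverse a y)) (≡.trans (spec y) (coeff-++ (hf (+ 1 ∷ bt) *L hf Q) (hf rem) y))))
               (≡.trans (neg-*ʳ (horner b) (hf Q) y) (cong ℚ.-_ (*L-cong {horner b} {hf (+ 1 ∷ bt)} {hf Q} {hf Q} (λ z → ≡.sym (same z)) (λ _ → ≡.refl) y))) ⟩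
        coeff (hf (+ 1 ∷ bt) *L hf Q) y ℚ.+ coeff (hf rem) y ℚ.+ (ℚ.- coeff (hf (+ 1 ∷ bt) *L hf Q) y)
          ≡⟨ ℚS.solve 2 (λ u v → u ℚS.:+ v ℚS.:+ (ℚS.:- u) ℚS.:= v) ≡.refl (coeff (hf (+ 1 ∷ bt) *L hf Q) y) (coeff (hf rem) y) ⟩
        coeff (hf rem) y ∎
  in ≡.trans (cong (λ l → coeff (horner l) x) (zdivMonic-unfold a b eb)) (≡.trans (horner-reverse Q x)
       (difference-0 c (hf Q) x (small-multiple-vanishes b bt rem h hb same l multiple x)))
  where
  open ≡.≡-Reasoning
  neg-*ʳ : ∀ f g y → coeff (f *L (-L g)) y ≡ ℚ.- coeff (f *L g) y
  neg-*ʳ f g y = ≡.trans (*L-comm f (-L g) y) (≡.trans (neg-*ˡ y) (cong ℚ.-_ (*L-comm g f y)))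
    where
    neg-*ˡ : ∀ y → coeff ((-L g) *L f) y ≡ ℚ.- coeff (g *L f) y
    neg-*ˡ y = ≡.trans (≡.sym (LR.-‿distribˡ-* g f y)) (coeff-neg (g *L f) y)
      where module LR = Kit laurent
  difference-0 : ∀ f g x → coeff (f -L g) x ≡ 0ℚ → coeff g x ≡ coeff f x
  difference-0 f g x z = begin
    coeff g x ≡⟨ ℚS.solve 2 (λ f g → g ℚS.:= f ℚS.:- (f ℚS.:+ (ℚS.:- g))) ≡.refl (coeff f x) (coeff g x) ⟩
    coeff f x ℚ.- (coeff f x ℚ.+ (ℚ.- coeff g x)) ≡⟨ cong (λ u → coeff f x ℚ.- u) (≡.trans (cong (coeff f x ℚ.+_) (≡.sym (coeff-neg g x))) (≡.trans (≡.sym (coeff-++ f (-L g) x)) z)) ⟩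
    coeff f x ℚ.- 0ℚ ≡⟨ ℚₚ.+-identityʳ _ ⟩
    coeff f x ∎

-- Constant coefficients of the two polynomials multiply to that of q^(n+1) - 1, which is -1; minus
-- the constant coefficient of r is the inverse.
headUnit-factor : ∀ p r n → (horner p *L horner r) ≈L (monoL (+ suc n) -L oneL) → HeadUnit p
headUnit-factor [] r n e with () ← e 0ℤ
headUnit-factor (a ∷ p) r n e = ℚ.- coeff (horner r) 0ℤ , (begin
    fromℤ a ℚ.* (ℚ.- coeff (horner r) 0ℤ) ≡⟨ ℚₚ.neg-distribʳ-* (fromℤ a) _ ⟨
    ℚ.- (fromℤ a ℚ.* coeff (horner r) 0ℤ) ≡⟨ cong ℚ.-_ (≡.trans (≡.sym (coeff-lowest a p (horner r) 0ℤ below)) (e 0ℤ)) ⟩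
    1ℚ ∎)
  where
  open ≡.≡-Reasoning
  below : VanishBelow (horner r) 0ℤ
  below n = ≡.trans (≡.sym (hf-reverse r _)) (hf-outside (reverse r) (0ℤ ℤ.- + suc n) (λ _ _ ()))

-- The coefficients of f - g have period k + 1 and vanish far below, hence, climbing upward,
-- everywhere.
oneMinusX-cancel : ∀ k f g → ((oneL -L monoL (+ suc k)) *L f) ≈L ((oneL -L monoL (+ suc k)) *L g) → f ≈L g
oneMinusX-cancel k f g e x = ≡.trans (≡.sym (subtract x)) (≡.trans (cong (ℚ._+ coeff g x) (allZero x)) (ℚₚ.+-identityˡ _))
  where
  open ≡.≡-Reasoning
  d = + suc k
  h = f -L g
  expand : ∀ f x → coeff ((oneL -L monoL d) *L f) x ≡ coeff f x ℚ.- coeff f (x ℤ.- d)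
  expand f x = ≡.trans (coeff-* (oneL -L monoL d) f x) (≡.trans (cong (λ y → 1ℚ ℚ.* coeff f y ℚ.+ ((ℚ.- 1ℚ) ℚ.* coeff f (x ℤ.- d) ℚ.+ 0ℚ)) (ℤₚ.+-identityʳ x))
    (ℚS.solve 2 (λ u v → ℚS.con 1ℚ ℚS.:* u ℚS.:+ (ℚS.con (ℚ.- 1ℚ) ℚS.:* v ℚS.:+ ℚS.con 0ℚ) ℚS.:= u ℚS.:- v) ≡.refl (coeff f x) (coeff f (x ℤ.- d))))
  coeff-h : ∀ x → coeff h x ≡ coeff f x ℚ.- coeff g x
  coeff-h x = ≡.trans (coeff-++ f (-L g) x) (cong (coeff f x ℚ.+_) (coeff-neg g x))
  subtract : ∀ x → coeff h x ℚ.+ coeff g x ≡ coeff f x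
  subtract x = ≡.trans (cong (ℚ._+ coeff g x) (coeff-h x)) (ℚS.solve 2 (λ f g → f ℚS.:- g ℚS.:+ g ℚS.:= f) ≡.refl (coeff f x) (coeff g x))
  periodic : ∀ x → coeff h x ≡ coeff h (x ℤ.- d)
  periodic x = begin
    coeff h x ≡⟨ coeff-h x ⟩
    coeff f x ℚ.- coeff g x
      ≡⟨ ℚS.solve 4 (λ a b c d → a ℚS.:- c ℚS.:= (a ℚS.:- b) ℚS.:- (c ℚS.:- d) ℚS.:+ (b ℚS.:- d)) ≡.refl
           (coeff f x) (coeff f (x ℤ.- d)) (coeff g x) (coeff g (x ℤ.- d)) ⟩
    (coeff f x ℚ.- coeff f (x ℤ.- d)) ℚ.- (coeff g x ℚ.- coeff g (x ℤ.- d)) ℚ.+ (coeff f (x ℤ.- d) ℚ.- coeff g (x ℤ.- d))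
      ≡⟨ cong (λ u → u ℚ.- (coeff g x ℚ.- coeff g (x ℤ.- d)) ℚ.+ (coeff f (x ℤ.- d) ℚ.- coeff g (x ℤ.- d))) (≡.trans (≡.sym (expand f x)) (≡.trans (e x) (expand g x))) ⟩
    (coeff g x ℚ.- coeff g (x ℤ.- d)) ℚ.- (coeff g x ℚ.- coeff g (x ℤ.- d)) ℚ.+ (coeff f (x ℤ.- d) ℚ.- coeff g (x ℤ.- d))
      ≡⟨ ℚS.solve 2 (λ u v → u ℚS.:- u ℚS.:+ v ℚS.:= v) ≡.refl (coeff g x ℚ.- coeff g (x ℤ.- d)) (coeff f (x ℤ.- d) ℚ.- coeff g (x ℤ.- d)) ⟩
    coeff f (x ℤ.- d) ℚ.- coeff g (x ℤ.- d) ≡⟨ coeff-h (x ℤ.- d) ⟨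
    coeff h (x ℤ.- d) ∎
  below : ∀ N → VanishBelow h (ℤ.- + N) → ∀ n → VanishBelow h (ℤ.- + N ℤ.+ + n)
  below N v zero m = ≡.trans (cong (λ y → coeff h (y ℤ.- + suc m)) (ℤₚ.+-identityʳ (ℤ.- + N))) (v m)
  below N v (suc n) = λ m → ≡.trans (cong (λ y → coeff h (y ℤ.- + suc m)) (ℤS.solve 2 (λ N n → :-ᶻ N :+ᶻ (:1ᶻ :+ᶻ n) :=ᶻ :-ᶻ N :+ᶻ n :+ᶻ :1ᶻ) ≡.refl (+ N) (+ n)))
    (vanishBelow-suc h (ℤ.- + N ℤ.+ + n) (below N v n) (≡.trans (periodic _) (below N v n k)) m)
  allZero : ∀ x → coeff h x ≡ 0ℚ
  allZero (+ a) = let (N , v) = vanishBelow-bounded h in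
    ≡.trans (cong (coeff h) (ℤS.solve 2 (λ N a → a :=ᶻ (:-ᶻ N) :+ᶻ (N :+ᶻ (:1ᶻ :+ᶻ a)) :-ᶻ :1ᶻ) ≡.refl (+ N) (+ a))) (below N v (N ℕ.+ suc a) 0)
  allZero -[1+ a ] = let (N , v) = vanishBelow-bounded h in
    ≡.trans (cong (coeff h) (ℤS.solve 2 (λ N a → (:-ᶻ a) :=ᶻ (:-ᶻ N) :+ᶻ N :-ᶻ a) ≡.refl (+ N) (+ suc a))) (below N v N a)

-- Identification with the q-binomials of the statement.

open QBinomial laurent using (gauss)

-- The local function of fromZPoly has no name outside Defs; it is recovered here by unification.
mutual
  terms : ℤ → ZPoly → LPoly
  terms = _

  fromZPoly-terms : ∀ p → fromZPoly p ≡ terms 0ℤ p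
  -- Abstracting the initial exponent makes it a variable, so that unification determines `terms` at
  -- every exponent and not only at 0.
  fromZPoly-terms p with + 0
  ... | e = ≡.refl

terms-horner : ∀ e p x → coeff (terms e p) x ≡ coeff (horner p) (x ℤ.- e)
terms-horner e [] x = ≡.refl
terms-horner e (a ∷ p) x = begin
    coeff ((e , fromℤ a) ∷ terms (ℤ.suc e) p) x ≡⟨ coeff-∷ e (fromℤ a) (terms (ℤ.suc e) p) x ⟩
    single e (fromℤ a) x ℚ.+ coeff (terms (ℤ.suc e) p) x ≡⟨ cong₂ ℚ._+_ head tail ⟩
    coeff (constL (fromℤ a)) (x ℤ.- e) ℚ.+ coeff (monoL 1ℤ *L horner p) (x ℤ.- e) ≡⟨ coeff-++ (constL (fromℤ a)) (monoL 1ℤ *L horner p) (x ℤ.- e) ⟨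
    coeff (horner (a ∷ p)) (x ℤ.- e) ∎
  where
  open ≡.≡-Reasoning
  head : single e (fromℤ a) x ≡ coeff (constL (fromℤ a)) (x ℤ.- e)
  head = ≡.trans (cong₂ (λ y c → single y c x) (≡.sym (ℤₚ.+-identityʳ e)) (≡.sym (ℚₚ.*-identityˡ (fromℤ a))))
    (≡.trans (single-shift e 0ℤ 1ℚ (fromℤ a) x) (≡.trans (ℚₚ.*-identityˡ _) (≡.sym (coeff-single 0ℤ (fromℤ a) (x ℤ.- e)))))
  tail : coeff (terms (ℤ.suc e) p) x ≡ coeff (monoL 1ℤ *L horner p) (x ℤ.- e)
  tail = ≡.trans (terms-horner (ℤ.suc e) p x) (≡.trans (cong (coeff (horner p)) (ℤS.solve 2 (λ x e → x :-ᶻ (:1ᶻ :+ᶻ e) :=ᶻ x :-ᶻ e :-ᶻ :1ᶻ) ≡.refl x e))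
    (≡.sym (coeff-shift 1ℤ (horner p) (x ℤ.- e))))

fromZPoly-horner : ∀ p → fromZPoly p ≈L horner p
fromZPoly-horner p x = ≡.trans (cong (λ f → coeff f x) (fromZPoly-terms p)) (≡.trans (terms-horner 0ℤ p x) (cong (coeff (horner p)) (ℤₚ.+-identityʳ x)))

qbinom-gauss : ∀ n k → k ℕ.≤ n → fromZPoly (qbinom n k) ≈L gauss n k
qbinom-gauss n k k≤n x = ≡.trans (fromZPoly-horner (qbinom n k) x)
  (zdivMonic-exact (qfact n) (zmul (qfact k) (qfact (n ℕ.∸ k))) (gauss n k) (proj₂ (proj₁ good)) (proj₂ good)
    (Polynomials.gauss-division laurent n k k≤n) x)
  where good = good-zmul (good-qfact k) (good-qfact (n ℕ.∸ k))

-- The substitution of q^d for q.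

coeff-substPow : ∀ D f e → coeff (substPow (+ suc D) f) (+ suc D ℤ.* e) ≡ coeff f e
coeff-substPow D [] e = ≡.refl
coeff-substPow D ((e′ , c) ∷ f) e with e′ ℤ.≟ e | (+ suc D ℤ.* e′) ℤ.≟ (+ suc D ℤ.* e)
... | yes _ | yes _ = cong (c ℚ.+_) (coeff-substPow D f e)
... | yes p | no ne = ⊥-elim (ne (cong (+ suc D ℤ.*_) p))
... | no ne | yes p = ⊥-elim (ne (ℤₚ.*-cancelˡ-≡ (+ suc D) e′ e p))
... | no _ | no _ = coeff-substPow D f e

coeff-substPow-0 : ∀ D f x → (∀ e → + suc D ℤ.* e ≢ x) → coeff (substPow (+ suc D) f) x ≡ 0ℚ
coeff-substPow-0 D [] x ne = ≡.refl
coeff-substPow-0 D ((e , c) ∷ f) x ne with (+ suc D ℤ.* e) ℤ.≟ x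
... | yes p = ⊥-elim (ne e p)
... | no _ = coeff-substPow-0 D f x ne

-- `substPow` acts on lists of terms. Multiplying exponents by a positive factor is injective, so
-- each coefficient of the result is a coefficient of the original or 0.
substPow-cong : ∀ D f g → f ≈L g → substPow (+ suc D) f ≈L substPow (+ suc D) g
substPow-cong D f g h x with (+ suc D) ℤ∣.∣? x
... | yes (ℤ∣.divides e p) rewrite ≡.trans p (ℤₚ.*-comm e (+ suc D)) =
  ≡.trans (coeff-substPow D f e) (≡.trans (h e) (≡.sym (coeff-substPow D g e)))
... | no ¬d = ≡.trans (coeff-substPow-0 D f x notMultiple) (≡.sym (coeff-substPow-0 D g x notMultiple))
  where
  notMultiple : ∀ e → + suc D ℤ.* e ≢ x
  notMultiple e p = ¬d (ℤ∣.divides e (≡.trans (≡.sym p) (ℤₚ.*-comm (+ suc D) e)))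

map-swap : ∀ {A B : Set} {s : A → B} {h : A → A} {h′ : B → B} → (∀ y → s (h y) ≡ h′ (s y)) → ∀ g → map s (map h g) ≡ map h′ (map s g)
map-swap e [] = ≡.refl
map-swap e (y ∷ g) = cong₂ _∷_ (e y) (map-swap e g)

substPow-* : ∀ d f g → substPow d (f *L g) ≡ substPow d f *L substPow d g
substPow-* d [] g = ≡.refl
substPow-* d ((e , c) ∷ f) g = ≡.trans (Listₚ.map-++ _ (map _ g) (f *L g))
  (cong₂ _++_ (map-swap (λ { (e′ , c′) → cong (_, c ℚ.* c′) (ℤₚ.*-distribˡ-+ d e e′) }) g) (substPow-* d f g))

substPow-pow : ∀ d f n → substPow d (powL f n) ≡ powL (substPow d f) n
substPow-pow d f zero = cong (λ e → (e , 1ℚ) ∷ []) (ℤₚ.*-zeroʳ d)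
substPow-pow d f (suc n) = ≡.trans (substPow-* d f (powL f n)) (cong (substPow d f *L_) (substPow-pow d f n))

substPow-gauss : ∀ d n k → substPow d (gauss n k) ≡ QBinomial.gauss (rebase d laurent) n k
substPow-gauss d n zero = cong (λ e → (e , 1ℚ) ∷ []) (ℤₚ.*-zeroʳ d)
substPow-gauss d zero (suc k) = ≡.refl
substPow-gauss d (suc n) (suc k) = ≡.trans (Listₚ.map-++ _ (monoL (+ suc k) *L gauss n (suc k)) (gauss n k))
  (cong₂ _++_ (≡.trans (substPow-* d (monoL (+ suc k)) (gauss n (suc k))) (cong (monoL (d ℤ.* + suc k) *L_) (substPow-gauss d n (suc k)))) (substPow-gauss d n k))

substPow-sum : ∀ d (f : ℕ → LPoly) ks → substPow d (sumL (map f ks)) ≡ sumL (map (λ k → substPow d (f k)) ks)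
substPow-sum d f [] = ≡.refl
substPow-sum d f (k ∷ ks) = ≡.trans (Listₚ.map-++ _ (f k) (sumL (map f ks))) (cong (substPow d (f k) ++_) (substPow-sum d f ks))

record _≡_[mod_] (a b m : ℤ) : Set where
  constructor _,_
  field
    quotient : ℤ
    equality : a ≡ b ℤ.+ m ℤ.* quotient

mod-refl : ∀ {m} a → a ≡ a [mod m ]
mod-refl {m} a = 0ℤ , ≡.sym (≡.trans (cong (λ z → a ℤ.+ z) (ℤₚ.*-zeroʳ m)) (ℤₚ.+-identityʳ a))

mod-* : ∀ {m a b c d} → a ≡ b [mod m ] → c ≡ d [mod m ] → (a ℤ.* c) ≡ (b ℤ.* d) [mod m ]
mod-* {m} {b = b} {d = d} (y , p) (z , q) = y ℤ.* d ℤ.+ b ℤ.* z ℤ.+ m ℤ.* y ℤ.* z , ≡.trans (cong₂ ℤ._*_ p q)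
  (ℤS.solve 5 (λ m b d y z → (b :+ᶻ m :*ᶻ y) :*ᶻ (d :+ᶻ m :*ᶻ z) :=ᶻ b :*ᶻ d :+ᶻ m :*ᶻ (y :*ᶻ d :+ᶻ b :*ᶻ z :+ᶻ m :*ᶻ y :*ᶻ z)) ≡.refl m b d y z)

mod-+ : ∀ {m a b c d} → a ≡ b [mod m ] → c ≡ d [mod m ] → (a ℤ.+ c) ≡ (b ℤ.+ d) [mod m ]
mod-+ {m} {b = b} {d = d} (y , p) (z , q) = y ℤ.+ z , ≡.trans (cong₂ ℤ._+_ p q)
  (ℤS.solve 5 (λ m b d y z → b :+ᶻ m :*ᶻ y :+ᶻ (d :+ᶻ m :*ᶻ z) :=ᶻ b :+ᶻ d :+ᶻ m :*ᶻ (y :+ᶻ z)) ≡.refl m b d y z)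

mod-^ : ∀ {m a b} i → a ≡ b [mod m ] → (a ℤ.^ i) ≡ (b ℤ.^ i) [mod m ]
mod-^ zero h = mod-refl 1ℤ
mod-^ (suc i) h = mod-* h (mod-^ i h)

-- Integer polynomials respect congruences. With nm congruent to 0 and k to its residue r, this
-- gives α(nm, k) ≡ α(0, r) = r² modulo m.
evalBi-mod : ∀ α {m a b c d} → a ≡ b [mod m ] → c ≡ d [mod m ] → evalBi α a c ≡ evalBi α b d [mod m ]
evalBi-mod [] p q = mod-refl 0ℤ
evalBi-mod ((i , j , c) ∷ α) p q = mod-+ (mod-* (mod-* (mod-refl c) (mod-^ i p)) (mod-^ j q)) (evalBi-mod α p q)

-- The modulus Φ_m³ and the theorem.

module Modulus (M : ℕ) where
  m : ℕ
  m = suc M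

  F φ : LPoly
  F = fromZPoly (cyclo m)
  φ = powL F 3

  open Modulo laurent φ using (quotient; congruent; lift; φ≈0; gauss-quotient; blockProduct-quotient)
  open Kit quotient
  open NilpotentUnits quotient
  module C = Cyclotomic laurent oneMinusX-cancel zdivMonic-exact headUnit-factor
  open C.Cyclotomic (C.cyclotomic M)

  F≈Φ : F ≈ C.Φ m
  F≈Φ = lift (fromZPoly-horner (cyclo m))

  t : Carrier
  t = X (+ m) - 1#

  t³≈0 : t * (t * t) ≈ 0#
  t³≈0 = cube-of-multiple F (C.Φ m) t (C.divisorProduct m M) φ≈0 F≈Φ (lift product)

  units : ∀ r → r ℕ.< M → IsUnit (1# - X (+ suc r))
  units r r<M = let (u , v , h) = coprime (suc r) (λ d → ℕₚ.<⇒≱ (ℕ.s≤s r<M) (∣⇒≤ d)) in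
    unit-modulo-nilpotent F (C.Φ m) (X (+ suc r)) u v φ≈0 F≈Φ (lift h)

  private module B = BlockProducts

  -- Proved for Laurent polynomials, where 1 - q^m can be cancelled, and then read in the quotient,
  -- where it cannot.
  factors : ∀ k l → QBinomial.gauss quotient ((k ℕ.+ l) ℕ.* m) (k ℕ.* m) *
    (B.blockProduct quotient M k * B.blockProduct quotient M l) ≈ B.blockProduct quotient M (k ℕ.+ l)
  factors k l = ≡.subst₂ (λ G P → G * P ≈ B.blockProduct quotient M (k ℕ.+ l))
    (≡.sym (gauss-quotient ((k ℕ.+ l) ℕ.* m) (k ℕ.* m)))
    (≡.sym (cong₂ _*_ (blockProduct-quotient M k) (blockProduct-quotient M l)))
    (≡.subst (gauss ((k ℕ.+ l) ℕ.* m) (k ℕ.* m) * (B.blockProduct laurent M k * B.blockProduct laurent M l) ≈_)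
      (≡.sym (blockProduct-quotient M (k ℕ.+ l)))
      (lift (B.factorization laurent M (oneMinusX-cancel M) k l)))

  powL-cong : ∀ {f g} n → f ≈ g → powL f n ≈ pow g n
  powL-cong zero e = refl
  powL-cong (suc n) e = *-cong e (powL-cong n e)

  sumL-∑ : ∀ (f : ℕ → LPoly) (G : ℕ → Carrier) (g : ℕ → ℕ) n → (∀ i → i ℕ.< n → f (g i) ≈ G i) → sumL (map f (applyUpTo g n)) ≈ ∑ G n
  sumL-∑ f G g zero h = refl
  sumL-∑ f G g (suc n) h = +-cong (h 0 ℕ.z<s) (sumL-∑ f (λ i → G (suc i)) (λ i → g (suc i)) n (λ i i<n → h (suc i) (ℕ.s<s i<n)))

  module Statement (λ′ μ : ℕ) (α : BiPoly)
    (homogeneous : ∀ (m n k : ℤ) → evalBi α (m ℤ.* n) (m ℤ.* k) ≡ m ℤ.* m ℤ.* evalBi α n k)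
    (square : ∀ (k : ℤ) → evalBi α 0ℤ k ≡ k ℤ.* k) (n : ℕ) where

    exponent exponent′ : ℕ → ℤ
    exponent k = evalBi α (+ (n ℕ.* m)) (+ k)
    exponent′ j = evalBi α (+ n) (+ j)

    exponent-multiple : ∀ j → exponent (j ℕ.* m) ≡ + (m ℕ.* m) ℤ.* exponent′ j
    exponent-multiple j = ≡.trans (cong₂ (evalBi α) (swap n) (swap j))
      (≡.trans (homogeneous (+ m) (+ n) (+ j)) (cong (ℤ._* exponent′ j) (≡.sym (ℤₚ.pos-* m m))))
      where
      swap : ∀ n → + (n ℕ.* m) ≡ + m ℤ.* + n
      swap n = ≡.trans (ℤₚ.pos-* n m) (ℤₚ.*-comm (+ n) (+ m))

    exponent-residue : ∀ j i → ∃ λ z → exponent (suc (j ℕ.* m ℕ.+ i)) ≡ + suc i ℤ.* + suc i ℤ.+ + m ℤ.* z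
    exponent-residue j i =
      let (z , h) = evalBi-mod α {+ m} {b = 0ℤ} {d = + suc i}
            (+ n , ≡.trans (ℤₚ.pos-* n m) (≡.trans (ℤₚ.*-comm (+ n) (+ m)) (≡.sym (ℤₚ.+-identityˡ _))))
            (+ j , ≡.trans (cong (λ x → 1ℤ ℤ.+ (x ℤ.+ + i)) (ℤₚ.pos-* j m))
              (ℤS.solve 3 (λ j m i → :1ᶻ :+ᶻ (j :*ᶻ m :+ᶻ i) :=ᶻ (:1ᶻ :+ᶻ i) :+ᶻ m :*ᶻ j) ≡.refl (+ j) (+ m) (+ i)))
      in z , ≡.trans h (cong (ℤ._+ + m ℤ.* z) (square (+ suc i)))

    open Congruence quotient M t³≈0 units using (module Summation; module Q²)
    open Summation factors μ n exponent exponent′ exponent-multiple exponent-residue using (summand; summand²; congruence)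

    term : ℕ → ℕ → LPoly
    term n k = monoL (evalBi α (+ n) (+ k)) *L (powL (fromZPoly (qbinom n k)) λ′ *L powL (fromZPoly (qbinom (n ℕ.+ k) k)) μ)

    qbinom≈ : ∀ n k → k ℕ.≤ n → fromZPoly (qbinom n k) ≈ QBinomial.gauss quotient n k
    qbinom≈ n k l = trans (lift (qbinom-gauss n k l)) (sym (reflexive (gauss-quotient n k)))

    gauss-base² : ∀ n k → Q².gauss n k ≡ QBinomial.gauss (rebase (+ (m ℕ.* m)) laurent) n k
    gauss-base² n zero = ≡.refl
    gauss-base² zero (suc k) = ≡.refl
    gauss-base² (suc n) (suc k) = cong₂ (λ a b → X (+ (m ℕ.* m) ℤ.* + suc k) * a + b) (gauss-base² n (suc k)) (gauss-base² n k)

    substPow-qbinom≈ : ∀ n k → k ℕ.≤ n → substPow (+ (m ℕ.* m)) (fromZPoly (qbinom n k)) ≈ Q².gauss n k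
    substPow-qbinom≈ n k l = ≡.subst (substPow (+ (m ℕ.* m)) (fromZPoly (qbinom n k)) ≈_)
      (≡.trans (substPow-gauss (+ (m ℕ.* m)) n k) (≡.sym (gauss-base² n k)))
      -- The first argument is m² - 1, written so that its successor is m * m by computation.
      (lift (substPow-cong (M ℕ.+ M ℕ.* suc M) (fromZPoly (qbinom n k)) (gauss n k) (qbinom-gauss n k l)))

    left : A λ′ μ α (n ℕ.* m) ≈ ∑ (summand λ′) (suc (n ℕ.* m))
    left = sumL-∑ (term (n ℕ.* m)) (summand λ′) (λ k → k) (suc (n ℕ.* m))
      (λ k k≤ → *-*-cong (monoL (exponent k))
        (powL (lower k) λ′) (pow (QBinomial.gauss quotient (n ℕ.* m) k) λ′) (powL (upper k) μ) (pow (QBinomial.gauss quotient (n ℕ.* m ℕ.+ k) k) μ)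
        (powL-cong λ′ (qbinom≈ (n ℕ.* m) k (ℕₚ.≤-pred k≤))) (powL-cong μ (qbinom≈ (n ℕ.* m ℕ.+ k) k (ℕₚ.m≤n+m k (n ℕ.* m)))))
      where
      lower upper : ℕ → LPoly
      lower k = fromZPoly (qbinom (n ℕ.* m) k)
      upper k = fromZPoly (qbinom (n ℕ.* m ℕ.+ k) k)

    right : substPow (+ (m ℕ.* m)) (A λ′ μ α n) ≈ ∑ (summand² λ′) (suc n)
    right = ≡.subst (_≈ ∑ (summand² λ′) (suc n)) (≡.sym (substPow-sum d (term n) (upTo (suc n))))
      (sumL-∑ (λ k → substPow d (term n k)) (summand² λ′) (λ k → k) (suc n)
        (λ k k≤n → ≡.subst (_≈ monoL (d ℤ.* exponent′ k) * (pow (Q².gauss n k) λ′ * pow (Q².gauss (n ℕ.+ k) k) μ)) (≡.sym (split k))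
          (*-*-cong (monoL (d ℤ.* exponent′ k)) (powL (lower k) λ′) (pow (Q².gauss n k) λ′) (powL (upper k) μ) (pow (Q².gauss (n ℕ.+ k) k) μ)
            (powL-cong λ′ (substPow-qbinom≈ n k (ℕₚ.≤-pred k≤n))) (powL-cong μ (substPow-qbinom≈ (n ℕ.+ k) k (ℕₚ.m≤n+m k n))))))
      where
      d = + (m ℕ.* m)
      lower upper : ℕ → LPoly
      lower k = substPow d (fromZPoly (qbinom n k))
      upper k = substPow d (fromZPoly (qbinom (n ℕ.+ k) k))
      split : ∀ k → substPow d (term n k) ≡ monoL (d ℤ.* exponent′ k) *L (powL (lower k) λ′ *L powL (upper k) μ)
      split k = ≡.trans (substPow-* d (monoL (exponent′ k)) (powL (fromZPoly (qbinom n k)) λ′ *L powL (fromZPoly (qbinom (n ℕ.+ k) k)) μ))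
        (cong (monoL (d ℤ.* exponent′ k) *L_)
          (≡.trans (substPow-* d (powL (fromZPoly (qbinom n k)) λ′) (powL (fromZPoly (qbinom (n ℕ.+ k) k)) μ))
            (cong₂ _*L_ (substPow-pow d (fromZPoly (qbinom n k)) λ′) (substPow-pow d (fromZPoly (qbinom (n ℕ.+ k) k)) μ))))

    conclusion : 2 ℕ.≤ λ′ → A λ′ μ α (n ℕ.* m) ≈
      substPow (+ (m ℕ.* m)) (A λ′ μ α n) - ι (((+ (m ℕ.* m)) ℤ.- (+ 1)) ℚ./ 12 ℚ.* R λ′ μ n) * powL t 2
    conclusion 2≤λ = trans left (trans (congruence λ′ 2≤λ)
      (+-cong (sym right) (-‿cong {c * (t * t)} {c * powL t 2} (square-pow c t))))
      where
      c = ι (((+ (m ℕ.* m)) ℤ.- (+ 1)) ℚ./ 12 ℚ.* R λ′ μ n)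

theorem2 : (lam mu : ℕ) → 2 ≤ lam →
    (α : BiPoly) →
    (∀ (m n k : ℤ) → evalBi α (m ℤ.* n) (m ℤ.* k) ≡ m ℤ.* m ℤ.* evalBi α n k) →
    (∀ (k : ℤ) → evalBi α (+ 0) k ≡ k ℤ.* k) →
    (m : ℕ) → 1 ≤ m → (n : ℕ) →
    CongMod (powL (fromZPoly (cyclo m)) 3)
    (A lam mu α (m Data.Nat.* n))
    (substPow (+ (m Data.Nat.* m)) (A lam mu α n)
    -L (constL (((+ (m Data.Nat.* m)) ℤ.- (+ 1)) ℚ./ 12 ℚ.* R lam mu n)
    *L powL (monoL (+ m) -L oneL) 2))
theorem2 lam mu 2≤lam α homogeneous square (suc M) _ n =
  -- The range of k was cut into n blocks of length m, which produces n * m; commutativity restores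
  -- m * n.
  ≡.subst (λ N → CongMod φ (A lam mu α N) rhs) (ℕₚ.*-comm n m) (cofactor , equation)
  where
  open Modulus M
  open Statement lam mu α homogeneous square n
  open Modulo._≈φ_ (conclusion 2≤lam)
  rhs = substPow (+ (m ℕ.* m)) (A lam mu α n) -L (constL (((+ (m ℕ.* m)) ℤ.- (+ 1)) ℚ./ 12 ℚ.* R lam mu n) *L powL (monoL (+ m) -L oneL) 2)
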